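{- Any probabilistic protocol (with common random source) for $\mathrm{EE}_n$ with maximum message size $O(n)$ and error $1/3$ has at least $\log^*n-O(1)$ rounds. That is, for every constant $C>0$ there is a constant $C'$ such that for all $n\ge1$, every probabilistic protocol for $\mathrm{EE}_n$ with error probability at most $1/3$ in which every message has length at most $Cn$ bits has at least $\log^*n-C'$ rounds.
   Context: All logarithms are to base 2. $\log^{(0)}x=x$, $\log^{(r)}x=\log(\log^{(r-1)}x)$; $\log^*x$ is the smallest integer $r$ with $\log^{(r)}x<2$. $[t]=\{1,\dots,t\}$. In the exists-equal problem $\mathrm{EE}_n$ (parameters $n$ and $t=4n$) Alice receives $x\in[t]^n$ and Bob receives $y\in[t]^n$; the value $\mathrm{EE}(x,y)$ is $1$ if there is $i\in[n]$ with $x_i=y_i$, and $0$ otherwise. In an $r$-round protocol the players take at most $r$ turns alternately sending each other a message, and the last player to receive a message declares the output. In a probabilistic protocol the players may base their actions on a common random source; the error probability is the maximum over inputs $(x,y)$ of the probability that the output differs from $\mathrm{EE}(x,y)$. -}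

module Defs where

open import Algebra.Bundles using (CommutativeRing)
import Algebra.Definitions.RawMonoid as RawMonoidDefinitions
open import Data.Bool using (Bool; true; false; not; _∧_; _∨_; _xor_)
open import Data.Fin using (Fin)
import Data.Fin.Properties as Fin
open import Data.Nat using (ℕ; zero; suc; _*_; _^_; _≤_; _<_; _<?_; s≤s; z≤n)
open import Data.Nat.Induction using (<-rec)
open import Data.Nat.Logarithm using (⌊log₂_⌋; ⌊log₂⌋-mono-≤; ⌊log₂[2^n]⌋≡n)
import Data.Nat.Properties as ℕ
open import Data.Product using (∃; _×_; _,_; proj₁; proj₂)
open import Data.Sum using (_⊎_; inj₁; inj₂)
open import Data.Vec using (Vec; lookup)
open import Data.Vec.Bounded using (Vec≤)
open import Function using (const; _∘_)
open import Level using (Level; _⊔_) renaming (suc to lsuc)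
open import Relation.Binary.Core using (Rel)
open import Relation.Binary.PropositionalEquality
  using (_≡_; _≗_; refl; sym; cong; subst)
open import Relation.Binary.Structures using (IsPartialOrder)
open import Relation.Nullary using (¬_; yes; no; does; contradiction)

------------------------------------------------------------------------
-- log*

-- The integer part of log⁽ʳ⁾ x, for every r up to and including the first
-- one with log⁽ʳ⁾ x < 2: for real y ≥ 1 one has ⌊log y⌋ = ⌊log ⌊y⌋⌋, so
-- rounding down at each step is the same as rounding down once at the end.
-- Past that point the real iterate may be undefined; here it is 0.
log^ : ℕ → ℕ → ℕ
log^ zero    x = x
log^ (suc r) x = ⌊log₂ log^ r x ⌋

-- For real y, y < 2 holds exactly when ⌊y⌋ < 2.
IsLog* : ℕ → ℕ → Set
IsLog* n r = log^ r n < 2 × (∀ s → log^ s n < 2 → r ≤ s)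

private
  log^-shift : ∀ r n → log^ (suc r) n ≡ log^ r ⌊log₂ n ⌋
  log^-shift zero    n = refl
  log^-shift (suc r) n = cong ⌊log₂_⌋ (log^-shift r n)

  n<2^n : ∀ n → n < 2 ^ n
  n<2^n zero    = s≤s z≤n
  n<2^n (suc n) =
    ℕ.+-mono-≤ (ℕ.m^n>0 2 n)
      (ℕ.≤-trans (n<2^n n) (ℕ.≤-reflexive (sym (ℕ.+-identityʳ (2 ^ n)))))

  ⌊log₂n⌋<n : ∀ n → ⌊log₂ suc n ⌋ < suc n
  ⌊log₂n⌋<n n = s≤s (ℕ.≤-trans (⌊log₂⌋-mono-≤ (n<2^n n))
                               (ℕ.≤-reflexive (⌊log₂[2^n]⌋≡n n)))

log*-exists : ∀ n → ∃ (IsLog* n)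
log*-exists = <-rec (∃ ∘ IsLog*) step
  where
  step : ∀ n → (∀ {m} → m < n → ∃ (IsLog* m)) → ∃ (IsLog* n)
  step zero    _   = 0 , s≤s z≤n , λ _ _ → z≤n
  step (suc k) rec with suc k <? 2
  ... | yes n<2 = 0 , n<2 , λ _ _ → z≤n
  ... | no  n≮2 with rec (⌊log₂n⌋<n k)
  ...   | r , small , least = suc r , small′ , least′
    where
    small′ : log^ (suc r) (suc k) < 2
    small′ = subst (_< 2) (sym (log^-shift r (suc k))) small

    least′ : ∀ s → log^ s (suc k) < 2 → suc r ≤ s
    least′ zero    n<2 = contradiction n<2 n≮2
    least′ (suc s) p   =
      s≤s (least s (subst (_< 2) (log^-shift s (suc k)) p))

log* : ℕ → ℕ
log* n = proj₁ (log*-exists n)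

------------------------------------------------------------------------
-- Probability

-- The library has no real numbers.  Probabilities take values in an
-- arbitrary ordered commutative ring with 1 ≰ 0; both ℝ and ℚ are such rings.
-- The order need not be total.
record OrderedCommutativeRing (c ℓ₁ ℓ₂ : Level)
  : Set (lsuc (c ⊔ ℓ₁ ⊔ ℓ₂)) where
  field
    commutativeRing : CommutativeRing c ℓ₁
  open CommutativeRing commutativeRing public
    using (Carrier; _≈_; 0#; 1#; +-rawMonoid)
    renaming (_+_ to _+ᴷ_; _*_ to _*ᴷ_)
  infix 4 _≤ᴷ_
  field
    _≤ᴷ_           : Rel Carrier ℓ₂
    isPartialOrder : IsPartialOrder _≈_ _≤ᴷ_
    +-monoˡ-≤      : ∀ z {x y} → x ≤ᴷ y → (x +ᴷ z) ≤ᴷ (y +ᴷ z)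
    *-nonneg       : ∀ {x y} → 0# ≤ᴷ x → 0# ≤ᴷ y → 0# ≤ᴷ (x *ᴷ y)
    0≤1            : 0# ≤ᴷ 1#
    1≰0            : ¬ (1# ≤ᴷ 0#)

-- Events are given by their indicator functions; only those satisfying
-- IsEvent have a probability.  Finite additivity is all that is asked, so
-- every σ-additive probability space is covered.
record ProbabilitySpace {c ℓ₁ ℓ₂ : Level}
  (K : OrderedCommutativeRing c ℓ₁ ℓ₂) (a e : Level)
  : Set (c ⊔ ℓ₁ ⊔ ℓ₂ ⊔ lsuc (a ⊔ e)) where
  open OrderedCommutativeRing K
  field
    Ω            : Set a
    IsEvent      : (Ω → Bool) → Set e
    IsEvent-resp : ∀ {A B} → A ≗ B → IsEvent A → IsEvent B
    full         : IsEvent (const true)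
    complement   : ∀ {A} → IsEvent A → IsEvent (not ∘ A)
    union        : ∀ {A B} → IsEvent A → IsEvent B →
                   IsEvent (λ ω → A ω ∨ B ω)

    Pr          : ∀ {A} → IsEvent A → Carrier
    Pr-cong     : ∀ {A B} → A ≗ B → (p : IsEvent A) (q : IsEvent B) →
                  Pr p ≈ Pr q
    Pr-nonneg   : ∀ {A} (p : IsEvent A) → 0# ≤ᴷ Pr p
    Pr-full     : Pr full ≈ 1#
    Pr-additive : ∀ {A B} (p : IsEvent A) (q : IsEvent B) →
                  (∀ ω → A ω ∧ B ω ≡ false) →
                  Pr (union p q) ≈ (Pr p +ᴷ Pr q)

------------------------------------------------------------------------
-- Protocols

-- A message of at most b bits.
Message : ℕ → Set
Message b = Vec≤ Bool b

-- Protocol X Y b r: deterministic protocols with at most r turns and messages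
-- of at most b bits, where the player about to act holds an input from X and
-- the other player one from Y.  A player who does not send a message declares
-- the output, which ends the protocol.  What follows a message depends on
-- earlier turns only through the messages, which both players have seen.
data Protocol (X Y : Set) (b : ℕ) : ℕ → Set where
  declare : ∀ {r} → (X → Bool) → Protocol X Y b r
  act     : ∀ {r} → (X → Bool ⊎ Message b) →
            (Message b → Protocol Y X b r) → Protocol X Y b (suc r)

run : ∀ {X Y b r} → Protocol X Y b r → X → Y → Bool
run (declare out) x y = out x
run (act move next) x y with move x
... | inj₁ o = o
... | inj₂ m = run (next m) y x

data Player : Set where
  alice bob : Player

-- Alice's inputs are in X, Bob's in Y; either of them may be the one to start.
StartedBy : Player → (X Y : Set) (b r : ℕ) → Set
StartedBy alice X Y b r = Protocol X Y b r
StartedBy bob   X Y b r = Protocol Y X b r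

output : ∀ first {X Y b r} → StartedBy first X Y b r → X → Y → Bool
output alice π x y = run π x y
output bob   π x y = run π y x

module _ {c ℓ₁ ℓ₂ a e : Level} {K : OrderedCommutativeRing c ℓ₁ ℓ₂}
         (S : ProbabilitySpace K a e) where
  open OrderedCommutativeRing K
  open ProbabilitySpace S
  open RawMonoidDefinitions +-rawMonoid using () renaming (_×_ to _×ᴷ_)

  -- Once the common random source has been sampled the players are
  -- deterministic.
  record ProbabilisticProtocol (X Y : Set) (b r : ℕ) : Set (a ⊔ e) where
    field
      first      : Player
      protocol   : Ω → StartedBy first X Y b r
      measurable : ∀ x y → IsEvent (λ ω → output first (protocol ω) x y)

  module _ {X Y : Set} {b r : ℕ} (f : X → Y → Bool)
           (Π : ProbabilisticProtocol X Y b r) where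
    open ProbabilisticProtocol Π

    errorEvent : ∀ x y → IsEvent (λ ω → f x y xor output first (protocol ω) x y)
    errorEvent x y with f x y
    ... | true  = complement (measurable x y)
    ... | false = measurable x y

    -- 3 p ≤ 1 stands for p ≤ 1/3, since K need not have division.
    Error≤⅓ : Set ℓ₂
    Error≤⅓ = ∀ x y → (3 ×ᴷ Pr (errorEvent x y)) ≤ᴷ 1#

------------------------------------------------------------------------
-- The exists-equal problem

EEInput : ℕ → Set
EEInput n = Vec (Fin (4 * n)) n

EE : ∀ n → EEInput n → EEInput n → Bool
EE n x y = does (Fin.any? (λ i → lookup x i Fin.≟ lookup y i))

{-# OPTIONS --safe #-}
module Submission where

-- Let y be a noisy copy of x: each coordinate is copied from x with probability
-- θ = N/n and uniform otherwise.  Then x and y agree somewhere with probability at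
-- least 1 − 1/N, while independent x and y do so with probability at most 1/4.  It
-- therefore suffices to show that a deterministic protocol rejects noisy copies, up
-- to O(1/N), at least as often as independent pairs.  This holds with r rounds if n
-- exceeds a tower of height r + O(1), by elimination of the first message.
--
-- Given that message, x has density 2^-O(n).  Exposing its coordinates one by one,
-- all but n/N² of them are light: the value taken is at most K = 2^O(N²) times
-- likelier than under the uniform distribution.  Hence x can be sampled from a
-- uniform z such that light coordinates agree with probability α = 1/2K each.  The
-- remaining coordinates must be corrected in order to keep z uniform, but in a noisy
-- copy of z with parameter θ/α these corrections are of order Kθ, independent
-- and of mean 0, so that this copy is in χ² close to a noisy copy of x with
-- parameter θ.  The first player can thus start from z, sample x and omit the message:
-- a protocol with one round less remains, with 2KN in place of N.
--
-- Everything is stated for averages over all inputs, which are finite in number; the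
-- resulting bound on weighted error counts is integrated over the random source.

open import Defs

open import Algebra.Bundles using (CommutativeRing)
import Algebra.Properties.CommutativeMonoid.Mult as Mult
import Algebra.Properties.Group as GroupProperties
import Algebra.Solver.Ring as RingSolver
open import Algebra.Solver.Ring.AlmostCommutativeRing
  using (AlmostCommutativeRing; fromCommutativeRing; _-Raw-AlmostCommutative⟶_)
open import Algebra.Structures using (IsCommutativeRing)
open import Data.Bool using (Bool; true; false; if_then_else_; not; _∧_; _∨_; _xor_)
import Data.Bool.Properties as Bool
open import Data.Fin using (Fin; zero; suc)
import Data.Fin.Properties as Fin
import Data.Integer as ℤ
open import Data.List as List using (List; []; _∷_; _++_)
open import Data.Nat as ℕ using (ℕ; zero; suc)
import Data.Nat.DivMod as ℕ
open import Data.Nat.Induction using (<-rec)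
open import Data.Nat.Logarithm
  using (⌊log₂_⌋; ⌊log₂⌋-mono-≤; ⌊log₂⌊n/2⌋⌋≡⌊log₂n⌋∸1; ⌊log₂[2^n]⌋≡n)
import Data.Nat.Properties as ℕ
import Data.Nat.Tactic.RingSolver as ℕ-Solver
open import Data.Product using (∃; ∃-syntax; _×_; _,_; proj₁; proj₂)
open import Data.Rational as ℚ using (ℚ; 0ℚ; 1ℚ; _≤_; _<_)
open import Data.Rational.Properties as ℚ using (≤-refl; ≤-trans; ≤-reflexive; module ≤-Reasoning)
open import Data.Sum using (_⊎_; inj₁; inj₂; [_,_]′)
open import Data.Vec as Vec using (Vec; []; _∷_; lookup)
open import Data.Vec.Bounded using (_,_; isBounded)
import Data.Vec.Properties as Vec
open import Function using (_∘_)
open import Level using (Level; 0ℓ)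
open import Relation.Binary.PropositionalEquality
  using (_≡_; _≗_; refl; sym; trans; cong; cong₂; subst; subst₂; module ≡-Reasoning)
import Relation.Binary.Reasoning.Setoid as SetoidReasoning
open import Relation.Binary.Structures using (IsPartialOrder)
open import Relation.Nullary using (¬_; Dec; yes; no; does; contradiction)
open import Relation.Nullary.Decidable using (toWitness)
open import Relation.Nullary.Decidable.Core using (dec⇒maybe)

-- The obstacle is that a player's input is no longer uniform once a message is known, while a noisy
-- copy needs a uniform starting point. Each player therefore holds a uniform reference input and
-- draws the input of the protocol from it by a kernel. Kernels are not normalised: conditioning on
-- a message splits a kernel into pieces whose masses add up again, all losses are linear in these
-- masses, and unlikely messages need no separate treatment. A kernel is only asked to have the same
-- mass at every reference input; the corrections in `tilt` preserve exactly this. Independent pairs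
-- are noisy copies with parameter 0 and are resampled without any loss, so only the noisy side has
-- to be estimated, and only in one direction. There the point masses of the copies, of order t,
-- would ruin a second moment; they occur identically in the tilt and in the noise and cancel in the
-- difference, which leaves a quantity bounded in terms of `K` alone.

infixl 6 _+_ _-_
infixl 7 _*_
infix  8 -_

-- Opaque copies of the operations of ℚ: unification can then solve a * b = c * d for a and b.
opaque
  _+_ _*_ : ℚ → ℚ → ℚ
  _+_ = ℚ._+_
  _*_ = ℚ._*_

  -_ : ℚ → ℚ
  -_ = ℚ.-_

_-_ : ℚ → ℚ → ℚ
a - b = a + (- b)

opaque
  unfolding _+_

  +-*-isCommutativeRing : IsCommutativeRing _≡_ _+_ _*_ -_ 0ℚ 1ℚ
  +-*-isCommutativeRing = ℚ.+-*-isCommutativeRing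

+-*-commutativeRing : CommutativeRing 0ℓ 0ℓ
+-*-commutativeRing = record { isCommutativeRing = +-*-isCommutativeRing }

almostCommutativeRing : AlmostCommutativeRing 0ℓ 0ℓ
almostCommutativeRing = fromCommutativeRing +-*-commutativeRing

opaque
  unfolding _+_

  +-homo : ∀ a b → a ℚ.+ b ≡ a + b
  +-homo a b = refl

  *-homo : ∀ a b → a ℚ.* b ≡ a * b
  *-homo a b = refl

  -‿homo : ∀ a → ℚ.- a ≡ - a
  -‿homo a = refl

coefficients :
  CommutativeRing.rawRing ℚ.+-*-commutativeRing -Raw-AlmostCommutative⟶ almostCommutativeRing
coefficients = record
  { ⟦_⟧    = λ a → a
  ; +-homo = +-homo
  ; *-homo = *-homo
  ; -‿homo = -‿homo
  ; 0-homo = refl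
  ; 1-homo = refl
  }

open RingSolver _ _ coefficients (λ a b → dec⇒maybe (a ℚ.≟ b))
  using (solve; con; _:+_; _:*_; _:-_; _:=_; :-_)

open CommutativeRing +-*-commutativeRing
  using (+-comm; +-assoc; +-identityˡ; +-identityʳ; -‿inverseʳ;
         *-comm; *-assoc; *-identityˡ; *-identityʳ; zeroˡ; zeroʳ; distribˡ)

+-congˡ : ∀ {a b c} → b ≡ c → a + b ≡ a + c
+-congˡ {a} = cong (a +_)

*-congˡ : ∀ {a b c} → b ≡ c → a * b ≡ a * c
*-congˡ {a} = cong (a *_)

*-congʳ : ∀ {a b c} → b ≡ c → b * a ≡ c * a
*-congʳ {a} = cong (_* a)

-- Inequalities, reciprocals and powers in ℚ

opaque
  unfolding _+_

  +-mono-≤ : ∀ {a b c d} → a ≤ b → c ≤ d → a + c ≤ b + d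
  +-mono-≤ = ℚ.+-mono-≤

  *-monoˡ : ∀ {a b} c → 0ℚ ≤ c → a ≤ b → c * a ≤ c * b
  *-monoˡ c 0≤c = ℚ.*-monoˡ-≤-nonNeg c ⦃ ℚ.nonNegative 0≤c ⦄

  *-monoˡ-< : ∀ {a b} c → 0ℚ < c → a < b → c * a < c * b
  *-monoˡ-< c 0<c = ℚ.*-monoʳ-<-pos c ⦃ ℚ.positive 0<c ⦄

  *-cancelˡ : ∀ {a b} c → 0ℚ < c → c * a ≤ c * b → a ≤ b
  *-cancelˡ c 0<c = ℚ.*-cancelˡ-≤-pos c ⦃ ℚ.positive 0<c ⦄

  inv : ∀ a → 0ℚ < a → ℚ
  inv a 0<a = (ℚ.1/ a) ⦃ ℚ.pos⇒nonZero a ⦃ ℚ.positive 0<a ⦄ ⦄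

  *-inv : ∀ a (0<a : 0ℚ < a) → a * inv a 0<a ≡ 1ℚ
  *-inv a 0<a = ℚ.*-inverseʳ a ⦃ ℚ.pos⇒nonZero a ⦃ ℚ.positive 0<a ⦄ ⦄

  0<inv : ∀ a (0<a : 0ℚ < a) → 0ℚ < inv a 0<a
  0<inv a 0<a = ℚ.positive⁻¹ _ ⦃ ℚ.1/pos⇒pos a ⦃ ℚ.positive 0<a ⦄ ⦄

opaque
  _≤?_ : ∀ a b → Dec (a ≤ b)
  _≤?_ = ℚ._≤?_

  _<?_ : ∀ a b → Dec (a < b)
  _<?_ = ℚ._<?_

0≤inv : ∀ a (0<a : 0ℚ < a) → 0ℚ ≤ inv a 0<a
0≤inv a 0<a = ℚ.<⇒≤ (0<inv a 0<a)

+-monoʳ : ∀ {a b} c → a ≤ b → c + a ≤ c + b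
+-monoʳ c = +-mono-≤ ≤-refl

+-monoˡ : ∀ {a b} c → a ≤ b → a + c ≤ b + c
+-monoˡ c a≤b = +-mono-≤ a≤b ≤-refl

2ℚ : ℚ
2ℚ = 1ℚ ℚ.+ 1ℚ

0≤2 : 0ℚ ≤ 2ℚ
0≤2 = ℚ.nonNegative⁻¹ 2ℚ

1≤2 : 1ℚ ≤ 2ℚ
1≤2 = ≤-trans (≤-reflexive (sym (+-identityʳ 1ℚ))) (≤-trans (+-monoʳ 1ℚ (ℚ.nonNegative⁻¹ 1ℚ))
    (≤-reflexive (solve 0 (con 1ℚ :+ con 1ℚ := con 2ℚ) refl)))

≤-slack : ∀ {a b} d → 0ℚ ≤ d → a + d ≡ b → a ≤ b
≤-slack {a} {b} d 0≤d eq = begin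
  a       ≡⟨ +-identityʳ a ⟨
  a + 0ℚ  ≤⟨ +-monoʳ a 0≤d ⟩
  a + d   ≡⟨ eq ⟩
  b       ∎
  where open ≤-Reasoning

slack : ∀ {a b} → a ≤ b → 0ℚ ≤ b - a
slack {a} {b} a≤b = begin
  0ℚ     ≡⟨ -‿inverseʳ a ⟨
  a - a  ≤⟨ +-monoˡ (- a) a≤b ⟩
  b - a  ∎
  where open ≤-Reasoning

0≤1 : 0ℚ ≤ 1ℚ
0≤1 = ℚ.nonNegative⁻¹ 1ℚ

0≤+ : ∀ {a b} → 0ℚ ≤ a → 0ℚ ≤ b → 0ℚ ≤ a + b
0≤+ 0≤a 0≤b = ≤-trans (≤-reflexive (sym (+-identityˡ 0ℚ))) (+-mono-≤ 0≤a 0≤b)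

*-monoʳ : ∀ {a b} c → 0ℚ ≤ c → a ≤ b → a * c ≤ b * c
*-monoʳ {a} {b} c 0≤c a≤b = subst₂ _≤_ (*-comm c a) (*-comm c b) (*-monoˡ c 0≤c a≤b)

0≤* : ∀ {a b} → 0ℚ ≤ a → 0ℚ ≤ b → 0ℚ ≤ a * b
0≤* {a} {b} 0≤a 0≤b = ≤-trans (≤-reflexive (sym (zeroʳ a))) (*-monoˡ a 0≤a 0≤b)

*-mono : ∀ {a b c d} → 0ℚ ≤ c → 0ℚ ≤ b → a ≤ b → c ≤ d → a * c ≤ b * d
*-mono {b = b} {c} 0≤c 0≤b a≤b c≤d = ≤-trans (*-monoʳ c 0≤c a≤b) (*-monoˡ b 0≤b c≤d)

0≤a² : ∀ a → 0ℚ ≤ a * a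
0≤a² a with ℚ.≤-total 0ℚ a
... | inj₁ 0≤a = 0≤* 0≤a 0≤a
... | inj₂ a≤0 = subst (0ℚ ≤_) (solve 1 (λ a → (con 0ℚ :- a) :* (con 0ℚ :- a) := a :* a) refl a)
                       (0≤* (slack a≤0) (slack a≤0))

infixr 8 _^_
_^_ : ℚ → ℕ → ℚ
a ^ zero  = 1ℚ
a ^ suc n = a * a ^ n

0≤^ : ∀ {a} n → 0ℚ ≤ a → 0ℚ ≤ a ^ n
0≤^ zero    0≤a = 0≤1
0≤^ (suc n) 0≤a = 0≤* 0≤a (0≤^ n 0≤a)

1≤^ : ∀ {a} n → 1ℚ ≤ a → 1ℚ ≤ a ^ n
1≤^ zero    1≤a = ≤-refl
1≤^ {a} (suc n) 1≤a = begin
  1ℚ         ≤⟨ 1≤a ⟩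
  a          ≡⟨ *-identityʳ a ⟨
  a * 1ℚ     ≤⟨ *-monoˡ a (≤-trans 0≤1 1≤a) (1≤^ n 1≤a) ⟩
  a * a ^ n  ∎
  where open ≤-Reasoning

^-monoˡ : ∀ {a b} n → 0ℚ ≤ a → a ≤ b → a ^ n ≤ b ^ n
^-monoˡ zero    0≤a a≤b = ≤-refl
^-monoˡ (suc n) 0≤a a≤b = *-mono (0≤^ n 0≤a) (≤-trans 0≤a a≤b) a≤b (^-monoˡ n 0≤a a≤b)

^-monoʳ : ∀ {a m n} → 1ℚ ≤ a → m ℕ.≤ n → a ^ m ≤ a ^ n
^-monoʳ {n = n} 1≤a ℕ.z≤n = 1≤^ n 1≤a
^-monoʳ {a} 1≤a (ℕ.s≤s m≤n) = *-monoˡ a (≤-trans 0≤1 1≤a) (^-monoʳ 1≤a m≤n)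

^-+ : ∀ a m n → a ^ (m ℕ.+ n) ≡ a ^ m * a ^ n
^-+ a zero    n = sym (*-identityˡ _)
^-+ a (suc m) n = trans (cong (a *_) (^-+ a m n)) (sym (*-assoc a _ _))


ι : ℕ → ℚ
ι zero    = 0ℚ
ι (suc n) = 1ℚ + ι n

0≤ι : ∀ n → 0ℚ ≤ ι n
0≤ι zero    = ≤-refl
0≤ι (suc n) = 0≤+ 0≤1 (0≤ι n)

ι-mono : ∀ {m n} → m ℕ.≤ n → ι m ≤ ι n
ι-mono {n = n} ℕ.z≤n = 0≤ι n
ι-mono (ℕ.s≤s m≤n) = +-monoʳ 1ℚ (ι-mono m≤n)

-- Irrelevance of the argument makes the reciprocals `inv (ι n) (0<ι p)` for different proofs `p`
-- definitionally equal.
0<ι : ∀ {n} → .(0 ℕ.< n) → 0ℚ < ι n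
0<ι {suc n} _ = ℚ.<-≤-trans (ℚ.positive⁻¹ 1ℚ) (≤-trans (≤-reflexive (sym (+-identityʳ 1ℚ)))
    (+-monoʳ 1ℚ (0≤ι n)))

ι-+ : ∀ m n → ι (m ℕ.+ n) ≡ ι m + ι n
ι-+ zero    n = sym (+-identityˡ _)
ι-+ (suc m) n = trans (cong (1ℚ +_) (ι-+ m n)) (sym (+-assoc 1ℚ (ι m) (ι n)))

ι-∸ : ∀ {m n} → m ℕ.≤ n → ι (n ℕ.∸ m) ≡ ι n - ι m
ι-∸ {m} {n} m≤n = begin
  ι (n ℕ.∸ m)                  ≡⟨ solve 2 (λ a b → a := a :+ b :- b) refl (ι (n ℕ.∸ m)) (ι m) ⟩
  ι (n ℕ.∸ m) + ι m - ι m      ≡⟨ cong (_- ι m) (trans (sym (ι-+ (n ℕ.∸ m) m))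
      (cong ι (ℕ.m∸n+n≡m m≤n))) ⟩
  ι n - ι m                    ∎
  where open ≡-Reasoning

ι-* : ∀ m n → ι (m ℕ.* n) ≡ ι m * ι n
ι-* zero    n = sym (zeroˡ (ι n))
ι-* (suc m) n = begin
  ι (n ℕ.+ m ℕ.* n)   ≡⟨ ι-+ n _ ⟩
  ι n + ι (m ℕ.* n)   ≡⟨ cong (ι n +_) (ι-* m n) ⟩
  ι n + ι m * ι n     ≡⟨ solve 2 (λ a b → a :+ b :* a := (con 1ℚ :+ b) :* a) refl (ι n) (ι m) ⟩
  (1ℚ + ι m) * ι n    ∎
  where open ≡-Reasoning

ι-^ : ∀ m n → ι (m ℕ.^ n) ≡ ι m ^ n
ι-^ m zero    = +-identityʳ 1ℚ
ι-^ m (suc n) = trans (ι-* m (m ℕ.^ n)) (cong (ι m *_) (ι-^ m n))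

ι-cancel-< : ∀ {m n} → ι m < ι n → m ℕ.< n
ι-cancel-< {m} {n} lt with m ℕ.<? n
... | yes p = p
... | no ¬p = contradiction (ℚ.<-≤-trans lt (ι-mono (ℕ.≮⇒≥ ¬p))) (ℚ.<-irrefl refl)

-- Bernoulli's inequality in reverse. Doubling the slope leaves room `x` at each step for the cross
-- term `2ℚ * (ι n * x) * x`, which is at most `x` by the smallness assumption.
bernoulli : ∀ x n → 0ℚ ≤ x → 2ℚ * (ι n * x) ≤ 1ℚ → (1ℚ + x) ^ n ≤ 1ℚ + 2ℚ * (ι n * x)
bernoulli x zero    0≤x _ =
  ≤-reflexive (solve 1 (λ x → con 1ℚ := con 1ℚ :+ con 2ℚ :* (con 0ℚ :* x)) refl x)
bernoulli x (suc n) 0≤x small = begin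
  (1ℚ + x) * (1ℚ + x) ^ n
    ≤⟨ *-monoˡ _ (0≤+ 0≤1 0≤x) (bernoulli x n 0≤x small′) ⟩
  (1ℚ + x) * (1ℚ + 2ℚ * y)
    ≤⟨ ≤-slack _ (0≤* 0≤x (slack small′))
         (solve 2 (λ x a → (con 1ℚ :+ x) :* (con 1ℚ :+ con 2ℚ :* (a :* x)) :+ x :*
             (con 1ℚ :- con 2ℚ :* (a :* x))
                        := con 1ℚ :+ con 2ℚ :* ((con 1ℚ :+ a) :* x)) refl x (ι n)) ⟩
  1ℚ + 2ℚ * ((1ℚ + ι n) * x)
    ∎
  where
  open ≤-Reasoning
  y = ι n * x
  small′ : 2ℚ * y ≤ 1ℚ
  small′ = ≤-trans (*-monoˡ 2ℚ 0≤2 (*-monoʳ x 0≤x (ι-mono (ℕ.n≤1+n n)))) small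

-- Finite averages and point masses

record IsMean {A : Set} (M : (A → ℚ) → ℚ) : Set where
  field
    cong-≗ : ∀ {f g} → f ≗ g → M f ≡ M g
    add    : ∀ f g → M (λ a → f a + g a) ≡ M f + M g
    scale  : ∀ c f → M (λ a → c * f a) ≡ c * M f
    mono   : ∀ {f g} → (∀ a → f a ≤ g a) → M f ≤ M g
    unit   : M (λ _ → 1ℚ) ≡ 1ℚ

  const : ∀ c → M (λ _ → c) ≡ c
  const c = begin
    M (λ _ → c)       ≡⟨ cong-≗ (λ _ → sym (*-identityʳ c)) ⟩
    M (λ _ → c * 1ℚ)  ≡⟨ scale c _ ⟩
    c * M (λ _ → 1ℚ)  ≡⟨ cong (c *_) unit ⟩
    c * 1ℚ            ≡⟨ *-identityʳ c ⟩
    c                 ∎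
    where open ≡-Reasoning

  scaleʳ : ∀ f c → M (λ a → f a * c) ≡ M f * c
  scaleʳ f c = begin
    M (λ a → f a * c)  ≡⟨ cong-≗ (λ a → *-comm (f a) c) ⟩
    M (λ a → c * f a)  ≡⟨ scale c f ⟩
    c * M f            ≡⟨ *-comm c (M f) ⟩
    M f * c            ∎
    where open ≡-Reasoning

  sub : ∀ f g → M (λ a → f a - g a) ≡ M f - M g
  sub f g = begin
    M (λ a → f a - g a)             ≡⟨ cong-≗ (λ a → cong (f a +_) (eq (g a))) ⟩
    M (λ a → f a + (- 1ℚ) * g a)    ≡⟨ add f _ ⟩
    M f + M (λ a → (- 1ℚ) * g a)    ≡⟨ cong (M f +_) (scale (- 1ℚ) g) ⟩
    M f + (- 1ℚ) * M g              ≡⟨ cong (M f +_) (eq (M g)) ⟨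
    M f - M g                       ∎
    where
    open ≡-Reasoning
    eq = solve 1 (λ x → :- x := (:- con 1ℚ) :* x) refl

  nonneg : ∀ {f} → (∀ a → 0ℚ ≤ f a) → 0ℚ ≤ M f
  nonneg {f} 0≤f = ≤-trans (≤-reflexive (sym (const 0ℚ))) (mono 0≤f)

  bounded : ∀ {f c} → (∀ a → f a ≤ c) → M f ≤ c
  bounded {f} {c} f≤c = ≤-trans (mono f≤c) (≤-reflexive (const c))

∑ : ∀ m → (Fin m → ℚ) → ℚ
∑ zero    f = 0ℚ
∑ (suc m) f = f zero + ∑ m (f ∘ suc)

∑-cong : ∀ m {f g} → f ≗ g → ∑ m f ≡ ∑ m g
∑-cong zero    f≗g = refl
∑-cong (suc m) f≗g = cong₂ _+_ (f≗g zero) (∑-cong m (f≗g ∘ suc))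

∑-add : ∀ m f g → ∑ m (λ a → f a + g a) ≡ ∑ m f + ∑ m g
∑-add zero    f g = sym (+-identityˡ 0ℚ)
∑-add (suc m) f g = trans (+-congˡ (∑-add m (f ∘ suc) (g ∘ suc))) (eq _ _ _ _)
  where
  eq = solve 4 (λ a b c d → (a :+ b) :+ (c :+ d) := (a :+ c) :+ (b :+ d)) refl

∑-scale : ∀ m c f → ∑ m (λ a → c * f a) ≡ c * ∑ m f
∑-scale zero    c f = sym (zeroʳ c)
∑-scale (suc m) c f = trans (+-congˡ (∑-scale m c (f ∘ suc))) (sym (distribˡ c _ _))

∑-mono : ∀ m {f g} → (∀ a → f a ≤ g a) → ∑ m f ≤ ∑ m g
∑-mono zero    f≤g = ≤-refl
∑-mono (suc m) f≤g = +-mono-≤ (f≤g zero) (∑-mono m (f≤g ∘ suc))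

∑-const : ∀ m c → ∑ m (λ _ → c) ≡ ι m * c
∑-const zero    c = sym (zeroˡ c)
∑-const (suc m) c = trans (cong (c +_) (∑-const m c)) (eq c (ι m))
  where
  eq = solve 2 (λ c d → c :+ d :* c := (con 1ℚ :+ d) :* c) refl

∑-swap : ∀ {A : Set} {M : (A → ℚ) → ℚ} → IsMean M → ∀ m (f : Fin m → A → ℚ) →
         ∑ m (λ v → M (f v)) ≡ M (λ a → ∑ m (λ v → f v a))
∑-swap mean zero    f = sym (IsMean.const mean 0ℚ)
∑-swap mean (suc m) f =
  trans (+-congˡ (∑-swap mean m (f ∘ suc))) (sym (IsMean.add mean _ _))

∑-point : ∀ {m} c (v : Fin m) (f : Fin m → ℚ) → ∑ m (λ u → (if does (v Fin.≟ u) then c else 0ℚ) * f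
    u) ≡ c * f v
∑-point {suc m} c zero    f = trans (+-congˡ (trans (∑-cong m (λ u → zeroˡ (f (suc u))))
    (trans (∑-const m 0ℚ) (zeroʳ (ι m))))) (+-identityʳ _)
∑-point {suc m} c (suc v) f = trans (cong₂ _+_ (zeroˡ (f zero)) (∑-point c v (f ∘ suc)))
    (+-identityˡ _)

-- The density of u with respect to the uniform distribution when u is known to be v.
δ : ∀ {t} → Fin t → Fin t → ℚ
δ {t} v u = if does (v Fin.≟ u) then ι t else 0ℚ

0≤δ : ∀ {t} (v u : Fin t) → 0ℚ ≤ δ v u
0≤δ {t} v u with does (v Fin.≟ u)
... | true  = 0≤ι t
... | false = ≤-refl

δ≤ : ∀ {t} (v u : Fin t) → δ v u ≤ ι t
δ≤ {t} v u with does (v Fin.≟ u)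
... | true  = ≤-refl
... | false = 0≤ι t

δ-sym : ∀ {t} (v u : Fin t) → δ v u ≡ δ u v
δ-sym v u with v Fin.≟ u | u Fin.≟ v
... | yes _   | yes _   = refl
... | no  _   | no  _   = refl
... | yes v≡u | no  u≢v = contradiction (sym v≡u) u≢v
... | no  v≢u | yes u≡v = contradiction (sym u≡v) v≢u

module Uniform (t : ℕ) (0<t : 0 ℕ.< t) where

  avg : (Fin t → ℚ) → ℚ
  avg f = inv (ι t) (0<ι 0<t) * ∑ t f

  avg-isMean : IsMean avg
  avg-isMean = record
    { cong-≗ = λ f≗g → *-congˡ (∑-cong t f≗g)
    ; add    = λ f g → trans (*-congˡ (∑-add t f g)) (distribˡ _ _ _)
    ; scale  = λ c f → trans (*-congˡ (∑-scale t c f)) (eq _ c _)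
    ; mono   = λ f≤g → *-monoˡ _ (0≤inv _ _) (∑-mono t f≤g)
    ; unit   = trans (*-congˡ (trans (∑-const t 1ℚ) (*-identityʳ (ι t))))
                     (trans (*-comm _ (ι t)) (*-inv (ι t) (0<ι 0<t)))
    }
    where
    eq = solve 3 (λ a b c → a :* (b :* c) := b :* (a :* c)) refl

  avg-swap : ∀ {A : Set} {M : (A → ℚ) → ℚ} → IsMean M → (f : Fin t → A → ℚ) →
             avg (λ v → M (f v)) ≡ M (λ a → avg (λ v → f v a))
  avg-swap mean f = trans (*-congˡ (∑-swap mean t f)) (sym (IsMean.scale mean _ _))

  avg-δ : ∀ v (f : Fin t → ℚ) → avg (λ u → δ v u * f u) ≡ f v
  avg-δ v f = begin
    avg (λ u → δ v u * f u)           ≡⟨ *-congˡ (∑-point (ι t) v f) ⟩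
    inv (ι t) (0<ι 0<t) * (ι t * f v) ≡⟨ eq _ (ι t) (f v) ⟩
    ι t * inv (ι t) (0<ι 0<t) * f v   ≡⟨ cong (_* f v) (*-inv (ι t) (0<ι 0<t)) ⟩
    1ℚ * f v                          ≡⟨ *-identityˡ (f v) ⟩
    f v                               ∎
    where
    open ≡-Reasoning
    eq = solve 3 (λ a b c → a :* (b :* c) := (b :* a) :* c) refl

  avg-δ-unit : ∀ v → avg (δ v) ≡ 1ℚ
  avg-δ-unit v = trans (IsMean.cong-≗ avg-isMean (λ u → sym (*-identityʳ (δ v u))))
      (avg-δ v (λ _ → 1ℚ))

  E : ∀ n → (Vec (Fin t) n → ℚ) → ℚ
  E zero    f = f []
  E (suc n) f = avg (λ v → E n (λ vs → f (v ∷ vs)))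

  E-isMean : ∀ n → IsMean (E n)
  E-isMean zero    = record
    { cong-≗ = λ f≗g → f≗g []
    ; add    = λ f g → refl
    ; scale  = λ c f → refl
    ; mono   = λ f≤g → f≤g []
    ; unit   = refl
    }
  E-isMean (suc n) = record
    { cong-≗ = λ f≗g → avg.cong-≗ (λ v → rec.cong-≗ (λ vs → f≗g (v ∷ vs)))
    ; add    = λ f g → trans (avg.cong-≗ (λ v → rec.add _ _)) (avg.add _ _)
    ; scale  = λ c f → trans (avg.cong-≗ (λ v → rec.scale c _)) (avg.scale c _)
    ; mono   = λ f≤g → avg.mono (λ v → rec.mono (λ vs → f≤g (v ∷ vs)))
    ; unit   = trans (avg.cong-≗ (λ v → rec.unit)) avg.unit
    }
    where
    module avg = IsMean avg-isMean
    module rec = IsMean (E-isMean n)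

  E-swap : ∀ {A : Set} {M : (A → ℚ) → ℚ} → IsMean M → ∀ n (f : Vec (Fin t) n → A → ℚ) →
           E n (λ v → M (f v)) ≡ M (λ a → E n (λ v → f v a))
  E-swap mean zero    f = refl
  E-swap mean (suc n) f =
    trans (IsMean.cong-≗ avg-isMean (λ v → E-swap mean n (λ vs → f (v ∷ vs)))) (avg-swap mean _)

  E-product : ∀ n (f : Fin t → ℚ) (g : Vec (Fin t) n → ℚ) →
              avg (λ v → E n (λ vs → f v * g vs)) ≡ avg f * E n g
  E-product n f g = trans (IsMean.cong-≗ avg-isMean (λ v → IsMean.scale (E-isMean n) (f v) g))
                          (IsMean.scaleʳ avg-isMean f (E n g))

  Δ : ∀ {n} → Vec (Fin t) n → Vec (Fin t) n → ℚ
  Δ []       []       = 1ℚ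
  Δ (v ∷ vs) (u ∷ us) = δ v u * Δ vs us

  0≤Δ : ∀ {n} (v u : Vec (Fin t) n) → 0ℚ ≤ Δ v u
  0≤Δ []       []       = 0≤1
  0≤Δ (v ∷ vs) (u ∷ us) = 0≤* (0≤δ v u) (0≤Δ vs us)

  Δ-bound : ∀ {n} (v u : Vec (Fin t) n) → Δ v u ≤ ι t ^ n
  Δ-bound []       []       = ≤-refl
  Δ-bound (v ∷ vs) (u ∷ us) = *-mono (0≤Δ vs us) (0≤ι t) (δ≤ v u) (Δ-bound vs us)

  E-Δ : ∀ {n} (v : Vec (Fin t) n) (f : Vec (Fin t) n → ℚ) → E n (λ u → Δ v u * f u) ≡ f v
  E-Δ         []       f = *-identityˡ (f [])
  E-Δ {suc n} (v ∷ vs) f = begin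
    avg (λ u → E n (λ us → δ v u * Δ vs us * f (u ∷ us)))
      ≡⟨ avg.cong-≗ (λ u → rec.cong-≗ (λ us → *-assoc (δ v u) (Δ vs us) _)) ⟩
    avg (λ u → E n (λ us → δ v u * (Δ vs us * f (u ∷ us))))
      ≡⟨ avg.cong-≗ (λ u → rec.scale (δ v u) _) ⟩
    avg (λ u → δ v u * E n (λ us → Δ vs us * f (u ∷ us)))
      ≡⟨ avg-δ v _ ⟩
    E n (λ us → Δ vs us * f (v ∷ us))
      ≡⟨ E-Δ vs _ ⟩
    f (v ∷ vs) ∎
    where
    open ≡-Reasoning
    module avg = IsMean avg-isMean
    module rec = IsMean (E-isMean n)

-- Noisy copies

*-exchange : ∀ a b c d → (a * b) * (c * d) ≡ (a * c) * (b * d)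
*-exchange = solve 4 (λ a b c d → (a :* b) :* (c :* d) := (a :* c) :* (b :* d)) refl

module Noise (t : ℕ) (0<t : 0 ℕ.< t) where
  open Uniform t 0<t public
  module avg = IsMean avg-isMean
  module E {n} = IsMean (E-isMean n)

  -- The density of u when each of its coordinates is, independently, a copy
  -- of that of v with probability θ and uniform otherwise.
  noise : ℚ → ∀ {n} → Vec (Fin t) n → Vec (Fin t) n → ℚ
  noise θ []       []       = 1ℚ
  noise θ (v ∷ vs) (u ∷ us) = (1ℚ + θ * (δ v u - 1ℚ)) * noise θ vs us

  noise-sym : ∀ θ {n} (v u : Vec (Fin t) n) → noise θ v u ≡ noise θ u v
  noise-sym θ []       []       = refl
  noise-sym θ (v ∷ vs) (u ∷ us) =
    cong₂ _*_ (cong (λ d → 1ℚ + θ * (d - 1ℚ)) (δ-sym v u)) (noise-sym θ vs us)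

  noise-0 : ∀ {n} (v u : Vec (Fin t) n) → noise 0ℚ v u ≡ 1ℚ
  noise-0 []       []       = refl
  noise-0 (v ∷ vs) (u ∷ us) = trans (*-congˡ (noise-0 vs us))
    (solve 1 (λ d → (con 1ℚ :+ con 0ℚ :* (d :- con 1ℚ)) :* con 1ℚ := con 1ℚ) refl (δ v u))

  1-θ≤noise₁ : ∀ {θ} → 0ℚ ≤ θ → ∀ (v u : Fin t) → 1ℚ - θ ≤ 1ℚ + θ * (δ v u - 1ℚ)
  1-θ≤noise₁ {θ} 0≤θ v u = ≤-slack (θ * δ v u) (0≤* 0≤θ (0≤δ v u))
    (solve 2 (λ θ d → con 1ℚ :- θ :+ θ :* d := con 1ℚ :+ θ :* (d :- con 1ℚ)) refl θ (δ v u))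

  0≤noise : ∀ {θ} → 0ℚ ≤ θ → θ ≤ 1ℚ → ∀ {n} (v u : Vec (Fin t) n) → 0ℚ ≤ noise θ v u
  0≤noise 0≤θ θ≤1 []       []       = 0≤1
  0≤noise 0≤θ θ≤1 (v ∷ vs) (u ∷ us) =
    0≤* (≤-trans (slack θ≤1) (1-θ≤noise₁ 0≤θ v u)) (0≤noise 0≤θ θ≤1 vs us)

  avg-noise₁ : ∀ θ v (f : Fin t → ℚ) →
               avg (λ u → (1ℚ + θ * (δ v u - 1ℚ)) * f u) ≡ (1ℚ - θ) * avg f + θ * f v
  avg-noise₁ θ v f = begin
    avg (λ u → (1ℚ + θ * (δ v u - 1ℚ)) * f u)
      ≡⟨ avg.cong-≗ (λ u → solve 3 (λ θ d x → (con 1ℚ :+ θ :* (d :- con 1ℚ)) :* x := (con 1ℚ :- θ)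
          :* x :+ θ :* (d :* x)) refl θ (δ v u) (f u)) ⟩
    avg (λ u → (1ℚ - θ) * f u + θ * (δ v u * f u))
      ≡⟨ avg.add _ _ ⟩
    avg (λ u → (1ℚ - θ) * f u) + avg (λ u → θ * (δ v u * f u))
      ≡⟨ cong₂ _+_ (avg.scale (1ℚ - θ) f) (trans (avg.scale θ (λ u → δ v u * f u))
          (*-congˡ (avg-δ v f))) ⟩
    (1ℚ - θ) * avg f + θ * f v ∎
    where open ≡-Reasoning

  E-split : ∀ {n} (a f : Fin t → ℚ) (b g : Vec (Fin t) n → ℚ) →
            avg (λ u → E n (λ us → (a u * b us) * (f u * g us)))
              ≡ avg (λ u → a u * f u) * E n (λ us → b us * g us)
  E-split {n} a f b g = trans
    (avg.cong-≗ (λ u → E.cong-≗ (λ us → *-exchange (a u) (b us) (f u) (g us))))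
    (E-product n (λ u → a u * f u) (λ us → b us * g us))

  E-noise : ∀ θ {n} (v : Vec (Fin t) n) → E n (noise θ v) ≡ 1ℚ
  E-noise θ         []       = refl
  E-noise θ {suc n} (v ∷ vs) = begin
    avg (λ u → E n (λ us → (1ℚ + θ * (δ v u - 1ℚ)) * noise θ vs us))
      ≡⟨ E-product n _ (noise θ vs) ⟩
    avg (λ u → 1ℚ + θ * (δ v u - 1ℚ)) * E n (noise θ vs)
      ≡⟨ cong₂ _*_ (trans (avg.cong-≗ (λ u → sym (*-identityʳ (1ℚ + θ * (δ v u - 1ℚ)))))
          (avg-noise₁ θ v (λ _ → 1ℚ))) (E-noise θ vs) ⟩
    ((1ℚ - θ) * avg (λ _ → 1ℚ) + θ * 1ℚ) * 1ℚ
      ≡⟨ cong (λ x → ((1ℚ - θ) * x + θ * 1ℚ) * 1ℚ) avg.unit ⟩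
    ((1ℚ - θ) * 1ℚ + θ * 1ℚ) * 1ℚ
      ≡⟨ solve 1 (λ θ → ((con 1ℚ :- θ) :* con 1ℚ :+ θ :* con 1ℚ) :* con 1ℚ := con 1ℚ) refl θ ⟩
    1ℚ ∎
    where open ≡-Reasoning

  -- Copies of light values, corrected so as to stay uniform on average

  module Tilt (K : ℚ) (0≤K : 0ℚ ≤ K) where

    light? : (F : Fin t → ℚ) (v : Fin t) → Dec (F v ≤ K * avg F)
    light? F v = F v ≤? (K * avg F)

    copy : (Fin t → ℚ) → Fin t → Fin t → ℚ
    copy F v u = if does (light? F v) then δ v u else 1ℚ

    0≤copy : ∀ F v u → 0ℚ ≤ copy F v u
    0≤copy F v u with does (light? F v)
    ... | true  = 0≤δ v u
    ... | false = 0≤1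

    avg-copy : ∀ F v → avg (copy F v) ≡ 1ℚ
    avg-copy F v with does (light? F v)
    ... | true  = avg-δ-unit v
    ... | false = avg.unit

    copied : (F : Fin t → ℚ) → Fin t → ℚ
    copied F u with 0ℚ <? avg F
    ... | yes 0<φ = inv (avg F) 0<φ * avg (λ v → F v * copy F v u)
    -- There is no law of v to average over here. The constant 1 is still a density, and in
    -- `avg-F*copy` both sides vanish.
    ... | no  _   = 1ℚ

    module _ {F : Fin t → ℚ} (0≤F : ∀ v → 0ℚ ≤ F v) where
      open ≡-Reasoning

      avg-F*copy : ∀ u → avg (λ v → F v * copy F v u) ≡ avg F * copied F u
      avg-F*copy u with 0ℚ <? avg F
      ... | yes 0<φ = begin
        A                                ≡⟨ *-identityˡ A ⟨
        1ℚ * A                           ≡⟨ *-congʳ (*-inv (avg F) 0<φ) ⟨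
        avg F * inv (avg F) 0<φ * A      ≡⟨ *-assoc (avg F) (inv (avg F) 0<φ) A ⟩
        avg F * (inv (avg F) 0<φ * A)    ∎
        where A = avg (λ v → F v * copy F v u)
      ... | no ¬0<φ = ℚ.≤-antisym
        (≤-trans A≤ (≤-reflexive (trans (zero-avg (λ x → x * ι t) (zeroˡ (ι t)))
            (sym (zero-avg (_* 1ℚ) (zeroˡ 1ℚ))))))
        (≤-trans (≤-reflexive (zero-avg (_* 1ℚ) (zeroˡ 1ℚ)))
            (avg.nonneg (λ v → 0≤* (0≤F v) (0≤copy F v u))))
        where
        φ≡0 : avg F ≡ 0ℚ
        φ≡0 = ℚ.≤-antisym (ℚ.≮⇒≥ ¬0<φ) (avg.nonneg 0≤F)
        zero-avg : ∀ (h : ℚ → ℚ) → h 0ℚ ≡ 0ℚ → h (avg F) ≡ 0ℚ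
        zero-avg h h0 = trans (cong h φ≡0) h0
        copy≤ : ∀ v → copy F v u ≤ ι t
        copy≤ v with does (light? F v)
        ... | false = ≤-trans (≤-reflexive (sym (+-identityʳ 1ℚ))) (ι-mono 0<t)
        ... | true  = δ≤ v u
        A≤ : avg (λ v → F v * copy F v u) ≤ avg F * ι t
        A≤ = ≤-trans (avg.mono (λ v → *-monoˡ (F v) (0≤F v) (copy≤ v)))
            (≤-reflexive (avg.scaleʳ F (ι t)))

      avg-copied : avg (copied F) ≡ 1ℚ
      avg-copied with 0ℚ <? avg F
      ... | no  _   = avg.unit
      ... | yes 0<φ = begin
        avg (λ u → inv (avg F) 0<φ * avg (λ v → F v * copy F v u))
          ≡⟨ avg.scale _ _ ⟩
        inv (avg F) 0<φ * avg (λ u → avg (λ v → F v * copy F v u))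
          ≡⟨ *-congˡ (sym (avg-swap avg-isMean (λ v u → F v * copy F v u))) ⟩
        inv (avg F) 0<φ * avg (λ v → avg (λ u → F v * copy F v u))
          ≡⟨ *-congˡ (avg.cong-≗ (λ v → trans (avg.scale (F v) (copy F v))
              (trans (*-congˡ (avg-copy F v)) (*-identityʳ (F v))))) ⟩
        inv (avg F) 0<φ * avg F
          ≡⟨ trans (*-comm _ _) (*-inv (avg F) 0<φ) ⟩
        1ℚ ∎

      0≤copied : ∀ u → 0ℚ ≤ copied F u
      0≤copied u with 0ℚ <? avg F
      ... | no  _   = 0≤1
      ... | yes 0<φ = 0≤* (0≤inv _ 0<φ) (avg.nonneg (λ v → 0≤* (0≤F v) (0≤copy F v u)))

      -- A light value has at most `K` times its uniform weight, so copies of light values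
      -- contribute density at most `K`; heavy values are replaced by uniform ones and contribute at
      -- most 1. This is what light values are distinguished for: it shows how large α may be with
      -- `tilt₁` nonnegative.
      copied≤ : ∀ u → copied F u ≤ K + 1ℚ
      copied≤ u with 0ℚ <? avg F
      ... | no  _   = ≤-slack K 0≤K (+-comm 1ℚ K)
      ... | yes 0<φ = ≤-trans (*-monoˡ _ (0≤inv _ 0<φ) A≤) (≤-reflexive eq)
        where
        pointwise : ∀ v → F v * copy F v u ≤ K * avg F * δ u v + F v
        pointwise v with light? F v
        ... | yes Fv≤ = ≤-trans (*-monoʳ (δ v u) (0≤δ v u) Fv≤)
                          (≤-slack (F v) (0≤F v) (cong (λ d → K * avg F * d + F v) (δ-sym v u)))
        ... | no  _   = ≤-slack (K * avg F * δ u v) (0≤* (0≤* 0≤K (avg.nonneg 0≤F)) (0≤δ u v))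
                          (solve 2 (λ x y → x :* con 1ℚ :+ y := y :+ x) refl (F v)
                              (K * avg F * δ u v))
        A≤ : avg (λ v → F v * copy F v u) ≤ (K + 1ℚ) * avg F
        A≤ = ≤-trans (avg.mono pointwise) (≤-reflexive (begin
          avg (λ v → K * avg F * δ u v + F v)
            ≡⟨ avg.add _ F ⟩
          avg (λ v → K * avg F * δ u v) + avg F
            ≡⟨ cong (_+ avg F) (trans (avg.scale (K * avg F) (δ u)) (*-congˡ (avg-δ-unit u))) ⟩
          K * avg F * 1ℚ + avg F
            ≡⟨ solve 2 (λ K x → K :* x :* con 1ℚ :+ x := (K :+ con 1ℚ) :* x) refl K (avg F) ⟩
          (K + 1ℚ) * avg F ∎))
        eq : inv (avg F) 0<φ * ((K + 1ℚ) * avg F) ≡ K + 1ℚ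
        eq = trans (solve 3 (λ i k x → i :* (k :* x) := k :* (x :* i)) refl (inv (avg F) 0<φ)
            (K + 1ℚ) (avg F))
                   (trans (*-congˡ (*-inv (avg F) 0<φ)) (*-identityʳ _))

    -- The density of u given v: each coordinate of u is with probability α a
    -- copy of that of v, unless F makes the latter too likely, and the other
    -- coordinates are corrected for what the copies contribute on average over
    -- v distributed according to F.
    tilt₁ : ℚ → (Fin t → ℚ) → Fin t → Fin t → ℚ
    tilt₁ α F v u = 1ℚ + α * (copy F v u - copied F u)

    marginal : ∀ {n} → (Vec (Fin t) (suc n) → ℚ) → Fin t → ℚ
    marginal {n} F v = E n (λ vs → F (v ∷ vs))

    fibre : ∀ {n} → (Vec (Fin t) (suc n) → ℚ) → Fin t → Vec (Fin t) n → ℚ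
    fibre F v vs = F (v ∷ vs)

    tilt : ℚ → ∀ {n} → (Vec (Fin t) n → ℚ) → Vec (Fin t) n → Vec (Fin t) n → ℚ
    tilt α F []       []       = 1ℚ
    tilt α F (v ∷ vs) (u ∷ us) = tilt₁ α (marginal F) v u * tilt α (fibre F v) vs us

    0≤tilt₁ : ∀ {α F} → 0ℚ ≤ α → α * (K + 1ℚ) ≤ 1ℚ → (∀ v → 0ℚ ≤ F v) → ∀ v u → 0ℚ ≤ tilt₁ α F v u
    0≤tilt₁ {α} {F} 0≤α αK≤1 0≤F v u = subst (0ℚ ≤_)
      (solve 3 (λ α c h → con 1ℚ :- α :* h :+ α :* c := con 1ℚ :+ α :* (c :- h)) refl α (copy F v u)
          (copied F u))
      (0≤+ (slack (≤-trans (*-monoˡ α 0≤α (copied≤ 0≤F u)) αK≤1)) (0≤* 0≤α (0≤copy F v u)))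

    0≤tilt : ∀ {α} → 0ℚ ≤ α → α * (K + 1ℚ) ≤ 1ℚ →
             ∀ {n F} → (∀ v → 0ℚ ≤ F v) → (v u : Vec (Fin t) n) → 0ℚ ≤ tilt α F v u
    0≤tilt 0≤α αK≤1 0≤F []       []       = 0≤1
    0≤tilt 0≤α αK≤1 0≤F (v ∷ vs) (u ∷ us) =
      0≤* (0≤tilt₁ 0≤α αK≤1 (λ v → E.nonneg (λ vs → 0≤F (v ∷ vs))) v u)
          (0≤tilt 0≤α αK≤1 (λ vs → 0≤F (v ∷ vs)) vs us)

    avg-tilt₁ : ∀ α {F} → (∀ v → 0ℚ ≤ F v) → ∀ v → avg (tilt₁ α F v) ≡ 1ℚ
    avg-tilt₁ α {F} 0≤F v = begin
      avg (λ u → 1ℚ + α * (copy F v u - copied F u))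
        ≡⟨ trans (avg.add _ _) (cong₂ _+_ avg.unit (trans (avg.scale α _)
            (*-congˡ (avg.sub (copy F v) (copied F))))) ⟩
      1ℚ + α * (avg (copy F v) - avg (copied F))
        ≡⟨ cong₂ (λ x y → 1ℚ + α * (x - y)) (avg-copy F v) (avg-copied 0≤F) ⟩
      1ℚ + α * (1ℚ - 1ℚ)
        ≡⟨ solve 1 (λ α → con 1ℚ :+ α :* (con 1ℚ :- con 1ℚ) := con 1ℚ) refl α ⟩
      1ℚ ∎
      where open ≡-Reasoning

    avg-F*tilt₁ : ∀ α {F} → (∀ v → 0ℚ ≤ F v) → ∀ u → avg (λ v → F v * tilt₁ α F v u) ≡ avg F
    avg-F*tilt₁ α {F} 0≤F u = begin
      avg (λ v → F v * (1ℚ + α * (copy F v u - copied F u)))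
        ≡⟨ avg.cong-≗ (λ v → solve 4 (λ f α c h → f :* (con 1ℚ :+ α :* (c :- h)) := f :+ α :*
            (f :* c :- f :* h)) refl (F v) α (copy F v u) (copied F u)) ⟩
      avg (λ v → F v + α * (F v * copy F v u - F v * copied F u))
        ≡⟨ trans (avg.add _ _) (+-congˡ (trans (avg.scale α _) (*-congˡ (avg.sub _ _)))) ⟩
      avg F + α * (avg (λ v → F v * copy F v u) - avg (λ v → F v * copied F u))
        ≡⟨ cong₂ (λ x y → avg F + α * (x - y)) (avg-F*copy 0≤F u) (avg.scaleʳ F (copied F u)) ⟩
      avg F + α * (avg F * copied F u - avg F * copied F u)
        ≡⟨ solve 3 (λ x α h → x :+ α :* (x :* h :- x :* h) := x) refl (avg F) α (copied F u) ⟩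
      avg F ∎
      where open ≡-Reasoning

    -- In each coordinate the subtracted `copied` is the F-average of `copy`, so the two cancel. The
    -- later coordinates are averaged first, with the earlier ones fixed, because their tilt depends
    -- on the fibre of `F`.
    E-F*tilt : ∀ α {n F} → (∀ v → 0ℚ ≤ F v) → ∀ (u : Vec (Fin t) n) →
               E n (λ v → F v * tilt α F v u) ≡ E n F
    E-F*tilt α {F = F} 0≤F []       = *-identityʳ (F [])
    E-F*tilt α {F = F} 0≤F (u ∷ us) = begin
      avg (λ v → E _ (λ vs → F (v ∷ vs) * (tilt₁ α (marginal F) v u * tilt α (fibre F v) vs us)))
        ≡⟨ avg.cong-≗ (λ v → trans
             (E.cong-≗ (λ vs → solve 3 (λ a b c → a :* (b :* c) := (a :* c) :* b) refl (F (v ∷ vs))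
                 (tilt₁ α (marginal F) v u) (tilt α (fibre F v) vs us)))
             (E.scaleʳ (λ vs → F (v ∷ vs) * tilt α (fibre F v) vs us) (tilt₁ α (marginal F) v u))) ⟩
      avg (λ v → E _ (λ vs → F (v ∷ vs) * tilt α (fibre F v) vs us) * tilt₁ α (marginal F) v u)
        ≡⟨ avg.cong-≗ (λ v → *-congʳ (E-F*tilt α (λ vs → 0≤F (v ∷ vs)) us)) ⟩
      avg (λ v → marginal F v * tilt₁ α (marginal F) v u)
        ≡⟨ avg-F*tilt₁ α (λ v → E.nonneg (λ vs → 0≤F (v ∷ vs))) u ⟩
      avg (marginal F) ∎
      where open ≡-Reasoning

    -- Each factor of the tilt is 1 plus α times a function of mean 0; noise fixes the constant and
    -- multiplies the deviation by θ, so the parameters multiply.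
    E-noise*tilt : ∀ θ α {n F} → (∀ v → 0ℚ ≤ F v) → ∀ (v u : Vec (Fin t) n) →
                   E n (λ w → noise θ u w * tilt α F v w) ≡ tilt (θ * α) F v u
    E-noise*tilt θ α         0≤F []       []       = *-identityʳ 1ℚ
    E-noise*tilt θ α {F = F} 0≤F (v ∷ vs) (u ∷ us) = begin
      avg (λ w → E _ (λ ws → ((1ℚ + θ * (δ u w - 1ℚ)) * noise θ us ws) * (tilt₁ α F′ v w * tilt α
          (fibre F v) vs ws)))
        ≡⟨ E-split _ _ (noise θ us) (tilt α (fibre F v) vs) ⟩
      avg (λ w → (1ℚ + θ * (δ u w - 1ℚ)) * tilt₁ α F′ v w) * E _ (λ ws → noise θ us ws * tilt α
          (fibre F v) vs ws)
        ≡⟨ cong₂ _*_ (trans (avg-noise₁ θ u (tilt₁ α F′ v)) (cong (λ x → (1ℚ - θ) * x + θ * tilt₁ α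
            F′ v u) (avg-tilt₁ α (λ v → E.nonneg (λ vs → 0≤F (v ∷ vs))) v)))
                     (E-noise*tilt θ α (λ vs → 0≤F (v ∷ vs)) vs us) ⟩
      ((1ℚ - θ) * 1ℚ + θ * tilt₁ α F′ v u) * tilt (θ * α) (fibre F v) vs us
        ≡⟨ *-congʳ (solve 3 (λ θ α d → (con 1ℚ :- θ) :* con 1ℚ :+ θ :* (con 1ℚ :+ α :* d) := con 1ℚ
            :+ θ :* α :* d) refl θ α (copy F′ v u - copied F′ u)) ⟩
      tilt₁ (θ * α) F′ v u * tilt (θ * α) (fibre F v) vs us ∎
      where
      open ≡-Reasoning
      F′ = marginal F

    tilt-0 : ∀ {n F} (v u : Vec (Fin t) n) → tilt 0ℚ F v u ≡ 1ℚ
    tilt-0 []       []       = refl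
    tilt-0 {F = F} (v ∷ vs) (u ∷ us) = trans (*-congˡ (tilt-0 vs us))
      (solve 1 (λ d → (con 1ℚ :+ con 0ℚ :* d) :* con 1ℚ := con 1ℚ) refl (copy (marginal F) v u -
          copied (marginal F) u))

    heavy : ∀ {n} → (Vec (Fin t) n → ℚ) → Vec (Fin t) n → ℕ
    heavy F []       = 0
    heavy F (v ∷ vs) = (if does (light? (marginal F) v) then 0 else 1) ℕ.+ heavy (fibre F v) vs

    heavy≤n : ∀ {n} F (v : Vec (Fin t) n) → heavy F v ℕ.≤ n
    heavy≤n F []       = ℕ.z≤n
    heavy≤n F (v ∷ vs) with does (light? (marginal F) v)
    ... | true  = ℕ.m≤n⇒m≤1+n (heavy≤n (fibre F v) vs)
    ... | false = ℕ.s≤s (heavy≤n (fibre F v) vs)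

    -- By Markov's inequality at most one value in K is heavy.
    avg-K^heavy : ∀ {F} → (∀ v → 0ℚ ≤ F v) →
                  avg (λ v → K ^ (if does (light? F v) then 0 else 1)) ≤ 2ℚ
    avg-K^heavy {F} 0≤F with 0ℚ <? avg F
    ... | yes 0<φ = *-cancelˡ (avg F) 0<φ (begin
        avg F * avg K^                ≡⟨ avg.scale (avg F) K^ ⟨
        avg (λ v → avg F * K^ v)      ≤⟨ avg.mono pointwise ⟩
        avg (λ v → avg F + F v)       ≡⟨ trans (avg.add _ F) (cong (_+ avg F) (avg.const (avg F))) ⟩
        avg F + avg F                 ≡⟨ solve 1 (λ x → x :+ x := x :* con 2ℚ) refl (avg F) ⟩
        avg F * 2ℚ                    ∎)
      where
      open ≤-Reasoning
      K^ : Fin t → ℚ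
      K^ v = K ^ (if does (light? F v) then 0 else 1)
      pointwise : ∀ v → avg F * K^ v ≤ avg F + F v
      pointwise v with light? F v
      ... | yes _   = ≤-slack (F v) (0≤F v) (cong (_+ F v) (*-identityʳ (avg F)))
      ... | no  ¬p  = ≤-trans (≤-reflexive (solve 2 (λ x k → x :* (k :* con 1ℚ) := k :* x) refl
          (avg F) K))
                     (≤-trans (ℚ.<⇒≤ (ℚ.≰⇒> ¬p)) (≤-slack (avg F) (ℚ.<⇒≤ 0<φ)
                         (+-comm (F v) (avg F))))
    ... | no ¬0<φ = ≤-trans (avg.bounded pointwise) 1≤2
      where
      F≤0 : ∀ v → F v ≤ K * avg F
      F≤0 v = begin
        F v                           ≡⟨ avg-δ v F ⟨
        avg (λ u → δ v u * F u)       ≤⟨ avg.mono (λ u → *-monoʳ (F u) (0≤F u) (δ≤ v u)) ⟩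
        avg (λ u → ι t * F u)         ≡⟨ avg.scale (ι t) F ⟩
        ι t * avg F                   ≡⟨ trans (*-congˡ φ≡0) (trans (zeroʳ (ι t))
            (sym (trans (*-congˡ φ≡0) (zeroʳ K)))) ⟩
        K * avg F                     ∎
        where
        open ≤-Reasoning
        φ≡0 : avg F ≡ 0ℚ
        φ≡0 = ℚ.≤-antisym (ℚ.≮⇒≥ ¬0<φ) (avg.nonneg 0≤F)
      pointwise : ∀ v → K ^ (if does (light? F v) then 0 else 1) ≤ 1ℚ
      pointwise v with light? F v
      ... | yes _ = ≤-refl
      ... | no ¬p = contradiction (F≤0 v) ¬p

-- Comparison of the tilt with the noise in χ²

3ℚ 4ℚ : ℚ
3ℚ = 1ℚ ℚ.+ 2ℚ
4ℚ = 2ℚ ℚ.+ 2ℚ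

-- The hypothesis says that the quadratic on the right minus `x` has no positive discriminant. Used
-- pointwise it replaces the Cauchy-Schwarz inequality: a first moment is bounded by a second one
-- without square roots.
≤-quadratic : ∀ {η s} x → 0ℚ < s → 1ℚ ≤ 4ℚ * (η * s) → x ≤ η + s * (x * x)
≤-quadratic {η} {s} x 0<s 1≤4ηs = *-cancelˡ s 0<s (*-cancelˡ 4ℚ (ℚ.positive⁻¹ 4ℚ) (≤-slack
  ((4ℚ * (η * s) - 1ℚ) + (2ℚ * (s * x) - 1ℚ) * (2ℚ * (s * x) - 1ℚ))
  (0≤+ (slack 1≤4ηs) (0≤a² _))
  (solve 3 (λ η s x → con 4ℚ :* (s :* x) :+ ((con 4ℚ :* (η :* s) :- con 1ℚ) :+ (con 2ℚ :* (s :* x)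
      :- con 1ℚ) :* (con 2ℚ :* (s :* x) :- con 1ℚ))
      := con 4ℚ :* (s :* (η :+ s :* (x :* x)))) refl η s x)))

module Comparison (t : ℕ) (0<t : 0 ℕ.< t) (K : ℚ) (0≤K : 0ℚ ≤ K) where
  open Noise t 0<t public
  open Tilt K 0≤K public

  -- The average is over uniform v and not over v distributed according to `F`: the values that `F`
  -- favours are rare among all values. The passage to `F` is made in `eliminate`, at the price of a
  -- pointwise bound on `F`.
  E-K^heavy : ∀ {n F} → (∀ v → 0ℚ ≤ F v) → E n (λ v → K ^ heavy F v) ≤ 2ℚ ^ n
  E-K^heavy {zero}          0≤F = ≤-refl
  E-K^heavy {suc n} {F = F} 0≤F = begin
    avg (λ v → E n (λ vs → K ^ (h v ℕ.+ heavy (fibre F v) vs)))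
      ≡⟨ avg.cong-≗ (λ v → trans (E.cong-≗ (λ vs → ^-+ K (h v) (heavy (fibre F v) vs)))
          (E.scale (K ^ h v) (λ vs → K ^ heavy (fibre F v) vs))) ⟩
    avg (λ v → K ^ h v * E n (λ vs → K ^ heavy (fibre F v) vs))
      ≤⟨ avg.mono (λ v → *-monoˡ (K ^ h v) (0≤^ (h v) 0≤K) (E-K^heavy (λ vs → 0≤F (v ∷ vs)))) ⟩
    avg (λ v → K ^ h v * 2ℚ ^ n)
      ≡⟨ avg.scaleʳ (λ v → K ^ h v) (2ℚ ^ n) ⟩
    avg (λ v → K ^ h v) * 2ℚ ^ n
      ≤⟨ *-monoʳ (2ℚ ^ n) (0≤^ n 0≤2) (avg-K^heavy (λ v → E.nonneg (λ vs → 0≤F (v ∷ vs)))) ⟩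
    2ℚ * 2ℚ ^ n ∎
    where
    open ≤-Reasoning
    h : Fin t → ℕ
    h v = if does (light? (marginal F) v) then 0 else 1

  module _ {θ : ℚ} (0≤θ : 0ℚ ≤ θ) (3θ≤1 : 3ℚ * θ ≤ 1ℚ) (θK≤1 : θ * (K + 1ℚ) ≤ 1ℚ) where

    noise₁ : Fin t → Fin t → ℚ
    noise₁ v u = 1ℚ + θ * (δ v u - 1ℚ)

    1≤2noise₁ : ∀ v u → 1ℚ ≤ 2ℚ * noise₁ v u
    1≤2noise₁ v u = ≤-trans (≤-slack _ (0≤+ (slack 3θ≤1) 0≤θ)
      (solve 1 (λ θ → con 1ℚ :+ (con 1ℚ :- con 3ℚ :* θ :+ θ) := con 2ℚ :* (con 1ℚ :- θ)) refl θ))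
      (*-monoˡ 2ℚ 0≤2 (1-θ≤noise₁ 0≤θ v u))

    0<noise₁ : ∀ v u → 0ℚ < noise₁ v u
    0<noise₁ v u = ℚ.≰⇒> λ noise≤0 → ℚ.<-irrefl refl (ℚ.<-≤-trans (ℚ.positive⁻¹ 1ℚ)
      (≤-trans (1≤2noise₁ v u) (≤-trans (*-monoˡ 2ℚ 0≤2 noise≤0) (≤-reflexive (zeroʳ 2ℚ)))))

    θ≤1 : θ ≤ 1ℚ
    θ≤1 = ≤-trans (≤-slack (2ℚ * θ) (0≤* 0≤2 0≤θ) (solve 1 (λ θ → θ :+ con 2ℚ :* θ := con 3ℚ :* θ)
        refl θ)) 3θ≤1

    noise⁻¹ : Fin t → Fin t → ℚ
    noise⁻¹ v u = inv (noise₁ v u) (0<noise₁ v u)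

    noise₁*noise⁻¹ : ∀ v u → noise₁ v u * noise⁻¹ v u ≡ 1ℚ
    noise₁*noise⁻¹ v u = *-inv (noise₁ v u) (0<noise₁ v u)

    0≤noise⁻¹ : ∀ v u → 0ℚ ≤ noise⁻¹ v u
    0≤noise⁻¹ v u = 0≤inv (noise₁ v u) (0<noise₁ v u)

    noise⁻¹≤2 : ∀ v u → noise⁻¹ v u ≤ 2ℚ
    noise⁻¹≤2 v u = begin
      noise⁻¹ v u                         ≡⟨ *-identityʳ _ ⟨
      noise⁻¹ v u * 1ℚ                    ≤⟨ *-monoˡ _ (0≤noise⁻¹ v u) (1≤2noise₁ v u) ⟩
      noise⁻¹ v u * (2ℚ * noise₁ v u)     ≡⟨ solve 2 (λ i n → i :* (con 2ℚ :* n) := con 2ℚ :*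
          (n :* i)) refl (noise⁻¹ v u) (noise₁ v u) ⟩
      2ℚ * (noise₁ v u * noise⁻¹ v u)     ≡⟨ trans (*-congˡ (noise₁*noise⁻¹ v u)) (*-identityʳ 2ℚ) ⟩
      2ℚ                                  ∎
      where open ≤-Reasoning

    lightTilt : (Fin t → ℚ) → Fin t → Fin t → ℚ
    lightTilt F v u = 1ℚ + θ * (δ v u - copied F u)

    -- On light coordinates the tilt is compared with the noise in χ², on the
    -- few heavy ones by the pointwise factor 1 + 3θ.
    ratio₁ : (Fin t → ℚ) → Fin t → Fin t → ℚ
    ratio₁ F v u = if does (light? F v) then lightTilt F v u * noise⁻¹ v u else 1ℚ

    ratio : ∀ {n} → (Vec (Fin t) n → ℚ) → Vec (Fin t) n → Vec (Fin t) n → ℚ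
    ratio F []       []       = 1ℚ
    ratio F (v ∷ vs) (u ∷ us) = ratio₁ (marginal F) v u * ratio (fibre F v) vs us

    ε : ℚ
    ε = 2ℚ * ((θ * (K + 1ℚ)) * (θ * (K + 1ℚ)))

    0≤ε : 0ℚ ≤ ε
    0≤ε = 0≤* 0≤2 (0≤a² _)

    cancel-noise : ∀ v u x → noise₁ v u * (x * noise⁻¹ v u) ≡ x
    cancel-noise v u x = trans (solve 3 (λ n x i → n :* (x :* i) := x :* (n :* i)) refl (noise₁ v u)
        x (noise⁻¹ v u))
                               (trans (*-congˡ (noise₁*noise⁻¹ v u)) (*-identityʳ x))

    avg-noise₁-unit : ∀ v → avg (noise₁ v) ≡ 1ℚ
    avg-noise₁-unit v = trans (avg.cong-≗ (λ u → sym (*-identityʳ (noise₁ v u))))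
        (trans (avg-noise₁ θ v (λ _ → 1ℚ))
      (trans (cong (λ x → (1ℚ - θ) * x + θ * 1ℚ) avg.unit) (solve 1 (λ θ → (con 1ℚ :- θ) :* con 1ℚ
          :+ θ :* con 1ℚ := con 1ℚ) refl θ)))

    module _ {F : Fin t → ℚ} (0≤F : ∀ v → 0ℚ ≤ F v) where

      0≤ratio₁ : ∀ v u → 0ℚ ≤ ratio₁ F v u
      0≤ratio₁ v u = cases (does (light? F v)) (0≤tilt₁ 0≤θ θK≤1 0≤F v u)
        where
        cases : ∀ light → 0ℚ ≤ 1ℚ + θ * ((if light then δ v u else 1ℚ) - copied F u) →
                0ℚ ≤ (if light then lightTilt F v u * noise⁻¹ v u else 1ℚ)
        cases true  0≤tilt = 0≤* 0≤tilt (0≤noise⁻¹ v u)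
        cases false _      = 0≤1

      avg-noise*ratio : ∀ v → avg (λ u → noise₁ v u * ratio₁ F v u) ≡ 1ℚ
      avg-noise*ratio v = cases (does (light? F v)) (avg-tilt₁ θ 0≤F v)
        where
        cases : ∀ light → avg (λ u → 1ℚ + θ * ((if light then δ v u else 1ℚ) - copied F u)) ≡ 1ℚ →
                avg (λ u → noise₁ v u * (if light then lightTilt F v u * noise⁻¹ v u else 1ℚ)) ≡ 1ℚ
        cases true  eq = trans (avg.cong-≗ (λ u → cancel-noise v u (lightTilt F v u))) eq
        cases false _  = trans (avg.cong-≗ (λ u → *-identityʳ (noise₁ v u))) (avg-noise₁-unit v)

      [1-copied]²≤ : ∀ u → (1ℚ - copied F u) * (1ℚ - copied F u) ≤ (K + 1ℚ) * (K + 1ℚ)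
      [1-copied]²≤ u = ≤-slack ((K + copied F u) * (K + 1ℚ - copied F u + 1ℚ))
        (0≤* (0≤+ 0≤K (0≤copied 0≤F u)) (0≤+ (slack (copied≤ 0≤F u)) 0≤1))
        (solve 2 (λ K h → (con 1ℚ :- h) :* (con 1ℚ :- h) :+ (K :+ h) :* (K :+ con 1ℚ :- h :+ con 1ℚ)
            := (K :+ con 1ℚ) :* (K :+ con 1ℚ)) refl K (copied F u))

      -- On a light coordinate `δ` cancels in the difference of tilt and noise, which is θ times
      -- `1ℚ - copied F u` and hence at most θ times `K + 1ℚ` in absolute value. Both have mean 1,
      -- so the linear terms leave 1 and the excess is the squared difference divided by a noise
      -- density of at least 1/2.
      avg-noise*ratio² : ∀ v → avg (λ u → noise₁ v u * (ratio₁ F v u * ratio₁ F v u)) ≤ 1ℚ + ε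
      avg-noise*ratio² v = cases (does (light? F v)) (avg-tilt₁ θ 0≤F v)
        where
        open ≤-Reasoning
        Q : Fin t → ℚ
        Q = lightTilt F v
        pointwise : ∀ u → noise₁ v u * ((Q u * noise⁻¹ v u) * (Q u * noise⁻¹ v u)) ≤ 2ℚ * Q u -
            noise₁ v u + ε
        pointwise u = begin
          n * ((q * i) * (q * i))
            ≡⟨ solve 3 (λ n q i → n :* ((q :* i) :* (q :* i)) := (n :* i) :* (q :* q :* i)) refl n q
                i ⟩
          (n * i) * (q * q * i)
            ≡⟨ trans (*-congʳ (noise₁*noise⁻¹ v u)) (*-identityˡ _) ⟩
          q * q * i
            -- The square is expanded around `n`; the products `n * i` are kept so that they can be
            -- rewritten to 1 afterwards.
            ≡⟨ solve 3 (λ n q i → q :* q :* i := con 2ℚ :* q :* (n :* i) :- n :* (n :* i) :+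
                (q :- n) :* (q :- n) :* i) refl n q i ⟩
          2ℚ * q * (n * i) - n * (n * i) + (q - n) * (q - n) * i
            ≡⟨ cong (λ x → 2ℚ * q * x - n * x + (q - n) * (q - n) * i) (noise₁*noise⁻¹ v u) ⟩
          2ℚ * q * 1ℚ - n * 1ℚ + (q - n) * (q - n) * i
            ≤⟨ +-monoʳ _ (*-monoˡ _ (0≤a² (q - n)) (noise⁻¹≤2 v u)) ⟩
          2ℚ * q * 1ℚ - n * 1ℚ + (q - n) * (q - n) * 2ℚ
            ≡⟨ solve 3 (λ θ d h → let q′ = con 1ℚ :+ θ :* (d :- h) ; n′ = con 1ℚ :+ θ :* (d :- con 1ℚ) in
                 con 2ℚ :* q′ :* con 1ℚ :- n′ :* con 1ℚ :+ (q′ :- n′) :* (q′ :- n′) :* con 2ℚ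
                   := con 2ℚ :* q′ :- n′ :+ con 2ℚ :* (θ :* θ :* ((con 1ℚ :- h) :* (con 1ℚ :- h))))
                       refl θ (δ v u) (copied F u) ⟩
          2ℚ * q - n + 2ℚ * (θ * θ * ((1ℚ - copied F u) * (1ℚ - copied F u)))
            ≤⟨ +-monoʳ _ (*-monoˡ 2ℚ 0≤2 (*-monoˡ (θ * θ) (0≤a² θ) ([1-copied]²≤ u))) ⟩
          2ℚ * q - n + 2ℚ * (θ * θ * ((K + 1ℚ) * (K + 1ℚ)))
            ≡⟨ +-congˡ (*-congˡ (*-exchange θ θ (K + 1ℚ) (K + 1ℚ))) ⟩
          2ℚ * q - n + ε ∎
          where
          n = noise₁ v u
          q = Q u
          i = noise⁻¹ v u
        ratioᵇ : Bool → Fin t → ℚ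
        ratioᵇ light u = if light then Q u * noise⁻¹ v u else 1ℚ
        cases : ∀ light → avg (λ u → 1ℚ + θ * ((if light then δ v u else 1ℚ) - copied F u)) ≡ 1ℚ →
                avg (λ u → noise₁ v u * (ratioᵇ light u * ratioᵇ light u)) ≤ 1ℚ + ε
        cases false _  = ≤-trans (≤-reflexive
            (trans (avg.cong-≗ (λ u → trans (*-congˡ (*-identityʳ 1ℚ)) (*-identityʳ (noise₁ v u))))
            (avg-noise₁-unit v)))
                                 (≤-slack ε 0≤ε refl)
        cases true  eq = begin
          avg (λ u → noise₁ v u * ((Q u * noise⁻¹ v u) * (Q u * noise⁻¹ v u)))
            ≤⟨ avg.mono pointwise ⟩
          avg (λ u → 2ℚ * Q u - noise₁ v u + ε)
            ≡⟨ trans (avg.add _ _) (cong₂ _+_ (trans (avg.sub _ _)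
                (cong₂ _-_ (trans (avg.scale 2ℚ Q) (*-congˡ eq)) (avg-noise₁-unit v)))
                (avg.const ε)) ⟩
          2ℚ * 1ℚ - 1ℚ + ε
            ≡⟨ solve 1 (λ e → con 2ℚ :* con 1ℚ :- con 1ℚ :+ e := con 1ℚ :+ e) refl ε ⟩
          1ℚ + ε ∎

      tilt₁≤ : ∀ v u → tilt₁ θ F v u ≤ (1ℚ + 3ℚ * θ) ^ (if does (light? F v) then 0 else 1) *
          (noise₁ v u * ratio₁ F v u)
      tilt₁≤ v u = cases (does (light? F v))
        where
        open ≤-Reasoning
        cases : ∀ light → 1ℚ + θ * ((if light then δ v u else 1ℚ) - copied F u) ≤
                (1ℚ + 3ℚ * θ) ^ (if light then 0 else 1) * (noise₁ v u * (if light then lightTilt F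
                    v u * noise⁻¹ v u else 1ℚ))
        cases true  = ≤-reflexive (sym (trans (*-identityˡ _) (cancel-noise v u (lightTilt F v u))))
        -- On a heavy coordinate the tilt is at most 1 + θ, whereas the noise may be as small as 1 -
        -- θ. The factor 1 + 3θ covers the quotient as long as 3θ is at most 1.
        cases false = begin
          1ℚ + θ * (1ℚ - copied F u)
            ≤⟨ ≤-slack (θ * copied F u) (0≤* 0≤θ (0≤copied 0≤F u))
                (solve 2 (λ θ h → con 1ℚ :+ θ :* (con 1ℚ :- h) :+ θ :* h := con 1ℚ :+ θ) refl θ
                (copied F u)) ⟩
          1ℚ + θ
            ≤⟨ ≤-slack (θ * (1ℚ - 3ℚ * θ)) (0≤* 0≤θ (slack 3θ≤1))
                (solve 1 (λ θ → con 1ℚ :+ θ :+ θ :* (con 1ℚ :- con 3ℚ :* θ) := (con 1ℚ :+ con 3ℚ :*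
                θ) :* con 1ℚ :* (con 1ℚ :- θ)) refl θ) ⟩
          (1ℚ + 3ℚ * θ) * 1ℚ * (1ℚ - θ)
            ≤⟨ *-monoˡ _ (0≤* (0≤+ 0≤1 (0≤* (ℚ.nonNegative⁻¹ 3ℚ) 0≤θ)) 0≤1) (1-θ≤noise₁ 0≤θ v u) ⟩
          (1ℚ + 3ℚ * θ) * 1ℚ * noise₁ v u
            ≡⟨ *-congˡ (*-identityʳ (noise₁ v u)) ⟨
          (1ℚ + 3ℚ * θ) * 1ℚ * (noise₁ v u * 1ℚ) ∎

    1≤1+3θ : 1ℚ ≤ 1ℚ + 3ℚ * θ
    1≤1+3θ = ≤-slack (3ℚ * θ) (0≤* (ℚ.nonNegative⁻¹ 3ℚ) 0≤θ) refl

    0≤1+3θ : 0ℚ ≤ 1ℚ + 3ℚ * θ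
    0≤1+3θ = ≤-trans 0≤1 1≤1+3θ

    module _ where
      private
        0≤marginal : ∀ {n} {F : Vec (Fin t) (suc n) → ℚ} → (∀ v → 0ℚ ≤ F v) → ∀ v → 0ℚ ≤ marginal F
            v
        0≤marginal 0≤F v = E.nonneg (λ vs → 0≤F (v ∷ vs))

      0≤ratio : ∀ {n F} → (∀ v → 0ℚ ≤ F v) → (v u : Vec (Fin t) n) → 0ℚ ≤ ratio F v u
      0≤ratio 0≤F []       []       = 0≤1
      0≤ratio 0≤F (v ∷ vs) (u ∷ us) =
        0≤* (0≤ratio₁ (0≤marginal 0≤F) v u) (0≤ratio (λ vs → 0≤F (v ∷ vs)) vs us)

      E-noise*ratio : ∀ {n F} → (∀ v → 0ℚ ≤ F v) → (v : Vec (Fin t) n) →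
                      E n (λ u → noise θ v u * ratio F v u) ≡ 1ℚ
      E-noise*ratio         0≤F []       = *-identityʳ 1ℚ
      E-noise*ratio {F = F} 0≤F (v ∷ vs) = trans
        (E-split (noise₁ v) (ratio₁ (marginal F) v) (noise θ vs) (ratio (fibre F v) vs))
        (trans (cong₂ _*_ (avg-noise*ratio (0≤marginal 0≤F) v) (E-noise*ratio (λ vs → 0≤F (v ∷ vs))
            vs)) (*-identityʳ 1ℚ))

      E-noise*ratio² : ∀ {n F} → (∀ v → 0ℚ ≤ F v) → (v : Vec (Fin t) n) →
                       E n (λ u → noise θ v u * (ratio F v u * ratio F v u)) ≤ (1ℚ + ε) ^ n
      E-noise*ratio²         {F = F} 0≤F []       = ≤-reflexive (trans (*-identityˡ _)
          (*-identityʳ 1ℚ))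
      E-noise*ratio² {suc n} {F = F} 0≤F (v ∷ vs) = begin
        avg (λ u → E n (λ us → (noise₁ v u * noise θ vs us) * ((r u * R us) * (r u * R us))))
          ≡⟨ avg.cong-≗ (λ u → E.cong-≗ (λ us → *-congˡ (*-exchange (r u) (R us) (r u) (R us)))) ⟩
        avg (λ u → E n (λ us → (noise₁ v u * noise θ vs us) * ((r u * r u) * (R us * R us))))
          ≡⟨ E-split (noise₁ v) (λ u → r u * r u) (noise θ vs) (λ us → R us * R us) ⟩
        avg (λ u → noise₁ v u * (r u * r u)) * E n (λ us → noise θ vs us * (R us * R us))
          ≤⟨ *-mono (E.nonneg (λ us → 0≤* (0≤noise 0≤θ θ≤1 vs us) (0≤a² (R us)))) (0≤+ 0≤1 0≤ε)
               (avg-noise*ratio² (0≤marginal 0≤F) v) (E-noise*ratio² (λ vs → 0≤F (v ∷ vs)) vs) ⟩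
        (1ℚ + ε) * (1ℚ + ε) ^ n ∎
        where
        open ≤-Reasoning
        r = ratio₁ (marginal F) v
        R = ratio (fibre F v) vs

      tilt≤ : ∀ {n F} → (∀ v → 0ℚ ≤ F v) → (v u : Vec (Fin t) n) →
              tilt θ F v u ≤ (1ℚ + 3ℚ * θ) ^ heavy F v * (noise θ v u * ratio F v u)
      tilt≤         0≤F []       []       = ≤-reflexive
          (sym (trans (*-identityˡ _) (*-identityʳ 1ℚ)))
      tilt≤ {F = F} 0≤F (v ∷ vs) (u ∷ us) = begin
        tilt₁ θ (marginal F) v u * tilt θ (fibre F v) vs us
          ≤⟨ *-mono (0≤tilt 0≤θ θK≤1 (λ vs → 0≤F (v ∷ vs)) vs us)
                    (0≤* (0≤^ h 0≤1+3θ) (0≤* (ℚ.<⇒≤ (0<noise₁ v u)) (0≤ratio₁ (0≤marginal 0≤F) v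
                        u)))
                    (tilt₁≤ (0≤marginal 0≤F) v u) (tilt≤ (λ vs → 0≤F (v ∷ vs)) vs us) ⟩
        (λ′ ^ h * (noise₁ v u * r)) * (λ′ ^ hs * (noise θ vs us * R))
          ≡⟨ solve 6 (λ a b c d e f → (a :* (b :* c)) :* (d :* (e :* f)) := (a :* d) :*
              ((b :* e) :* (c :* f))) refl (λ′ ^ h) (noise₁ v u) r (λ′ ^ hs) (noise θ vs us) R ⟩
        (λ′ ^ h * λ′ ^ hs) * ((noise₁ v u * noise θ vs us) * (r * R))
          ≡⟨ *-congʳ (^-+ λ′ h hs) ⟨
        λ′ ^ (h ℕ.+ hs) * ((noise₁ v u * noise θ vs us) * (r * R)) ∎
        where
        open ≤-Reasoning
        λ′ = 1ℚ + 3ℚ * θ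
        h  = if does (light? (marginal F) v) then 0 else 1
        hs = heavy (fibre F v) vs
        r  = ratio₁ (marginal F) v u
        R  = ratio (fibre F v) vs us

      -- By `tilt≤` the tilt is at most a constant times the density noise times ratio. The constant
      -- costs its excess over 1. Replacing the ratio by 1 costs the mean of its deviation, which
      -- `≤-quadratic` bounds by η plus s times the χ² distance.
      compare : ∀ {η s} → 0ℚ ≤ η → 0ℚ < s → 1ℚ ≤ 4ℚ * (η * s) →
                ∀ {n F} → (∀ v → 0ℚ ≤ F v) → (v : Vec (Fin t) n) →
                ∀ {g : Vec (Fin t) n → ℚ} {c} → (∀ u → 0ℚ ≤ g u) → (∀ u → g u ≤ c) →
                E n (λ u → tilt θ F v u * g u) ≤
                E n (λ u → noise θ v u * g u) +
                  c * (((1ℚ + 3ℚ * θ) ^ heavy F v - 1ℚ) + (η + s * ((1ℚ + ε) ^ n - 1ℚ)))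
      compare {η} {s} 0≤η 0<s 1≤4ηs {n} {F} 0≤F v {g} {c} 0≤g g≤c = begin
        E n (λ u → tilt θ F v u * g u)
          ≤⟨ Eₙ.mono (λ u → *-monoʳ (g u) (0≤g u) (tilt≤ 0≤F v u)) ⟩
        E n (λ u → Λ * (P u * R u) * g u)
          ≡⟨ trans (Eₙ.cong-≗ (λ u → *-assoc Λ (P u * R u) (g u)))
              (Eₙ.scale Λ (λ u → P u * R u * g u)) ⟩
        Λ * X
          ≡⟨ solve 2 (λ Λ X → Λ :* X := X :+ (Λ :- con 1ℚ) :* X) refl Λ X ⟩
        X + (Λ - 1ℚ) * X
          ≤⟨ +-mono-≤ X≤ (*-monoˡ (Λ - 1ℚ) (slack (1≤^ (heavy F v) 1≤1+3θ)) X≤c) ⟩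
        E n (λ u → P u * g u) + c * (η + s * ((1ℚ + ε) ^ n - 1ℚ)) + (Λ - 1ℚ) * c
          ≡⟨ solve 4 (λ e c x l → e :+ c :* x :+ l :* c := e :+ c :* (l :+ x)) refl
              (E n (λ u → P u * g u)) c (η + s * ((1ℚ + ε) ^ n - 1ℚ)) (Λ - 1ℚ) ⟩
        E n (λ u → P u * g u) + c * ((Λ - 1ℚ) + (η + s * ((1ℚ + ε) ^ n - 1ℚ))) ∎
        where
        open ≤-Reasoning
        module Eₙ = IsMean (E-isMean n)
        Λ = (1ℚ + 3ℚ * θ) ^ heavy F v
        P R : Vec (Fin t) n → ℚ
        P = noise θ v
        R = ratio F v
        X = E n (λ u → P u * R u * g u)
        0≤P : ∀ u → 0ℚ ≤ P u
        0≤P = 0≤noise 0≤θ θ≤1 v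
        0≤c : 0ℚ ≤ c
        0≤c = ≤-trans (Eₙ.nonneg 0≤g) (Eₙ.bounded g≤c)
        X≤c : X ≤ c
        X≤c = begin
          X                              ≤⟨ Eₙ.mono (λ u → *-monoˡ (P u * R u)
              (0≤* (0≤P u) (0≤ratio 0≤F v u)) (g≤c u)) ⟩
          E n (λ u → P u * R u * c)      ≡⟨ Eₙ.scaleʳ (λ u → P u * R u) c ⟩
          E n (λ u → P u * R u) * c      ≡⟨ trans (*-congʳ (E-noise*ratio 0≤F v)) (*-identityˡ c) ⟩
          c                              ∎
        pointwise : ∀ u → P u * R u * g u ≤ P u * g u + c * (η * P u + s * (P u * (R u * R u) - 2ℚ *
            (P u * R u) + P u))
        pointwise u = begin
          P u * R u * g u
            ≡⟨ solve 3 (λ p r g → p :* r :* g := p :* g :+ p :* ((r :- con 1ℚ) :* g)) refl (P u)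
                (R u) (g u) ⟩
          P u * g u + P u * ((R u - 1ℚ) * g u)
            ≤⟨ +-monoʳ _ (*-monoˡ (P u) (0≤P u) (≤-trans
                 (*-monoʳ (g u) (0≤g u) (≤-quadratic (R u - 1ℚ) 0<s 1≤4ηs))
                 (*-monoˡ _ (0≤+ 0≤η (0≤* (ℚ.<⇒≤ 0<s) (0≤a² (R u - 1ℚ)))) (g≤c u)))) ⟩
          P u * g u + P u * ((η + s * ((R u - 1ℚ) * (R u - 1ℚ))) * c)
            ≡⟨ solve 6 (λ p g r c η s → p :* g :+ p :* ((η :+ s :* ((r :- con 1ℚ) :* (r :- con 1ℚ)))
                :* c)
                 := p :* g :+ c :* (η :* p :+ s :* (p :* (r :* r) :- con 2ℚ :* (p :* r) :+ p))) refl
                     (P u) (g u) (R u) c η s ⟩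
          P u * g u + c * (η * P u + s * (P u * (R u * R u) - 2ℚ * (P u * R u) + P u)) ∎
        X≤ : X ≤ E n (λ u → P u * g u) + c * (η + s * ((1ℚ + ε) ^ n - 1ℚ))
        X≤ = begin
          X
            ≤⟨ Eₙ.mono pointwise ⟩
          E n (λ u → P u * g u + c * (η * P u + s * (P u * (R u * R u) - 2ℚ * (P u * R u) + P u)))
            ≡⟨ trans (Eₙ.add _ _) (+-congˡ (trans (Eₙ.scale c _)
                (*-congˡ (trans (Eₙ.add _ _) (cong₂ _+_ (Eₙ.scale η P)
                 (trans (Eₙ.scale s _) (*-congˡ (trans (Eₙ.add _ P)
                     (cong (_+ E n P) (trans (Eₙ.sub _ _) (cong (λ x → E n (λ u → P u * (R u * R u))
                     - x) (Eₙ.scale 2ℚ (λ u → P u * R u)))))))))))))  ⟩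
          E n (λ u → P u * g u) + c * (η * E n P + s * (E n (λ u → P u * (R u * R u)) - 2ℚ * E n
              (λ u → P u * R u) + E n P))
            ≡⟨ cong₂ (λ x y → E n (λ u → P u * g u) + c *
                (η * x + s * (E n (λ u → P u * (R u * R u)) - 2ℚ * y + x))) (E-noise θ v)
                (E-noise*ratio 0≤F v) ⟩
          E n (λ u → P u * g u) + c * (η * 1ℚ + s * (E n (λ u → P u * (R u * R u)) - 2ℚ * 1ℚ + 1ℚ))
            ≡⟨ solve 5 (λ e c η s x → e :+ c :* (η :* con 1ℚ :+ s :* (x :- con 2ℚ :* con 1ℚ :+ con
                1ℚ)) := e :+ c :* (η :+ s :* (x :- con 1ℚ))) refl
                 (E n (λ u → P u * g u)) c η s (E n (λ u → P u * (R u * R u))) ⟩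
          E n (λ u → P u * g u) + c * (η + s * (E n (λ u → P u * (R u * R u)) - 1ℚ))
            ≤⟨ +-monoʳ _ (*-monoˡ c 0≤c (+-monoʳ η (*-monoˡ s (ℚ.<⇒≤ 0<s)
                (+-monoˡ (- 1ℚ) (E-noise*ratio² 0≤F v))))) ⟩
          E n (λ u → P u * g u) + c * (η + s * ((1ℚ + ε) ^ n - 1ℚ)) ∎

-- Sampled inputs and the replacement of one player's reference input

module Elimination (t : ℕ) (0<t : 0 ℕ.< t) (n : ℕ) where
  open Noise t 0<t
  module Eₙ = IsMean (E-isMean n)

  Input : Set
  Input = Vec (Fin t) n

  𝔼 : (Input → ℚ) → ℚ
  𝔼 = E n

  swap : ∀ (f : Input → Input → ℚ) → 𝔼 (λ v → 𝔼 (f v)) ≡ 𝔼 (λ u → 𝔼 (λ v → f v u))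
  swap = E-swap (E-isMean n) n

  compose : ∀ (p : Input → ℚ) (q : Input → Input → ℚ) (g : Input → ℚ) →
            𝔼 (λ z → p z * 𝔼 (λ v → q v z * g v)) ≡ 𝔼 (λ v → 𝔼 (λ z → p z * q v z) * g v)
  compose p q g = begin
    𝔼 (λ z → p z * 𝔼 (λ v → q v z * g v))
      ≡⟨ Eₙ.cong-≗ (λ z → sym (Eₙ.scale (p z) (λ v → q v z * g v))) ⟩
    𝔼 (λ z → 𝔼 (λ v → p z * (q v z * g v)))
      ≡⟨ swap (λ z v → p z * (q v z * g v)) ⟩
    𝔼 (λ v → 𝔼 (λ z → p z * (q v z * g v)))
      ≡⟨ Eₙ.cong-≗ (λ v → trans (Eₙ.cong-≗ (λ z → sym (*-assoc (p z) (q v z) (g v))))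
          (Eₙ.scaleʳ (λ z → p z * q v z) (g v))) ⟩
    𝔼 (λ v → 𝔼 (λ z → p z * q v z) * g v) ∎
    where open ≡-Reasoning

  Kernel : Set
  Kernel = Input → Input → ℚ

  -- The players have inputs v and u, but run the protocol, which pays off h, on
  -- x and y which they sample according to A and B.
  payoff : Kernel → Kernel → (Input → Input → ℚ) → Input → Input → ℚ
  payoff A B h v u = 𝔼 (λ x → 𝔼 (λ y → A v x * (B u y * h x y)))

  value : ℚ → Kernel → Kernel → (Input → Input → ℚ) → ℚ
  value θ A B h = 𝔼 (λ v → 𝔼 (λ u → noise θ v u * payoff A B h v u))

  payoff≤ : ∀ {A B h} → (∀ v x → 0ℚ ≤ A v x) → (∀ u y → 0ℚ ≤ B u y) → (∀ x y → h x y ≤ 1ℚ) →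
            ∀ v u → payoff A B h v u ≤ 𝔼 (A v) * 𝔼 (B u)
  payoff≤ {A} {B} {h} 0≤A 0≤B h≤1 v u = begin
    𝔼 (λ x → 𝔼 (λ y → A v x * (B u y * h x y)))
      ≤⟨ Eₙ.mono (λ x → Eₙ.mono (λ y → *-monoˡ (A v x) (0≤A v x)
          (≤-trans (*-monoˡ (B u y) (0≤B u y) (h≤1 x y)) (≤-reflexive (*-identityʳ (B u y)))))) ⟩
    𝔼 (λ x → 𝔼 (λ y → A v x * B u y))
      ≡⟨ Eₙ.cong-≗ (λ x → Eₙ.scale (A v x) (B u)) ⟩
    𝔼 (λ x → A v x * 𝔼 (B u))
      ≡⟨ Eₙ.scaleʳ (A v) (𝔼 (B u)) ⟩
    𝔼 (A v) * 𝔼 (B u) ∎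
    where open ≤-Reasoning

  0≤payoff : ∀ {A B h} → (∀ v x → 0ℚ ≤ A v x) → (∀ u y → 0ℚ ≤ B u y) → (∀ x y → 0ℚ ≤ h x y) →
             ∀ v u → 0ℚ ≤ payoff A B h v u
  0≤payoff 0≤A 0≤B 0≤h v u = Eₙ.nonneg (λ x → Eₙ.nonneg (λ y → 0≤* (0≤A v x)
      (0≤* (0≤B u y) (0≤h x y))))

  -- The second reference input then matters only through the mass of `B`, which is constant, so the
  -- noise integrates to 1 whatever θ is. This settles protocols that declare at once.
  value-silent : ∀ θ {A B b} (h : Input → ℚ) → (∀ u → 𝔼 (B u) ≡ b) →
                 value θ A B (λ x _ → h x) ≡ 𝔼 (λ v → 𝔼 (λ x → A v x * h x)) * b
  value-silent θ {A} {B} {b} h mass = begin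
    𝔼 (λ v → 𝔼 (λ u → noise θ v u * payoff A B (λ x _ → h x) v u))
      ≡⟨ Eₙ.cong-≗ (λ v → Eₙ.cong-≗ (λ u → *-congˡ (simplify v u))) ⟩
    𝔼 (λ v → 𝔼 (λ u → noise θ v u * (𝔼 (λ x → A v x * h x) * b)))
      ≡⟨ Eₙ.cong-≗ (λ v → trans (Eₙ.scaleʳ (noise θ v) _) (trans (*-congʳ (E-noise θ v))
          (*-identityˡ _))) ⟩
    𝔼 (λ v → 𝔼 (λ x → A v x * h x) * b)
      ≡⟨ Eₙ.scaleʳ (λ v → 𝔼 (λ x → A v x * h x)) b ⟩
    𝔼 (λ v → 𝔼 (λ x → A v x * h x)) * b ∎
    where
    open ≡-Reasoning
    simplify : ∀ v u → payoff A B (λ x _ → h x) v u ≡ 𝔼 (λ x → A v x * h x) * b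
    simplify v u = begin
      𝔼 (λ x → 𝔼 (λ y → A v x * (B u y * h x)))
        ≡⟨ Eₙ.cong-≗ (λ x → trans (Eₙ.cong-≗ (λ y → solve 3 (λ a b h → a :* (b :* h) := (a :* h) :*
            b) refl (A v x) (B u y) (h x)))
                                   (trans (Eₙ.scale (A v x * h x) (B u)) (*-congˡ (mass u)))) ⟩
      𝔼 (λ x → A v x * h x * b)
        ≡⟨ Eₙ.scaleʳ (λ x → A v x * h x) b ⟩
      𝔼 (λ x → A v x * h x) * b ∎

  module _ (K : ℚ) (1≤K : 1ℚ ≤ K) where
    private
      0≤K : 0ℚ ≤ K
      0≤K = ≤-trans 0≤1 1≤K
    open Tilt K 0≤K
    open Comparison t 0<t K 0≤K using (E-K^heavy; compare; 1≤1+3θ; 0≤1+3θ; ε)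

    -- The law of x when z is replaced by a v which has density F and agrees with z
    -- in some coordinates; A is left unnormalised, so F is the mass of A v.
    resample : ℚ → (Input → ℚ) → Kernel → Kernel
    resample α F A z x = 𝔼 (λ v → tilt α F v z * A v x)

    -- This is where the corrections in `tilt` pay off: the new kernel again has the same mass at
    -- every reference input, as the induction requires.
    resample-mass : ∀ α {A} → (∀ v x → 0ℚ ≤ A v x) → ∀ z →
                    𝔼 (resample α (λ v → 𝔼 (A v)) A z) ≡ 𝔼 (λ v → 𝔼 (A v))
    resample-mass α {A} 0≤A z = begin
      𝔼 (λ x → 𝔼 (λ v → tilt α F v z * A v x))  ≡⟨ swap (λ x v → tilt α F v z * A v x) ⟩
      𝔼 (λ v → 𝔼 (λ x → tilt α F v z * A v x))
          ≡⟨ Eₙ.cong-≗ (λ v → trans (Eₙ.scale (tilt α F v z) (A v)) (*-comm (tilt α F v z) (F v))) ⟩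
      𝔼 (λ v → F v * tilt α F v z)                ≡⟨ E-F*tilt α (λ v → Eₙ.nonneg (0≤A v)) z ⟩
      𝔼 F                                         ∎
      where
      open ≡-Reasoning
      F : Input → ℚ
      F v = 𝔼 (A v)

    -- A noisy copy of z with parameter ϑ is a tilted copy of v with parameter ϑ * α.
    value-resample : ∀ ϑ α {F} → (∀ v → 0ℚ ≤ F v) → ∀ A B h →
                     value ϑ B (resample α F A) h ≡ 𝔼 (λ v → 𝔼 (λ u → tilt (ϑ * α) F v u * payoff B
                         A h u v))
    value-resample ϑ α {F} 0≤F A B h = begin
      𝔼 (λ u → 𝔼 (λ z → noise ϑ u z * payoff B (resample α F A) h u z))
        ≡⟨ Eₙ.cong-≗ (λ u → Eₙ.cong-≗ (λ z → *-congˡ (pull u z))) ⟩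
      𝔼 (λ u → 𝔼 (λ z → noise ϑ u z * 𝔼 (λ v → tilt α F v z * payoff B A h u v)))
        ≡⟨ Eₙ.cong-≗ (λ u → compose (noise ϑ u) (λ v z → tilt α F v z) (λ v → payoff B A h u v)) ⟩
      𝔼 (λ u → 𝔼 (λ v → 𝔼 (λ z → noise ϑ u z * tilt α F v z) * payoff B A h u v))
        ≡⟨ Eₙ.cong-≗ (λ u → Eₙ.cong-≗ (λ v → *-congʳ (E-noise*tilt ϑ α 0≤F v u))) ⟩
      𝔼 (λ u → 𝔼 (λ v → tilt (ϑ * α) F v u * payoff B A h u v))
        ≡⟨ swap (λ u v → tilt (ϑ * α) F v u * payoff B A h u v) ⟩
      𝔼 (λ v → 𝔼 (λ u → tilt (ϑ * α) F v u * payoff B A h u v)) ∎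
      where
      open ≡-Reasoning
      pull : ∀ u z → payoff B (resample α F A) h u z ≡ 𝔼 (λ v → tilt α F v z * payoff B A h u v)
      pull u z = begin
        𝔼 (λ y → 𝔼 (λ x → B u y * (𝔼 (λ v → tilt α F v z * A v x) * h y x)))
          ≡⟨ Eₙ.cong-≗ (λ y → trans (Eₙ.cong-≗ (λ x → inner y x))
              (swap (λ x v → tilt α F v z * (B u y * (A v x * h y x))))) ⟩
        𝔼 (λ y → 𝔼 (λ v → 𝔼 (λ x → tilt α F v z * (B u y * (A v x * h y x)))))
          ≡⟨ swap (λ y v → 𝔼 (λ x → tilt α F v z * (B u y * (A v x * h y x)))) ⟩
        𝔼 (λ v → 𝔼 (λ y → 𝔼 (λ x → tilt α F v z * (B u y * (A v x * h y x)))))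
          ≡⟨ Eₙ.cong-≗ (λ v → trans (Eₙ.cong-≗ (λ y → Eₙ.scale (tilt α F v z)
              (λ x → B u y * (A v x * h y x))))
                                     (Eₙ.scale (tilt α F v z) (λ y → 𝔼
                                         (λ x → B u y * (A v x * h y x))))) ⟩
        𝔼 (λ v → tilt α F v z * payoff B A h u v) ∎
        where
        inner : ∀ y x → B u y * (𝔼 (λ v → tilt α F v z * A v x) * h y x) ≡ 𝔼 (λ v → tilt α F v z *
            (B u y * (A v x * h y x)))
        inner y x = trans (*-congˡ (sym (Eₙ.scaleʳ (λ v → tilt α F v z * A v x) (h y x))))
          (trans (sym (Eₙ.scale (B u y) (λ v → tilt α F v z * A v x * h y x)))
            (Eₙ.cong-≗ (λ v → solve 4 (λ b t a h → b :* (t :* a :* h) := t :* (b :* (a :* h))) refl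
                (B u y) (tilt α F v z) (A v x) (h y x))))

    module _ {θ : ℚ} (0≤θ : 0ℚ ≤ θ) (3θ≤1 : 3ℚ * θ ≤ 1ℚ) (θK≤1 : θ * (K + 1ℚ) ≤ 1ℚ)
             {η s : ℚ} (0≤η : 0ℚ ≤ η) (0<s : 0ℚ < s) (1≤4ηs : 1ℚ ≤ 4ℚ * (η * s))
             (B : ℕ) {ρ : ℚ} (0≤ρ : 0ℚ ≤ ρ) (1≤ρK^B : 1ℚ ≤ ρ * K ^ B) where

      -- `κ₁` accounts for up to `B` heavy coordinates and for the χ² distance, and is charged to
      -- the mass of `F`. `κ₂` accounts for inputs with more heavy coordinates; these are rare only
      -- under the uniform law, so it is charged to the maximum of `F`.
      κ₁ κ₂ : ℚ
      κ₁ = ((1ℚ + 3ℚ * θ) ^ B - 1ℚ) + (η + s * ((1ℚ + 2ℚ * ((θ * (K + 1ℚ)) * (θ * (K + 1ℚ)))) ^ n -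
          1ℚ))
      κ₂ = (1ℚ + 3ℚ * θ) ^ n * (ρ * 2ℚ ^ n)

      private
        Λ : ℚ
        Λ = 1ℚ + 3ℚ * θ
        1≤Λ : 1ℚ ≤ Λ
        1≤Λ = 1≤1+3θ 0≤θ 3θ≤1 θK≤1
        0≤Λ : 0ℚ ≤ Λ
        0≤Λ = 0≤1+3θ 0≤θ 3θ≤1 θK≤1
        χ : ℚ
        χ = η + s * ((1ℚ + 2ℚ * ((θ * (K + 1ℚ)) * (θ * (K + 1ℚ)))) ^ n - 1ℚ)

      -- Markov's inequality for the exponential moment: `ρ * K ^ h` is at least 1 as soon as `h`
      -- reaches `B`, and there the trivial bound `Λ ^ n` is used.
      Λ^heavy≤ : ∀ {h} → h ℕ.≤ n → Λ ^ h - 1ℚ ≤ (Λ ^ B - 1ℚ) + Λ ^ n * (ρ * K ^ h)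
      Λ^heavy≤ {h} h≤n with ℕ.≤-total h B
      ... | inj₁ h≤B = ≤-trans (+-monoˡ (- 1ℚ) (^-monoʳ 1≤Λ h≤B))
                               (≤-slack _ (0≤* (0≤^ n 0≤Λ) (0≤* 0≤ρ (0≤^ h 0≤K))) refl)
      ... | inj₂ B≤h = begin
        Λ ^ h - 1ℚ                                ≤⟨ +-monoˡ (- 1ℚ) (^-monoʳ 1≤Λ h≤n) ⟩
        Λ ^ n - 1ℚ                                ≡⟨ cong (_- 1ℚ) (*-identityʳ (Λ ^ n)) ⟨
        Λ ^ n * 1ℚ - 1ℚ                           ≤⟨ +-monoˡ (- 1ℚ) (*-monoˡ (Λ ^ n) (0≤^ n 0≤Λ)
            (≤-trans 1≤ρK^B (*-monoˡ ρ 0≤ρ (^-monoʳ 1≤K B≤h)))) ⟩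
        Λ ^ n * (ρ * K ^ h) - 1ℚ                  ≤⟨ ≤-slack _ (0≤^ B 0≤Λ)
            (solve 2 (λ x y → x :- con 1ℚ :+ y := (y :- con 1ℚ) :+ x) refl (Λ ^ n * (ρ * K ^ h))
            (Λ ^ B)) ⟩
        (Λ ^ B - 1ℚ) + Λ ^ n * (ρ * K ^ h)        ∎
        where open ≤-Reasoning

      -- Letting the bound on `g` vary with v as `b * F v` makes the main loss proportional to the
      -- mass of `F`; averaged over the messages these masses give back the mass of the kernel that
      -- was split.
      eliminate : ∀ {F : Input → ℚ} {a b} → (∀ v → 0ℚ ≤ F v) → (∀ v → F v ≤ a) → 0ℚ ≤ b →
                  ∀ {g : Input → Input → ℚ} → (∀ v u → 0ℚ ≤ g v u) → (∀ v u → g v u ≤ b * F v) →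
                  𝔼 (λ v → 𝔼 (λ u → tilt θ F v u * g v u)) ≤
                  𝔼 (λ v → 𝔼 (λ u → noise θ v u * g v u)) + b * (𝔼 F * κ₁ + a * κ₂)
      eliminate {F} {a} {b} 0≤F F≤a 0≤b {g} 0≤g g≤ = begin
        𝔼 (λ v → 𝔼 (λ u → tilt θ F v u * g v u))
          ≤⟨ Eₙ.mono (λ v → ≤-trans (compare 0≤θ 3θ≤1 θK≤1 0≤η 0<s 1≤4ηs 0≤F v (0≤g v) (g≤ v))
              (+-monoʳ (G v) (pointwise v))) ⟩
        𝔼 (λ v → G v + b * (F v * κ₁ + a * (Λ ^ n * ρ) * K ^ heavy F v))
          ≡⟨ trans (Eₙ.add G _) (+-congˡ (trans (Eₙ.scale b _)
              (*-congˡ (trans (Eₙ.add _ _) (cong₂ _+_ (Eₙ.scaleʳ F κ₁) (Eₙ.scale (a * (Λ ^ n * ρ))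
              (λ v → K ^ heavy F v))))))) ⟩
        𝔼 G + b * (𝔼 F * κ₁ + a * (Λ ^ n * ρ) * 𝔼 (λ v → K ^ heavy F v))
          ≤⟨ +-monoʳ (𝔼 G) (*-monoˡ b 0≤b (+-monoʳ (𝔼 F * κ₁)
              (*-monoˡ _ (0≤* 0≤a (0≤* (0≤^ n 0≤Λ) 0≤ρ)) (E-K^heavy 0≤F)))) ⟩
        𝔼 G + b * (𝔼 F * κ₁ + a * (Λ ^ n * ρ) * 2ℚ ^ n)
          ≡⟨ solve 7 (λ G b F κ a l r → G :+ b :* (F :* κ :+ a :* l :* r) := G :+ b :*
              (F :* κ :+ a :* (l :* r))) refl (𝔼 G) b (𝔼 F) κ₁ a (Λ ^ n * ρ) (2ℚ ^ n) ⟩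
        𝔼 G + b * (𝔼 F * κ₁ + a * (Λ ^ n * ρ * 2ℚ ^ n))
          ≡⟨ +-congˡ (*-congˡ (+-congˡ (*-congˡ (*-assoc (Λ ^ n) ρ (2ℚ ^ n))))) ⟩
        𝔼 G + b * (𝔼 F * κ₁ + a * κ₂) ∎
        where
        open ≤-Reasoning
        G : Input → ℚ
        G v = 𝔼 (λ u → noise θ v u * g v u)
        0≤a : 0ℚ ≤ a
        0≤a = ≤-trans (Eₙ.nonneg 0≤F) (Eₙ.bounded F≤a)
        pointwise : ∀ v → b * F v * ((Λ ^ heavy F v - 1ℚ) + χ) ≤ b * (F v * κ₁ + a * (Λ ^ n * ρ) * K
            ^ heavy F v)
        pointwise v = begin
          b * F v * ((Λ ^ heavy F v - 1ℚ) + χ)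
            ≤⟨ *-monoˡ (b * F v) (0≤* 0≤b (0≤F v)) (+-monoˡ χ (Λ^heavy≤ (heavy≤n F v))) ⟩
          b * F v * ((Λ ^ B - 1ℚ) + Λ ^ n * (ρ * k) + χ)
            ≡⟨ solve 7 (λ b f l n′ r k χ → b :* f :* (l :+ n′ :* (r :* k) :+ χ) := b :*
                (f :* (l :+ χ) :+ f :* (n′ :* r :* k))) refl b (F v) (Λ ^ B - 1ℚ) (Λ ^ n) ρ k χ ⟩
          b * (F v * κ₁ + F v * (Λ ^ n * ρ * k))
            ≤⟨ *-monoˡ b 0≤b (+-monoʳ (F v * κ₁) (*-monoʳ _ (0≤* (0≤* (0≤^ n 0≤Λ) 0≤ρ)
                (0≤^ (heavy F v) 0≤K)) (F≤a v))) ⟩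
          b * (F v * κ₁ + a * (Λ ^ n * ρ * k))
            ≡⟨ *-congˡ (+-congˡ (sym (*-assoc a (Λ ^ n * ρ) k))) ⟩
          b * (F v * κ₁ + a * (Λ ^ n * ρ) * k) ∎
          where k = K ^ heavy F v

-- Binary codes for moves

bit : Fin 2 → Bool
bit zero    = false
bit (suc _) = true

bit⁻¹ : Bool → Fin 2
bit⁻¹ false = zero
bit⁻¹ true  = suc zero

bit-bit⁻¹ : ∀ b → bit (bit⁻¹ b) ≡ b
bit-bit⁻¹ false = refl
bit-bit⁻¹ true  = refl

lengthen : ∀ {b} → Message b → Message (suc b)
lengthen (v , p) = v , ℕ.m≤n⇒m≤1+n p

-- Leading zeros and a first one pad a message to the maximum length.
message : ∀ b → Vec (Fin 2) (suc b) → Message b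
message zero    _           = [] , ℕ.z≤n
message (suc b) (zero  ∷ v) = lengthen (message b v)
message (suc b) (suc _ ∷ v) = Vec.map bit v , ℕ.≤-refl

message-surjective : ∀ b (m : Message b) → ∃ λ v → message b v ≡ m
message-surjective b m@(w , _) = go b w (isBounded m)
  where
  go : ∀ b {l} (w : Vec Bool l) (l≤b : l ℕ.≤ b) → ∃ λ v → message b v ≡ (w , l≤b)
  go zero    []  ℕ.z≤n = zero ∷ [] , refl
  go (suc b) {l} w l≤1+b with ℕ.m≤n⇒m<n∨m≡n l≤1+b
  ... | inj₁ (ℕ.s≤s l≤b) with go b w l≤b
  ...   | v , eq = zero ∷ v , cong lengthen eq
  go (suc b) w l≤1+b | inj₂ refl = suc zero ∷ Vec.map bit⁻¹ w , cong (_, ℕ.≤-refl)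
    (trans (sym (Vec.map-∘ bit bit⁻¹ w)) (trans (Vec.map-cong bit-bit⁻¹ w) (Vec.map-id w)))

-- The first bit tells a message from an output, so that declaring early is one more kind of move
-- and needs no separate case in the elimination. Codes are vectors over `Fin 2` so that averages
-- over them are again instances of `Uniform`.
move : ∀ b → Vec (Fin 2) (suc (suc b)) → Bool ⊎ Message b
move b (zero  ∷ v)     = inj₂ (message b v)
move b (suc _ ∷ o ∷ _) = inj₁ (bit o)

move-surjective : ∀ b (m : Bool ⊎ Message b) → ∃ λ v → move b v ≡ m
move-surjective b (inj₁ o) = suc zero ∷ bit⁻¹ o ∷ Vec.replicate b zero , cong inj₁ (bit-bit⁻¹ o)
move-surjective b (inj₂ m) with message-surjective b m
... | v , eq = zero ∷ v , cong inj₂ eq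

-- Induction over the rounds

rejects : ∀ {X Y b r} → Protocol X Y b r → X → Y → ℚ
rejects π x y = if run π x y then 0ℚ else 1ℚ

0≤rejects : ∀ {X Y b r} (π : Protocol X Y b r) x y → 0ℚ ≤ rejects π x y
0≤rejects π x y with run π x y
... | true  = ≤-refl
... | false = 0≤1

rejects≤1 : ∀ {X Y b r} (π : Protocol X Y b r) x y → rejects π x y ≤ 1ℚ
rejects≤1 π x y with run π x y
... | true  = 0≤1
... | false = ≤-refl

-- The code length m is a variable so that the mean over all codes does not unfold.
module Rounds (t : ℕ) (0<t : 0 ℕ.< t) (n bits : ℕ) {m : ℕ}
              (decode : Vec (Fin 2) m → Bool ⊎ Message bits) (decode-surjective : ∀ l → ∃ λ c →
                  decode c ≡ l) where
  open Elimination t 0<t n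
  open Noise t 0<t

  -- Up to κ, correlating the inputs does not make rejection less likely than it
  -- is for independent ones.
  Bounded : ℕ → ℚ → ℚ → Set
  Bounded r θ κ = ∀ (π : Protocol Input Input bits r) {A B a b} →
    (∀ v x → 0ℚ ≤ A v x) → (∀ u y → 0ℚ ≤ B u y) → (∀ v → 𝔼 (A v) ≡ a) → (∀ u → 𝔼 (B u) ≡ b) →
    value 0ℚ A B (rejects π) ≤ value θ A B (rejects π) + κ * (a * b)

  0≤mass : ∀ {A : Kernel} {a} → (∀ v x → 0ℚ ≤ A v x) → (∀ v → 𝔼 (A v) ≡ a) → 0ℚ ≤ a
  0≤mass {A} {a} 0≤A mass = ≤-trans (Eₙ.nonneg (λ v → Eₙ.nonneg (0≤A v)))
                                    (≤-reflexive (trans (Eₙ.cong-≗ mass) (Eₙ.const a)))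

  bounded-declare : ∀ {r θ κ} → 0ℚ ≤ κ → ∀ (o : Input → Bool) {A B a b} →
    (∀ v x → 0ℚ ≤ A v x) → (∀ u y → 0ℚ ≤ B u y) → (∀ v → 𝔼 (A v) ≡ a) → (∀ u → 𝔼 (B u) ≡ b) →
    value 0ℚ A B (rejects (declare {b = bits} {r = r} o)) ≤ value θ A B
        (rejects (declare {b = bits} {r = r} o)) + κ * (a * b)
  bounded-declare {θ = θ} {κ} 0≤κ o {A} {B} {a} {b} 0≤A 0≤B massA massB =
    ≤-slack (κ * (a * b)) (0≤* 0≤κ (0≤* (0≤mass 0≤A massA) (0≤mass 0≤B massB)))
      (cong (_+ κ * (a * b)) (trans (value-silent 0ℚ {A} {B} (λ x → if o x then 0ℚ else 1ℚ) massB)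
                                    (sym (value-silent θ {A} {B} (λ x → if o x then 0ℚ else 1ℚ)
                                        massB))))

  bounded-0 : ∀ {θ κ} → 0ℚ ≤ κ → Bounded 0 θ κ
  bounded-0 {θ} 0≤κ (declare o) = bounded-declare {r = 0} {θ} 0≤κ o

  module _ {K : ℚ} (1≤K : 1ℚ ≤ K)
           {θ θ′ α : ℚ} (θ′α≡θ : θ′ * α ≡ θ) (0≤α : 0ℚ ≤ α) (αK≤1 : α * (K + 1ℚ) ≤ 1ℚ)
           (0≤θ : 0ℚ ≤ θ) (3θ≤1 : 3ℚ * θ ≤ 1ℚ) (θK≤1 : θ * (K + 1ℚ) ≤ 1ℚ)
           {η s : ℚ} (0≤η : 0ℚ ≤ η) (0<s : 0ℚ < s) (1≤4ηs : 1ℚ ≤ 4ℚ * (η * s))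
           (B# : ℕ) {ρ : ℚ} (0≤ρ : 0ℚ ≤ ρ) (1≤ρK^B : 1ℚ ≤ ρ * K ^ B#) where
    private
      0≤K : 0ℚ ≤ K
      0≤K = ≤-trans 0≤1 1≤K
      module C where
        open Noise 2 (ℕ.s≤s ℕ.z≤n) public
      module Eₘ = IsMean (C.E-isMean m)
      k₁ k₂ : ℚ
      k₁ = κ₁ K 1≤K 0≤θ 3θ≤1 θK≤1 0≤η 0<s 1≤4ηs B# 0≤ρ 1≤ρK^B
      k₂ = κ₂ K 1≤K 0≤θ 3θ≤1 θK≤1 0≤η 0<s 1≤4ηs B# 0≤ρ 1≤ρK^B
    open Tilt K 0≤K

    -- `A` is split by the code of the first move and each piece is resampled, after which the other
    -- player starts. The term `k₁` is weighted by the masses of the pieces, whose average is `a`;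
    -- the term `k₂` acquires the number of codes, since a single piece is only bounded by
    -- `a * ι 2 ^ m`.
    bounded-suc : ∀ {r κ κ*} → 0ℚ ≤ κ* → κ + k₁ + ι 2 ^ m * k₂ ≤ κ* → Bounded r θ′ κ → Bounded
        (suc r) θ κ*
    bounded-suc {r} 0≤κ* _ rec (declare o) = bounded-declare {r = suc r} {θ} 0≤κ* o
    bounded-suc {r} {κ} {κ*} 0≤κ* κ≤κ* rec (act choose next) {A} {B} {a} {b} 0≤A 0≤B massA massB =
        begin
      value 0ℚ A B h
        ≡⟨ decompose 0ℚ ⟩
      C.E m (λ ℓ → 𝔼 (λ v → 𝔼 (λ u → noise 0ℚ v u * g ℓ v u)))
        -- Without noise the tilt is trivial too, so independent pairs pass to the shorter protocol
        -- exactly.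
        ≡⟨ Eₘ.cong-≗ (λ ℓ → trans (Eₙ.cong-≗ (λ v → Eₙ.cong-≗ (λ u → *-congʳ (no-noise ℓ v u))))
            (sym (value-resample K 1≤K 0ℚ α (0≤F ℓ) (A# ℓ) B (h# ℓ)))) ⟩
      C.E m (λ ℓ → value 0ℚ B (A′ ℓ) (h# ℓ))
        -- The receiver of the message acts next, so the kernels change places.
        ≤⟨ Eₘ.mono (λ ℓ → rec (next# ℓ) 0≤B (0≤A′ ℓ) massB (resample-mass K 1≤K α (0≤A# ℓ))) ⟩
      C.E m (λ ℓ → value θ′ B (A′ ℓ) (h# ℓ) + κ * (b * 𝔼 (F ℓ)))
        ≡⟨ Eₘ.cong-≗ (λ ℓ → cong (_+ κ * (b * 𝔼 (F ℓ))) (trans (value-resample K 1≤K θ′ α (0≤F ℓ)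
            (A# ℓ) B (h# ℓ))
             (Eₙ.cong-≗ (λ v → Eₙ.cong-≗ (λ u → cong (λ x → tilt x (F ℓ) v u * g ℓ v u) θ′α≡θ))))) ⟩
      C.E m (λ ℓ → 𝔼 (λ v → 𝔼 (λ u → tilt θ (F ℓ) v u * g ℓ v u)) + κ * (b * 𝔼 (F ℓ)))
        ≤⟨ Eₘ.mono (λ ℓ → +-monoˡ (κ * (b * 𝔼 (F ℓ)))
             (eliminate K 1≤K 0≤θ 3θ≤1 θK≤1 0≤η 0<s 1≤4ηs B# 0≤ρ 1≤ρK^B (0≤F ℓ) (F≤ ℓ)
                 (0≤mass 0≤B massB) (λ v u → 0≤payoff 0≤B (0≤A# ℓ) (0≤rejects (next# ℓ)) u v)
               (λ v u → ≤-trans (payoff≤ 0≤B (0≤A# ℓ) (rejects≤1 (next# ℓ)) u v)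
                   (≤-reflexive (*-congʳ (massB u)))))) ⟩
      C.E m (λ ℓ → N ℓ + b * (𝔼 (F ℓ) * k₁ + a * ι 2 ^ m * k₂) + κ * (b * 𝔼 (F ℓ)))
        ≡⟨ Eₘ.cong-≗ (λ ℓ → solve 8 (λ N b f k₁ a p k₂ κ → N :+ b :* (f :* k₁ :+ a :* p :* k₂) :+ κ
            :* (b :* f)
             := N :+ ((b :* k₁ :+ κ :* b) :* f :+ b :* (a :* p :* k₂))) refl (N ℓ) b (𝔼 (F ℓ)) k₁ a
                 (ι 2 ^ m) k₂ κ) ⟩
      C.E m (λ ℓ → N ℓ + ((b * k₁ + κ * b) * 𝔼 (F ℓ) + b * (a * ι 2 ^ m * k₂)))
        ≡⟨ trans (Eₘ.add N _) (+-congˡ (trans (Eₘ.add _ _)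
            (cong₂ _+_ (trans (Eₘ.scale (b * k₁ + κ * b) (λ ℓ → 𝔼 (F ℓ))) (*-congˡ mass-F))
            (Eₘ.const _)))) ⟩
      C.E m N + ((b * k₁ + κ * b) * a + b * (a * ι 2 ^ m * k₂))
        ≡⟨ cong (_+ ((b * k₁ + κ * b) * a + b * (a * ι 2 ^ m * k₂))) (decompose θ) ⟨
      value θ A B h + ((b * k₁ + κ * b) * a + b * (a * ι 2 ^ m * k₂))
        ≡⟨ +-congˡ (solve 6 (λ b k₁ κ a p k₂ → (b :* k₁ :+ κ :* b) :* a :+ b :* (a :* p :* k₂) :=
            (κ :+ k₁ :+ p :* k₂) :* (a :* b)) refl b k₁ κ a (ι 2 ^ m) k₂) ⟩
      value θ A B h + (κ + k₁ + ι 2 ^ m * k₂) * (a * b)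
        ≤⟨ +-monoʳ (value θ A B h) (*-monoʳ (a * b) (0≤* (0≤mass 0≤A massA) (0≤mass 0≤B massB))
            κ≤κ*) ⟩
      value θ A B h + κ* * (a * b) ∎
      where
      open ≤-Reasoning
      h : Input → Input → ℚ
      h = rejects (act choose next)
      code : Input → Vec (Fin 2) m
      code x = proj₁ (decode-surjective (choose x))
      -- An output becomes a protocol in which the other player declares it, so every code leads to
      -- a protocol with one round less.
      after : Bool ⊎ Message bits → Protocol Input Input bits r
      after = [ (λ o → declare (λ _ → o)) , next ]′
      next# : Vec (Fin 2) m → Protocol Input Input bits r
      next# ℓ = after (decode ℓ)
      h# : Vec (Fin 2) m → Input → Input → ℚ
      h# ℓ = rejects (next# ℓ)
      h≡h# : ∀ x y → h# (code x) y x ≡ h x y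
      h≡h# x y = trans (cong (λ l → rejects (after l) y x) (proj₂ (decode-surjective (choose x))))
          continue
        where
        continue : rejects (after (choose x)) y x ≡ rejects (act choose next) x y
        continue with choose x
        ... | inj₁ o = refl
        ... | inj₂ μ = refl
      -- `A# ℓ` is the part of `A` whose first move has code `ℓ`, as a density relative to uniform
      -- `ℓ`; averaging over `ℓ` recovers `A` in `mass-F` and `payoff-code`.
      A# A′ : Vec (Fin 2) m → Kernel
      A# ℓ v x = A v x * C.Δ (code x) ℓ
      F : Vec (Fin 2) m → Input → ℚ
      F ℓ v = 𝔼 (A# ℓ v)
      A′ ℓ = resample K 1≤K α (F ℓ) (A# ℓ)
      0≤A# : ∀ ℓ v x → 0ℚ ≤ A# ℓ v x
      0≤A# ℓ v x = 0≤* (0≤A v x) (C.0≤Δ (code x) ℓ)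
      0≤F : ∀ ℓ v → 0ℚ ≤ F ℓ v
      0≤F ℓ v = Eₙ.nonneg (0≤A# ℓ v)
      0≤A′ : ∀ ℓ v x → 0ℚ ≤ A′ ℓ v x
      0≤A′ ℓ z x = Eₙ.nonneg (λ v → 0≤* (0≤tilt 0≤α αK≤1 (0≤F ℓ) v z) (0≤A# ℓ v x))
      -- The unnormalised form of the statement that a message of O(n) bits leaves a set of inputs
      -- of density 2^-O(n): a point mass on codes has density at most 2^m.
      F≤ : ∀ ℓ v → F ℓ v ≤ a * ι 2 ^ m
      F≤ ℓ v = ≤-trans (Eₙ.mono (λ x → *-monoˡ (A v x) (0≤A v x) (C.Δ-bound (code x) ℓ)))
                       (≤-reflexive (trans (Eₙ.scaleʳ (A v) (ι 2 ^ m)) (*-congʳ (massA v))))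
      g : Vec (Fin 2) m → Input → Input → ℚ
      g ℓ v u = payoff B (A# ℓ) (h# ℓ) u v
      N : Vec (Fin 2) m → ℚ
      N ℓ = 𝔼 (λ v → 𝔼 (λ u → noise θ v u * g ℓ v u))
      no-noise : ∀ ℓ v u → noise 0ℚ v u ≡ tilt (0ℚ * α) (F ℓ) v u
      no-noise ℓ v u = trans (noise-0 v u) (sym (trans (cong (λ x → tilt x (F ℓ) v u) (zeroˡ α))
          (tilt-0 v u)))
      mass-F : C.E m (λ ℓ → 𝔼 (F ℓ)) ≡ a
      mass-F = ≡.begin
        C.E m (λ ℓ → 𝔼 (λ v → 𝔼 (λ x → A v x * C.Δ (code x) ℓ)))
          ≡.≡⟨ C.E-swap (E-isMean n) m (λ ℓ v → 𝔼 (λ x → A v x * C.Δ (code x) ℓ)) ⟩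
        𝔼 (λ v → C.E m (λ ℓ → 𝔼 (λ x → A v x * C.Δ (code x) ℓ)))
          ≡.≡⟨ Eₙ.cong-≗ (λ v → C.E-swap (E-isMean n) m (λ ℓ x → A v x * C.Δ (code x) ℓ)) ⟩
        𝔼 (λ v → 𝔼 (λ x → C.E m (λ ℓ → A v x * C.Δ (code x) ℓ)))
          ≡.≡⟨ Eₙ.cong-≗ (λ v → trans (Eₙ.cong-≗ (λ x → trans (Eₘ.scale (A v x) (C.Δ (code x)))
              (trans (*-congˡ (E-Δ-unit (code x))) (*-identityʳ (A v x))))) (massA v)) ⟩
        𝔼 (λ v → a)
          ≡.≡⟨ Eₙ.const a ⟩
        a ≡.∎
        where
        module ≡ = ≡-Reasoning
        E-Δ-unit : ∀ c → C.E m (C.Δ c) ≡ 1ℚ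
        E-Δ-unit c = trans (Eₘ.cong-≗ (λ ℓ → sym (*-identityʳ (C.Δ c ℓ)))) (C.E-Δ c (λ _ → 1ℚ))
      payoff-code : ∀ v u → payoff A B h v u ≡ C.E m (λ ℓ → g ℓ v u)
      payoff-code v u = sym (≡.begin
        C.E m (λ ℓ → 𝔼 (λ y → 𝔼 (λ x → B u y * (A v x * C.Δ (code x) ℓ * h# ℓ y x))))
          ≡.≡⟨ C.E-swap (E-isMean n) m (λ ℓ y → 𝔼 (λ x → B u y * (A v x * C.Δ (code x) ℓ * h# ℓ y
              x))) ⟩
        𝔼 (λ y → C.E m (λ ℓ → 𝔼 (λ x → B u y * (A v x * C.Δ (code x) ℓ * h# ℓ y x))))
          ≡.≡⟨ Eₙ.cong-≗ (λ y → C.E-swap (E-isMean n) m (λ ℓ x → B u y * (A v x * C.Δ (code x) ℓ *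
              h# ℓ y x))) ⟩
        𝔼 (λ y → 𝔼 (λ x → C.E m (λ ℓ → B u y * (A v x * C.Δ (code x) ℓ * h# ℓ y x))))
          ≡.≡⟨ Eₙ.cong-≗ (λ y → Eₙ.cong-≗ (λ x → trans
                 (Eₘ.cong-≗ (λ ℓ → solve 4 (λ b a d h → b :* (a :* d :* h) := a :* b :* (d :* h))
                     refl (B u y) (A v x) (C.Δ (code x) ℓ) (h# ℓ y x)))
                 (trans (Eₘ.scale (A v x * B u y) (λ ℓ → C.Δ (code x) ℓ * h# ℓ y x))
                   (trans (*-congˡ (trans (C.E-Δ (code x) (λ ℓ → h# ℓ y x)) (h≡h# x y)))
                       (*-assoc (A v x) (B u y) (h x y)))))) ⟩
        𝔼 (λ y → 𝔼 (λ x → A v x * (B u y * h x y)))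
          ≡.≡⟨ swap (λ y x → A v x * (B u y * h x y)) ⟩
        𝔼 (λ x → 𝔼 (λ y → A v x * (B u y * h x y))) ≡.∎)
        where module ≡ = ≡-Reasoning
      decompose : ∀ ϑ → value ϑ A B h ≡ C.E m (λ ℓ → 𝔼 (λ v → 𝔼 (λ u → noise ϑ v u * g ℓ v u)))
      decompose ϑ = ≡.begin
        𝔼 (λ v → 𝔼 (λ u → noise ϑ v u * payoff A B h v u))
          ≡.≡⟨ Eₙ.cong-≗ (λ v → Eₙ.cong-≗ (λ u → trans (*-congˡ (payoff-code v u))
              (sym (Eₘ.scale (noise ϑ v u) (λ ℓ → g ℓ v u))))) ⟩
        𝔼 (λ v → 𝔼 (λ u → C.E m (λ ℓ → noise ϑ v u * g ℓ v u)))
          ≡.≡⟨ Eₙ.cong-≗ (λ v → sym (C.E-swap (E-isMean n) m (λ ℓ u → noise ϑ v u * g ℓ v u))) ⟩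
        𝔼 (λ v → C.E m (λ ℓ → 𝔼 (λ u → noise ϑ v u * g ℓ v u)))
          ≡.≡⟨ sym (C.E-swap (E-isMean n) m (λ ℓ v → 𝔼 (λ u → noise ϑ v u * g ℓ v u))) ⟩
        C.E m (λ ℓ → 𝔼 (λ v → 𝔼 (λ u → noise ϑ v u * g ℓ v u))) ≡.∎
        where module ≡ = ≡-Reasoning

-- Growth of the noise and choice of the parameters

m<2^m : ∀ m → m ℕ.< 2 ℕ.^ m
m<2^m zero    = ℕ.s≤s ℕ.z≤n
m<2^m (suc m) = ℕ.+-mono-≤ (ℕ.m^n>0 2 m) (ℕ.≤-trans (m<2^m m)
    (ℕ.≤-reflexive (sym (ℕ.+-identityʳ _))))

m≤2^m : ∀ m → m ℕ.≤ 2 ℕ.^ m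
m≤2^m m = ℕ.<⇒≤ (m<2^m m)

m≤m*m : ∀ m → m ℕ.≤ m ℕ.* m
m≤m*m zero    = ℕ.z≤n
m≤m*m (suc m) = ℕ.m≤m*n (suc m) (suc m)

module Growth (C : ℕ) where

  -- Noise N/n at one round becomes next N/n at the next one.  Values are called
  -- heavy beyond K = 2 ^ exponent N, which makes K ^ (n/N²) exceed the number of
  -- messages, so that only n/N² coordinates are heavy.
  exponent : ℕ → ℕ
  exponent N = 2 ℕ.* (N ℕ.* N) ℕ.* (C ℕ.+ 5)

  next : ℕ → ℕ
  next N = N ℕ.* 2 ℕ.^ suc (exponent N)

  grow : ℕ → ℕ → ℕ
  grow zero    N = N
  grow (suc r) N = grow r (next N)

  2N≤next : ∀ N → 2 ℕ.* N ℕ.≤ next N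
  2N≤next N = begin
    2 ℕ.* N                            ≡⟨ ℕ.*-comm 2 N ⟩
    N ℕ.* (2 ℕ.* 1)                    ≤⟨ ℕ.*-monoʳ-≤ N (ℕ.*-monoʳ-≤ 2 (ℕ.m^n>0 2 (exponent N))) ⟩
    N ℕ.* (2 ℕ.* 2 ℕ.^ exponent N)     ∎
    where open ℕ.≤-Reasoning

  N≤next : ∀ N → N ℕ.≤ next N
  N≤next N = ℕ.≤-trans (ℕ.m≤m+n N _) (2N≤next N)

  N≤grow : ∀ r N → N ℕ.≤ grow r N
  N≤grow zero    N = ℕ.≤-refl
  N≤grow (suc r) N = ℕ.≤-trans (N≤next N) (N≤grow r (next N))

  3N≤exponent : ∀ N → N ℕ.+ N ℕ.+ N ℕ.≤ exponent N
  3N≤exponent N = begin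
    N ℕ.+ N ℕ.+ N                               ≤⟨ ℕ.+-mono-≤ (ℕ.+-mono-≤ (m≤m*m N) (m≤m*m N))
        (m≤m*m N) ⟩
    Q ℕ.+ Q ℕ.+ Q                               ≤⟨ ℕ.m≤m+n _ _ ⟩
    Q ℕ.+ Q ℕ.+ Q ℕ.+ (7 ℕ.* Q ℕ.+ 2 ℕ.* Q ℕ.* C)   ≡⟨ eq Q C ⟩
    2 ℕ.* Q ℕ.* (C ℕ.+ 5)                       ∎
    where
    open ℕ.≤-Reasoning
    Q = N ℕ.* N
    eq : ∀ Q C → Q ℕ.+ Q ℕ.+ Q ℕ.+ (7 ℕ.* Q ℕ.+ 2 ℕ.* Q ℕ.* C) ≡ 2 ℕ.* Q ℕ.* (C ℕ.+ 5)
    eq = ℕ-Solver.solve-∀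

  N⁴≤next : ∀ N → (N ℕ.* N) ℕ.* (N ℕ.* N) ℕ.≤ next N
  N⁴≤next N = begin
    (N ℕ.* N) ℕ.* (N ℕ.* N)                          ≡⟨ ℕ.*-assoc N N (N ℕ.* N) ⟩
    N ℕ.* (N ℕ.* (N ℕ.* N))                          ≡⟨ cong (N ℕ.*_) (ℕ.*-assoc N N N) ⟨
    N ℕ.* (N ℕ.* N ℕ.* N)
        ≤⟨ ℕ.*-monoʳ-≤ N (ℕ.*-mono-≤ (ℕ.*-mono-≤ (m≤2^m N) (m≤2^m N)) (m≤2^m N)) ⟩
    N ℕ.* (2 ℕ.^ N ℕ.* 2 ℕ.^ N ℕ.* 2 ℕ.^ N)
        ≡⟨ cong (N ℕ.*_) (trans (cong (ℕ._* 2 ℕ.^ N) (sym (ℕ.^-distribˡ-+-* 2 N N)))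
        (sym (ℕ.^-distribˡ-+-* 2 (N ℕ.+ N) N))) ⟩
    N ℕ.* 2 ℕ.^ (N ℕ.+ N ℕ.+ N)
        ≤⟨ ℕ.*-monoʳ-≤ N (ℕ.^-monoʳ-≤ 2 (ℕ.m≤n⇒m≤1+n (3N≤exponent N))) ⟩
    next N                                           ∎
    where open ℕ.≤-Reasoning

  -- The χ² contribution is at most 4N′²/n times the coefficient N and has to be at most 1/N. One
  -- application of `next` beyond N′ makes n large enough for that.
  4N²N′²≤next² : ∀ N → 4 ℕ.* (N ℕ.* N) ℕ.* (next N ℕ.* next N) ℕ.≤ next (next N)
  4N²N′²≤next² N = begin
    4 ℕ.* (N ℕ.* N) ℕ.* (N′ ℕ.* N′)            ≡⟨ cong (ℕ._* (N′ ℕ.* N′)) (eq N) ⟩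
    (2 ℕ.* N) ℕ.* (2 ℕ.* N) ℕ.* (N′ ℕ.* N′)    ≤⟨ ℕ.*-monoˡ-≤ (N′ ℕ.* N′) (ℕ.*-mono-≤ (2N≤next N)
        (2N≤next N)) ⟩
    (N′ ℕ.* N′) ℕ.* (N′ ℕ.* N′)                ≤⟨ N⁴≤next N′ ⟩
    next N′                                    ∎
    where
    open ℕ.≤-Reasoning
    N′ = next N
    eq : ∀ N → 4 ℕ.* (N ℕ.* N) ≡ (2 ℕ.* N) ℕ.* (2 ℕ.* N)
    eq = ℕ-Solver.solve-∀

fraction≤ : ∀ a b c (0<b : 0 ℕ.< b) (0<c : 0 ℕ.< c) → a ℕ.* b ℕ.≤ c →
            ι a * inv (ι c) (0<ι 0<c) ≤ inv (ι b) (0<ι 0<b)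
fraction≤ a b c 0<b 0<c ab≤c = begin
  ι a * c⁻¹                    ≡⟨ *-identityʳ _ ⟨
  ι a * c⁻¹ * 1ℚ               ≡⟨ *-congˡ (*-inv (ι b) (0<ι 0<b)) ⟨
  ι a * c⁻¹ * (ι b * b⁻¹)      ≡⟨ solve 4 (λ a c b d → a :* c :* (b :* d) := a :* b :* (c :* d))
      refl (ι a) c⁻¹ (ι b) b⁻¹ ⟩
  ι a * ι b * (c⁻¹ * b⁻¹)      ≡⟨ *-congʳ (ι-* a b) ⟨
  ι (a ℕ.* b) * (c⁻¹ * b⁻¹)    ≤⟨ *-monoʳ _ (0≤* (0≤inv _ _) (0≤inv _ _)) (ι-mono ab≤c) ⟩
  ι c * (c⁻¹ * b⁻¹)            ≡⟨ *-assoc (ι c) c⁻¹ b⁻¹ ⟨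
  ι c * c⁻¹ * b⁻¹              ≡⟨ trans (*-congʳ (*-inv (ι c) (0<ι 0<c))) (*-identityˡ b⁻¹) ⟩
  b⁻¹                          ∎
  where
  open ≤-Reasoning
  b⁻¹ = inv (ι b) (0<ι 0<b)
  c⁻¹ = inv (ι c) (0<ι 0<c)

fraction≤1 : ∀ a c (0<c : 0 ℕ.< c) → a ℕ.≤ c → ι a * inv (ι c) (0<ι 0<c) ≤ 1ℚ
fraction≤1 a c 0<c a≤c = ≤-trans (*-monoʳ _ (0≤inv _ _) (ι-mono a≤c))
    (≤-reflexive (*-inv (ι c) (0<ι 0<c)))

2≡ι : 2ℚ ≡ ι 2
2≡ι = solve 0 (con 2ℚ := con 1ℚ :+ (con 1ℚ :+ con 0ℚ)) refl

3≡ι : 3ℚ ≡ ι 3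
3≡ι = solve 0 (con 3ℚ := con 1ℚ :+ (con 1ℚ :+ (con 1ℚ :+ con 0ℚ))) refl

4≡ι : 4ℚ ≡ ι 4
4≡ι = solve 0 (con 4ℚ := con 1ℚ :+ (con 1ℚ :+ (con 1ℚ :+ (con 1ℚ :+ con 0ℚ)))) refl

6ℚ 8ℚ 18ℚ : ℚ
6ℚ  = 3ℚ ℚ.+ 3ℚ
8ℚ  = 4ℚ ℚ.+ 4ℚ
18ℚ = 2ℚ ℚ.* (8ℚ ℚ.+ 1ℚ)

module Parameters (C N n : ℕ) (6≤N : 6 ℕ.≤ N) (large : Growth.next C (Growth.next C N) ℕ.≤ n) where
  open Growth C

  N′ k : ℕ
  N′ = next N
  k = exponent N

  0<N : 0 ℕ.< N
  0<N = ℕ.≤-trans (ℕ.s≤s ℕ.z≤n) 6≤N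

  N′≤n : N′ ℕ.≤ n
  N′≤n = ℕ.≤-trans (N≤next N′) large

  2N≤N′ : 2 ℕ.* N ℕ.≤ N′
  2N≤N′ = 2N≤next N

  0<N′ : 0 ℕ.< N′
  0<N′ = ℕ.≤-trans 0<N (N≤next N)

  0<n : 0 ℕ.< n
  0<n = ℕ.≤-trans 0<N′ N′≤n

  N≤n : N ℕ.≤ n
  N≤n = ℕ.≤-trans (N≤next N) N′≤n

  4N²N′²≤n : 4 ℕ.* (N ℕ.* N) ℕ.* (N′ ℕ.* N′) ℕ.≤ n
  4N²N′²≤n = ℕ.≤-trans (4N²N′²≤next² N) large

  instance
    N²≢0 : ℕ.NonZero (N ℕ.* N)
    N²≢0 = ℕ.>-nonZero (ℕ.*-mono-≤ 0<N 0<N)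

  -- Each heavy coordinate costs a factor 1 + 3θ with θ = N/n, so n/N² of them cost O(1/N) in total.
  B : ℕ
  B = n ℕ./ (N ℕ.* N)

  BN²≤n : B ℕ.* (N ℕ.* N) ℕ.≤ n
  BN²≤n = ℕ.m/n*n≤m n (N ℕ.* N)

  4N′²≤n : 4 ℕ.* (N′ ℕ.* N′) ℕ.≤ n
  4N′²≤n = ℕ.≤-trans (ℕ.*-monoˡ-≤ (N′ ℕ.* N′) (ℕ.m≤m*n 4 (N ℕ.* N))) 4N²N′²≤n

  N²≤n : N ℕ.* N ℕ.≤ n
  N²≤n = ℕ.≤-trans (ℕ.*-mono-≤ (N≤next N) (N≤next N)) (ℕ.≤-trans (ℕ.m≤n*m (N′ ℕ.* N′) 4) 4N′²≤n)

  0<B : 0 ℕ.< B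
  0<B = ℕ.m≥n⇒m/n>0 N²≤n

  n≤2BN² : n ℕ.≤ 2 ℕ.* (N ℕ.* N) ℕ.* B
  n≤2BN² = begin
    n                                               ≡⟨ ℕ.m≡m%n+[m/n]*n n (N ℕ.* N) ⟩
    n ℕ.% (N ℕ.* N) ℕ.+ B ℕ.* (N ℕ.* N)             ≤⟨ ℕ.+-monoˡ-≤ _ (ℕ.<⇒≤ (ℕ.m%n<n n (N ℕ.* N))) ⟩
    N ℕ.* N ℕ.+ B ℕ.* (N ℕ.* N)                     ≤⟨ ℕ.+-monoˡ-≤ _ (ℕ.m≤n*m (N ℕ.* N) B
        ⦃ ℕ.>-nonZero 0<B ⦄) ⟩
    B ℕ.* (N ℕ.* N) ℕ.+ B ℕ.* (N ℕ.* N)             ≡⟨ eq B (N ℕ.* N) ⟩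
    2 ℕ.* (N ℕ.* N) ℕ.* B                           ∎
    where
    open ℕ.≤-Reasoning
    eq : ∀ b q → b ℕ.* q ℕ.+ b ℕ.* q ≡ 2 ℕ.* q ℕ.* b
    eq = ℕ-Solver.solve-∀

  m : ℕ
  m = suc (suc (C ℕ.* n))

  -- The budget behind `κ₂≤`: 2^m is the number of codes, one 2^n comes from `E-K^heavy`, one bounds
  -- (1 + 3θ)^n, and the last one exceeds N and so leaves 1/N. As m is at most (C + 2)n, this is
  -- where the C + 5 in `exponent` comes from; its factor 2 makes up for rounding in `B`.
  m+3n≤kB : m ℕ.+ n ℕ.+ n ℕ.+ n ℕ.≤ k ℕ.* B
  m+3n≤kB = begin
    2 ℕ.+ C ℕ.* n ℕ.+ n ℕ.+ n ℕ.+ n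
        ≤⟨ ℕ.+-monoˡ-≤ n (ℕ.+-monoˡ-≤ n (ℕ.+-monoˡ-≤ n (ℕ.+-monoˡ-≤ (C ℕ.* n) (ℕ.*-monoʳ-≤ 2 0<n))))
        ⟩
    2 ℕ.* n ℕ.+ C ℕ.* n ℕ.+ n ℕ.+ n ℕ.+ n               ≡⟨ eq C n ⟩
    n ℕ.* (C ℕ.+ 5)                                     ≤⟨ ℕ.*-monoˡ-≤ (C ℕ.+ 5) n≤2BN² ⟩
    2 ℕ.* (N ℕ.* N) ℕ.* B ℕ.* (C ℕ.+ 5)                 ≡⟨ eq′ (2 ℕ.* (N ℕ.* N)) B (C ℕ.+ 5) ⟩
    k ℕ.* B                                             ∎
    where
    open ℕ.≤-Reasoning
    eq : ∀ C n → 2 ℕ.* n ℕ.+ C ℕ.* n ℕ.+ n ℕ.+ n ℕ.+ n ≡ n ℕ.* (C ℕ.+ 5)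
    eq = ℕ-Solver.solve-∀
    eq′ : ∀ a b c → a ℕ.* b ℕ.* c ≡ a ℕ.* c ℕ.* b
    eq′ = ℕ-Solver.solve-∀

  ν iN iN′ θ θ′ K α η s ρ : ℚ
  ν   = inv (ι n) (0<ι 0<n)
  iN  = inv (ι N) (0<ι 0<N)
  iN′ = inv (ι N′) (0<ι 0<N′)
  θ   = ι N * ν
  θ′  = ι N′ * ν
  K   = ι (2 ℕ.^ k)
  α   = inv (ι (2 ℕ.^ suc k)) (0<ι (ℕ.m^n>0 2 (suc k)))
  -- Chosen with `s` such that 4ηs = 1: then η is itself O(1/N), and the χ² distance, which `s`
  -- magnifies, is small enough to afford a factor N.
  η   = (ℤ.+ 1 ℚ./ 4) * iN
  s   = ι N
  ρ   = inv (ι (2 ℕ.^ (k ℕ.* B))) (0<ι (ℕ.m^n>0 2 (k ℕ.* B)))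

  0≤ν : 0ℚ ≤ ν
  0≤ν = 0≤inv _ _

  0≤iN : 0ℚ ≤ iN
  0≤iN = 0≤inv _ _

  0≤θ : 0ℚ ≤ θ
  0≤θ = 0≤* (0≤ι N) 0≤ν

  0≤θ′ : 0ℚ ≤ θ′
  0≤θ′ = 0≤* (0≤ι N′) 0≤ν

  0≤α : 0ℚ ≤ α
  0≤α = 0≤inv _ _

  0≤η : 0ℚ ≤ η
  0≤η = 0≤* (ℚ.nonNegative⁻¹ (ℤ.+ 1 ℚ./ 4)) 0≤iN

  0≤ρ : 0ℚ ≤ ρ
  0≤ρ = 0≤inv _ _

  1≤K : 1ℚ ≤ K
  1≤K = ≤-trans (≤-reflexive (sym (+-identityʳ 1ℚ))) (ι-mono (ℕ.m^n>0 2 k))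

  3θ≤1 : 3ℚ * θ ≤ 1ℚ
  3θ≤1 = begin
    3ℚ * (ι N * ν)       ≡⟨ *-assoc 3ℚ (ι N) ν ⟨
    3ℚ * ι N * ν         ≡⟨ *-congʳ (trans (*-congʳ 3≡ι) (sym (ι-* 3 N))) ⟩
    ι (3 ℕ.* N) * ν      ≤⟨ fraction≤1 (3 ℕ.* N) n 0<n
        (ℕ.≤-trans (ℕ.*-monoˡ-≤ N (ℕ.≤-trans (ℕ.s≤s (ℕ.s≤s (ℕ.s≤s ℕ.z≤n))) 6≤N)) N²≤n) ⟩
    1ℚ                   ∎
    where open ≤-Reasoning

  K+1≤2K : K + 1ℚ ≤ ι (2 ℕ.^ suc k)
  K+1≤2K = ≤-trans (≤-reflexive (+-comm K 1ℚ)) (ι-mono (begin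
    1 ℕ.+ 2 ℕ.^ k              ≤⟨ ℕ.+-monoˡ-≤ (2 ℕ.^ k) (ℕ.m^n>0 2 k) ⟩
    2 ℕ.^ k ℕ.+ 2 ℕ.^ k        ≡⟨ cong (2 ℕ.^ k ℕ.+_) (ℕ.+-identityʳ (2 ℕ.^ k)) ⟨
    2 ℕ.^ suc k                ∎))
    where open ℕ.≤-Reasoning

  αK≤1 : α * (K + 1ℚ) ≤ 1ℚ
  αK≤1 = ≤-trans (*-monoˡ α 0≤α K+1≤2K) (≤-reflexive (trans (*-comm α _) (*-inv _ _)))

  θ′≡ : θ′ ≡ θ * ι (2 ℕ.^ suc k)
  θ′≡ = trans (*-congʳ (ι-* N (2 ℕ.^ suc k))) (solve 3 (λ a b c → a :* b :* c := a :* c :* b) refl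
      (ι N) (ι (2 ℕ.^ suc k)) ν)

  θ′α≡θ : θ′ * α ≡ θ
  θ′α≡θ = trans (*-congʳ θ′≡) (trans (*-assoc θ _ α) (trans (*-congˡ (*-inv _ _)) (*-identityʳ θ)))

  θK≤θ′ : θ * (K + 1ℚ) ≤ θ′
  θK≤θ′ = ≤-trans (*-monoˡ θ 0≤θ K+1≤2K) (≤-reflexive (sym θ′≡))

  θK≤1 : θ * (K + 1ℚ) ≤ 1ℚ
  θK≤1 = ≤-trans θK≤θ′ (fraction≤1 N′ n 0<n N′≤n)

  0<s : 0ℚ < s
  0<s = 0<ι 0<N

  1≤4ηs : 1ℚ ≤ 4ℚ * (η * s)
  1≤4ηs = ≤-reflexive (sym (trans (solve 2 (λ i N → con 4ℚ :* (con (ℤ.+ 1 ℚ./ 4) :* i :* N) := N :*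
      i) refl iN (ι N)) (*-inv (ι N) (0<ι 0<N))))

  K^B≡ : K ^ B ≡ ι (2 ℕ.^ (k ℕ.* B))
  K^B≡ = trans (sym (ι-^ (2 ℕ.^ k) B)) (cong ι (ℕ.^-*-assoc 2 k B))

  1≤ρK^B : 1ℚ ≤ ρ * K ^ B
  1≤ρK^B = ≤-reflexive (sym (trans (*-congˡ K^B≡) (trans (*-comm ρ _) (*-inv _ _))))

  heavy-small : 2ℚ * (ι B * (3ℚ * θ)) ≤ 6ℚ * iN
  heavy-small = begin
    2ℚ * (ι B * (3ℚ * (ι N * ν)))   ≡⟨ solve 3 (λ b N ν → con 2ℚ :* (b :* (con 3ℚ :* (N :* ν))) :=
        con 6ℚ :* (b :* N :* ν)) refl (ι B) (ι N) ν ⟩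
    6ℚ * (ι B * ι N * ν)            ≡⟨ *-congˡ (*-congʳ (ι-* B N)) ⟨
    6ℚ * (ι (B ℕ.* N) * ν)          ≤⟨ *-monoˡ 6ℚ (ℚ.nonNegative⁻¹ 6ℚ) (fraction≤ (B ℕ.* N) N n 0<N
        0<n (ℕ.≤-trans (ℕ.≤-reflexive (ℕ.*-assoc B N N)) BN²≤n)) ⟩
    6ℚ * iN                         ∎
    where open ≤-Reasoning

  6/N≤1 : 6ℚ * iN ≤ 1ℚ
  6/N≤1 = begin
    6ℚ * iN      ≡⟨ *-congʳ 6≡ι ⟩
    ι 6 * iN     ≤⟨ fraction≤1 6 N 0<N 6≤N ⟩
    1ℚ           ∎
    where
    open ≤-Reasoning
    6≡ι : 6ℚ ≡ ι 6
    6≡ι = trans (solve 0 (con 6ℚ := con 3ℚ :+ con 3ℚ) refl) (trans (cong₂ _+_ 3≡ι 3≡ι)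
        (sym (ι-+ 3 3)))

  ε : ℚ
  ε = 2ℚ * ((θ * (K + 1ℚ)) * (θ * (K + 1ℚ)))

  2nε≤ : 2ℚ * (ι n * ε) ≤ ι (4 ℕ.* (N′ ℕ.* N′)) * ν
  2nε≤ = begin
    2ℚ * (ι n * (2ℚ * ((θ * (K + 1ℚ)) * (θ * (K + 1ℚ)))))
      ≤⟨ *-monoˡ 2ℚ 0≤2 (*-monoˡ (ι n) (0≤ι n)
          (*-monoˡ 2ℚ 0≤2 (*-mono (0≤* 0≤θ (0≤+ (≤-trans 0≤1 1≤K) 0≤1)) 0≤θ′ θK≤θ′ θK≤θ′))) ⟩
    2ℚ * (ι n * (2ℚ * (ι N′ * ν * (ι N′ * ν))))
      ≡⟨ solve 3 (λ n N ν → con 2ℚ :* (n :* (con 2ℚ :* (N :* ν :* (N :* ν)))) := con 4ℚ :* (N :* N)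
          :* ν :* (n :* ν)) refl (ι n) (ι N′) ν ⟩
    4ℚ * (ι N′ * ι N′) * ν * (ι n * ν)
      ≡⟨ trans (*-congˡ (*-inv (ι n) (0<ι 0<n))) (*-identityʳ _) ⟩
    4ℚ * (ι N′ * ι N′) * ν
      ≡⟨ *-congʳ (trans (cong₂ _*_ 4≡ι (sym (ι-* N′ N′))) (sym (ι-* 4 (N′ ℕ.* N′)))) ⟩
    ι (4 ℕ.* (N′ ℕ.* N′)) * ν ∎
    where open ≤-Reasoning

  s2nε≤ : s * (2ℚ * (ι n * ε)) ≤ iN
  s2nε≤ = begin
    ι N * (2ℚ * (ι n * ε))                      ≤⟨ *-monoˡ (ι N) (0≤ι N) 2nε≤ ⟩
    ι N * (ι (4 ℕ.* (N′ ℕ.* N′)) * ν)           ≡⟨ *-assoc (ι N) _ ν ⟨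
    ι N * ι (4 ℕ.* (N′ ℕ.* N′)) * ν             ≡⟨ *-congʳ (ι-* N (4 ℕ.* (N′ ℕ.* N′))) ⟨
    ι (N ℕ.* (4 ℕ.* (N′ ℕ.* N′))) * ν           ≤⟨ fraction≤ (N ℕ.* (4 ℕ.* (N′ ℕ.* N′))) N n 0<N 0<n
        (ℕ.≤-trans (ℕ.≤-reflexive (eq N (N′ ℕ.* N′))) 4N²N′²≤n) ⟩
    iN                                          ∎
    where
    open ≤-Reasoning
    eq : ∀ N q → N ℕ.* (4 ℕ.* q) ℕ.* N ≡ 4 ℕ.* (N ℕ.* N) ℕ.* q
    eq = ℕ-Solver.solve-∀

  -- The heavy coordinates cost 6/N, η costs 1/(4N) and the χ² distance 1/N. Both uses of
  -- `bernoulli` are within its range, the first because N is at least 6.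
  κ₁≤ : ((1ℚ + 3ℚ * θ) ^ B - 1ℚ) + (η + s * ((1ℚ + ε) ^ n - 1ℚ)) ≤ 8ℚ * iN
  κ₁≤ = begin
    ((1ℚ + 3ℚ * θ) ^ B - 1ℚ) + (η + s * ((1ℚ + ε) ^ n - 1ℚ))
      ≤⟨ +-mono-≤ (≤-trans (+-monoˡ (- 1ℚ) (bernoulli (3ℚ * θ) B (0≤* (ℚ.nonNegative⁻¹ 3ℚ) 0≤θ)
          (≤-trans heavy-small 6/N≤1))) (+-monoˡ (- 1ℚ) (+-monoʳ 1ℚ heavy-small)))
                  (+-monoʳ η (*-monoˡ s (0≤ι N) (+-monoˡ (- 1ℚ) (bernoulli ε n (0≤* 0≤2 (0≤a² _))
                      (≤-trans 2nε≤ (fraction≤1 _ n 0<n 4N′²≤n)))))) ⟩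
    (1ℚ + 6ℚ * iN - 1ℚ) + (η + s * (1ℚ + 2ℚ * (ι n * ε) - 1ℚ))
      ≡⟨ solve 4 (λ i η s x → (con 1ℚ :+ con 6ℚ :* i :- con 1ℚ) :+
          (η :+ s :* (con 1ℚ :+ x :- con 1ℚ)) := con 6ℚ :* i :+ (η :+ s :* x)) refl iN η s
          (2ℚ * (ι n * ε)) ⟩
    6ℚ * iN + (η + s * (2ℚ * (ι n * ε)))
      ≤⟨ +-monoʳ _ (+-monoʳ η s2nε≤) ⟩
    6ℚ * iN + ((ℤ.+ 1 ℚ./ 4) * iN + iN)
      ≤⟨ ≤-slack ((ℤ.+ 3 ℚ./ 4) * iN) (0≤* (ℚ.nonNegative⁻¹ (ℤ.+ 3 ℚ./ 4)) 0≤iN)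
           (solve 1 (λ i → con 6ℚ :* i :+ (con (ℤ.+ 1 ℚ./ 4) :* i :+ i) :+ con (ℤ.+ 3 ℚ./ 4) :* i :=
               con 8ℚ :* i) refl iN) ⟩
    8ℚ * iN ∎
    where open ≤-Reasoning

  κ₂≤ : ι 2 ^ m * ((1ℚ + 3ℚ * θ) ^ n * (ρ * 2ℚ ^ n)) ≤ iN
  κ₂≤ = begin
    ι 2 ^ m * ((1ℚ + 3ℚ * θ) ^ n * (ρ * 2ℚ ^ n))
      ≤⟨ *-monoˡ (ι 2 ^ m) (0≤^ m (0≤ι 2)) (*-monoʳ _ (0≤* 0≤ρ (0≤^ n 0≤2))
          (^-monoˡ n (0≤+ 0≤1 (0≤* (ℚ.nonNegative⁻¹ 3ℚ) 0≤θ)) 1+3θ≤2)) ⟩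
    ι 2 ^ m * (2ℚ ^ n * (ρ * 2ℚ ^ n))
      ≡⟨ cong (λ x → ι 2 ^ m * (x ^ n * (ρ * x ^ n))) 2≡ι ⟩
    ι 2 ^ m * (ι 2 ^ n * (ρ * ι 2 ^ n))
      ≡⟨ solve 3 (λ a b r → a :* (b :* (r :* b)) := a :* b :* b :* r) refl (ι 2 ^ m) (ι 2 ^ n) ρ ⟩
    ι 2 ^ m * ι 2 ^ n * ι 2 ^ n * ρ
      ≡⟨ *-congʳ (trans (*-congʳ (sym (^-+ (ι 2) m n))) (trans (sym (^-+ (ι 2) (m ℕ.+ n) n))
          (sym (ι-^ 2 (m ℕ.+ n ℕ.+ n))))) ⟩
    ι (2 ℕ.^ (m ℕ.+ n ℕ.+ n)) * ρ
      ≤⟨ fraction≤ (2 ℕ.^ (m ℕ.+ n ℕ.+ n)) N (2 ℕ.^ (k ℕ.* B)) 0<N (ℕ.m^n>0 2 (k ℕ.* B)) 2^N≤ ⟩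
    iN ∎
    where
    open ≤-Reasoning
    1+3θ≤2 : 1ℚ + 3ℚ * θ ≤ 2ℚ
    1+3θ≤2 = ≤-trans (+-monoʳ 1ℚ 3θ≤1) (≤-reflexive (solve 0 (con 1ℚ :+ con 1ℚ := con 2ℚ) refl))
    2^N≤ : 2 ℕ.^ (m ℕ.+ n ℕ.+ n) ℕ.* N ℕ.≤ 2 ℕ.^ (k ℕ.* B)
    2^N≤ = ℕ.≤-trans (ℕ.*-monoʳ-≤ (2 ℕ.^ (m ℕ.+ n ℕ.+ n)) (ℕ.≤-trans N≤n (m≤2^m n)))
          (ℕ.≤-trans (ℕ.≤-reflexive (sym (ℕ.^-distribˡ-+-* 2 (m ℕ.+ n ℕ.+ n) n)))
              (ℕ.^-monoʳ-≤ 2 m+3n≤kB))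

  -- A round costs 8/N + 1/N. Since N at least doubles from one round to the next, the costs are
  -- dominated by a geometric series with sum 18/N, independent of the number of rounds.
  κ≤ : ∀ {κ₁ κ₂} → κ₁ ≤ 8ℚ * iN → κ₂ ≤ iN → 18ℚ * iN′ + κ₁ + κ₂ ≤ 18ℚ * iN
  κ≤ {κ₁} {κ₂} κ₁≤ κ₂≤ = begin
    18ℚ * iN′ + κ₁ + κ₂
      ≤⟨ +-mono-≤ (+-monoʳ (18ℚ * iN′) κ₁≤) κ₂≤ ⟩
    18ℚ * iN′ + 8ℚ * iN + iN
      ≡⟨ solve 2 (λ i′ i → con 18ℚ :* i′ :+ con 8ℚ :* i :+ i := con (8ℚ ℚ.+ 1ℚ) :* (con 2ℚ :* i′) :+
          con (8ℚ ℚ.+ 1ℚ) :* i) refl iN′ iN ⟩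
    (8ℚ ℚ.+ 1ℚ) * (2ℚ * iN′) + (8ℚ ℚ.+ 1ℚ) * iN
      ≤⟨ +-monoˡ _ (*-monoˡ (8ℚ ℚ.+ 1ℚ) (ℚ.nonNegative⁻¹ (8ℚ ℚ.+ 1ℚ))
          (≤-trans (≤-reflexive (*-congʳ 2≡ι)) (fraction≤ 2 N N′ 0<N 0<N′ 2N≤N′))) ⟩
    (8ℚ ℚ.+ 1ℚ) * iN + (8ℚ ℚ.+ 1ℚ) * iN
      ≡⟨ solve 1 (λ i → con (8ℚ ℚ.+ 1ℚ) :* i :+ con (8ℚ ℚ.+ 1ℚ) :* i := con 18ℚ :* i) refl iN ⟩
    18ℚ * iN ∎
    where open ≤-Reasoning

-- From one elimination to all rounds

module Descent (C n t : ℕ) (0<t : 0 ℕ.< t) where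
  open Growth C
  open Elimination t 0<t n
  open Noise t 0<t
  open Rounds t 0<t n (C ℕ.* n) (move (C ℕ.* n)) (move-surjective (C ℕ.* n))

  -- Each round uses one application of `next`; the additional one in `grow (suc r)` ensures that
  -- `next (next N)` is at most `n` whenever a message is eliminated, as `Parameters` requires.
  bounded : ∀ r {N} (6≤N : 6 ℕ.≤ N) .(0<N : 0 ℕ.< N) .(0<n : 0 ℕ.< n) → grow (suc r) N ℕ.≤ n →
            Bounded r (ι N * inv (ι n) (0<ι 0<n)) (18ℚ * inv (ι N) (0<ι 0<N))
  bounded zero    {N} 6≤N 0<N 0<n _ =
    bounded-0 {ι N * inv (ι n) (0<ι 0<n)} (0≤* (ℚ.nonNegative⁻¹ 18ℚ) (0≤inv (ι N) (0<ι 0<N)))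
  bounded (suc r) {N} 6≤N 0<N 0<n large =
    bounded-suc 1≤K θ′α≡θ 0≤α αK≤1 0≤θ 3θ≤1 θK≤1 0≤η 0<s 1≤4ηs B 0≤ρ 1≤ρK^B
      (0≤* (ℚ.nonNegative⁻¹ 18ℚ) 0≤iN) (κ≤ κ₁≤ κ₂≤)
      (bounded r (ℕ.≤-trans 6≤N (N≤next N)) 0<N′ 0<n large)
    where open Parameters C N n 6≤N (ℕ.≤-trans (N≤grow r (next (next N))) large) hiding (0<n; 0<N)

  private
    mean² : (Input → Input → ℚ) → ℚ
    mean² f = 𝔼 (λ x → 𝔼 (f x))

  -- The induction starts from players who run the protocol on their own inputs, that is, with point
  -- masses as kernels.
  value-Δ : ∀ θ h → value θ Δ Δ h ≡ mean² (λ x y → noise θ x y * h x y)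
  value-Δ θ h = Eₙ.cong-≗ (λ v → Eₙ.cong-≗ (λ u → *-congˡ (trans
    (Eₙ.cong-≗ (λ x → trans (Eₙ.scale (Δ v x) (λ y → Δ u y * h x y)) (*-congˡ (E-Δ u (h x)))))
    (E-Δ v (λ x → h x u)))))

  rejection : ∀ first {r} → StartedBy first Input Input (C ℕ.* n) r → Input → Input → ℚ
  rejection first π x y = if output first π x y then 0ℚ else 1ℚ

  rejection-stable : ∀ r {N} → 6 ℕ.≤ N → .(0<N : 0 ℕ.< N) .(0<n : 0 ℕ.< n) → grow (suc r) N ℕ.≤ n →
    ∀ first (π : StartedBy first Input Input (C ℕ.* n) r) →
    mean² (rejection first π) ≤
    mean² (λ x y → noise (ι N * inv (ι n) (0<ι 0<n)) x y * rejection first π x y) + 18ℚ * inv (ι N)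
        (0<ι 0<N)
  rejection-stable r {N} 6≤N 0<N 0<n large first π = stable first π
    where
    θ = ι N * inv (ι n) (0<ι 0<n)
    κ = 18ℚ * inv (ι N) (0<ι 0<N)
    one-way : ∀ (π : Protocol Input Input (C ℕ.* n) r) →
              mean² (rejects π) ≤ mean² (λ x y → noise θ x y * rejects π x y) + κ
    one-way π = begin
      mean² (rejects π)
        ≡⟨ Eₙ.cong-≗ (λ x → Eₙ.cong-≗ (λ y → sym (trans (*-congʳ (noise-0 x y)) (*-identityˡ _)))) ⟩
      mean² (λ x y → noise 0ℚ x y * rejects π x y)
        ≡⟨ value-Δ 0ℚ (rejects π) ⟨
      value 0ℚ Δ Δ (rejects π)
        ≤⟨ bounded r 6≤N 0<N 0<n large π 0≤Δ 0≤Δ E-Δ-unit E-Δ-unit ⟩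
      value θ Δ Δ (rejects π) + κ * (1ℚ * 1ℚ)
        ≡⟨ cong₂ _+_ (value-Δ θ (rejects π)) (solve 1 (λ κ → κ :* (con 1ℚ :* con 1ℚ) := κ) refl κ) ⟩
      mean² (λ x y → noise θ x y * rejects π x y) + κ ∎
      where
      open ≤-Reasoning
      E-Δ-unit : ∀ v → 𝔼 (Δ v) ≡ 1ℚ
      E-Δ-unit v = trans (Eₙ.cong-≗ (λ u → sym (*-identityʳ (Δ v u)))) (E-Δ v (λ _ → 1ℚ))
    stable : ∀ first (π : StartedBy first Input Input (C ℕ.* n) r) →
             mean² (rejection first π) ≤ mean² (λ x y → noise θ x y * rejection first π x y) + κ
    stable alice π = one-way π
    -- Exchanging the inputs reduces this to the other case, because noise is symmetric.
    stable bob   π = begin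
      mean² (λ x y → rejects π y x)
        ≡⟨ swap (λ x y → rejects π y x) ⟩
      mean² (rejects π)
        ≤⟨ one-way π ⟩
      mean² (λ y x → noise θ y x * rejects π y x) + κ
        ≡⟨ cong (_+ κ) (trans (swap (λ y x → noise θ y x * rejects π y x))
            (Eₙ.cong-≗ (λ x → Eₙ.cong-≗ (λ y → *-congʳ (noise-sym θ y x))))) ⟩
      mean² (λ x y → noise θ x y * rejects π y x) + κ ∎
      where open ≤-Reasoning

-- Agreements between noisy and between independent inputs

module Collisions (t : ℕ) (0<t : 0 ℕ.< t) where
  open Noise t 0<t

  equal unequal : Fin t → Fin t → ℚ
  equal   v u = if does (v Fin.≟ u) then 1ℚ else 0ℚ
  unequal v u = if does (v Fin.≟ u) then 0ℚ else 1ℚ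

  collisions : ∀ {n} → Vec (Fin t) n → Vec (Fin t) n → ℚ
  collisions []       []       = 0ℚ
  collisions (v ∷ vs) (u ∷ us) = equal v u + collisions vs us

  apart : ∀ {n} → Vec (Fin t) n → Vec (Fin t) n → ℚ
  apart []       []       = 1ℚ
  apart (v ∷ vs) (u ∷ us) = unequal v u * apart vs us

  0≤equal : ∀ v u → 0ℚ ≤ equal v u
  0≤equal v u with does (v Fin.≟ u)
  ... | true  = 0≤1
  ... | false = ≤-refl

  0≤unequal : ∀ v u → 0ℚ ≤ unequal v u
  0≤unequal v u with does (v Fin.≟ u)
  ... | true  = ≤-refl
  ... | false = 0≤1

  unequal≤1 : ∀ v u → unequal v u ≤ 1ℚ
  unequal≤1 v u with does (v Fin.≟ u)
  ... | true  = 0≤1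
  ... | false = ≤-refl

  unequal-refl : ∀ v → unequal v v ≡ 0ℚ
  unequal-refl v with v Fin.≟ v
  ... | yes _  = refl
  ... | no v≢v = contradiction refl v≢v

  0≤collisions : ∀ {n} (v u : Vec (Fin t) n) → 0ℚ ≤ collisions v u
  0≤collisions []       []       = ≤-refl
  0≤collisions (v ∷ vs) (u ∷ us) = 0≤+ (0≤equal v u) (0≤collisions vs us)

  0≤apart : ∀ {n} (v u : Vec (Fin t) n) → 0ℚ ≤ apart v u
  0≤apart []       []       = 0≤1
  0≤apart (v ∷ vs) (u ∷ us) = 0≤* (0≤unequal v u) (0≤apart vs us)

  1≤collisions : ∀ {n} (v u : Vec (Fin t) n) i → lookup v i ≡ lookup u i → 1ℚ ≤ collisions v u
  1≤collisions (v ∷ vs) (u ∷ us) (suc i) eq =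
    ≤-trans (1≤collisions vs us i eq) (≤-slack (equal v u) (0≤equal v u) (+-comm (collisions vs us)
        (equal v u)))
  1≤collisions (v ∷ vs) (u ∷ us) zero    eq with v Fin.≟ u
  ... | yes _  = ≤-slack (collisions vs us) (0≤collisions vs us) refl
  ... | no v≢u = contradiction eq v≢u

  1≤apart : ∀ {n} (v u : Vec (Fin t) n) → (∀ i → ¬ lookup v i ≡ lookup u i) → 1ℚ ≤ apart v u
  1≤apart []       []       _    = ≤-refl
  1≤apart (v ∷ vs) (u ∷ us) none with v Fin.≟ u
  ... | yes v≡u = contradiction v≡u (none zero)
  ... | no  _   = ≤-trans (1≤apart vs us (λ i → none (suc i))) (≤-reflexive (sym (*-identityˡ _)))

  E-collisions : ∀ {n} (v : Vec (Fin t) n) → E n (collisions v) ≡ ι n * inv (ι t) (0<ι 0<t)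
  E-collisions         []       = sym (zeroˡ (inv (ι t) (0<ι 0<t)))
  E-collisions {suc n} (v ∷ vs) = begin
    avg (λ u → E n (λ us → equal v u + collisions vs us))
      ≡⟨ avg.cong-≗ (λ u → trans (IsMean.add (E-isMean n) (λ _ → equal v u) (collisions vs))
          (cong₂ _+_ (IsMean.const (E-isMean n) (equal v u)) (E-collisions vs))) ⟩
    avg (λ u → equal v u + ι n * t⁻¹)
      ≡⟨ trans (avg.add (equal v) _) (cong₂ _+_ avg-equal (avg.const (ι n * t⁻¹))) ⟩
    t⁻¹ + ι n * t⁻¹
      ≡⟨ solve 2 (λ n i → i :+ n :* i := (con 1ℚ :+ n) :* i) refl (ι n) t⁻¹ ⟩
    (1ℚ + ι n) * t⁻¹ ∎
    where
    open ≡-Reasoning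
    t⁻¹ = inv (ι t) (0<ι 0<t)
    equal-δ : ∀ u → equal v u ≡ t⁻¹ * δ v u
    equal-δ u with does (v Fin.≟ u)
    ... | true  = sym (trans (*-comm t⁻¹ (ι t)) (*-inv (ι t) (0<ι 0<t)))
    ... | false = sym (zeroʳ t⁻¹)
    avg-equal : avg (equal v) ≡ t⁻¹
    avg-equal = trans (avg.cong-≗ equal-δ) (trans (avg.scale t⁻¹ (δ v))
        (trans (*-congˡ (avg-δ-unit v)) (*-identityʳ t⁻¹)))

  -- A copied coordinate agrees, so being apart requires that none of the n coordinates be copied.
  E-noise*apart : ∀ {θ} → θ ≤ 1ℚ → ∀ {n} (v : Vec (Fin t) n) → E n (λ u → noise θ v u * apart v u) ≤
      (1ℚ - θ) ^ n
  E-noise*apart     θ≤1         []       = ≤-reflexive (*-identityʳ 1ℚ)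
  E-noise*apart {θ} θ≤1 {suc n} (v ∷ vs) = begin
    avg (λ u → E n (λ us → ((1ℚ + θ * (δ v u - 1ℚ)) * noise θ vs us) * (unequal v u * apart vs us)))
      ≡⟨ E-split (λ u → 1ℚ + θ * (δ v u - 1ℚ)) (unequal v) (noise θ vs) (apart vs) ⟩
    avg (λ u → (1ℚ + θ * (δ v u - 1ℚ)) * unequal v u) * E n (λ us → noise θ vs us * apart vs us)
      ≡⟨ *-congʳ (trans (avg-noise₁ θ v (unequal v))
          (trans (cong (λ x → (1ℚ - θ) * avg (unequal v) + θ * x) (unequal-refl v))
                                                       (solve 2 (λ x θ → x :+ θ :* con 0ℚ := x) refl
                                                           ((1ℚ - θ) * avg (unequal v)) θ))) ⟩
    (1ℚ - θ) * avg (unequal v) * E n (λ us → noise θ vs us * apart vs us)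
      ≤⟨ *-monoˡ _ (0≤* (slack θ≤1) (avg.nonneg (0≤unequal v))) (E-noise*apart θ≤1 vs) ⟩
    (1ℚ - θ) * avg (unequal v) * (1ℚ - θ) ^ n
      ≤⟨ *-monoʳ _ (0≤^ n (slack θ≤1)) (≤-trans (*-monoˡ (1ℚ - θ) (slack θ≤1)
          (avg.bounded (unequal≤1 v))) (≤-reflexive (*-identityʳ (1ℚ - θ)))) ⟩
    (1ℚ - θ) * (1ℚ - θ) ^ n ∎
    where open ≤-Reasoning

-- A rational substitute for the bound of (1 - x)^n by exp(-nx). It suffices that (1 - x)(1 + (n +
-- 1)x) is at most 1 + nx.
[1-x]ⁿ[1+nx]≤1 : ∀ {x} n → 0ℚ ≤ x → x ≤ 1ℚ → (1ℚ - x) ^ n * (1ℚ + ι n * x) ≤ 1ℚ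
[1-x]ⁿ[1+nx]≤1 {x} zero    0≤x x≤1 = ≤-reflexive (solve 1 (λ x → con 1ℚ :* (con 1ℚ :+ con 0ℚ :* x)
    := con 1ℚ) refl x)
[1-x]ⁿ[1+nx]≤1 {x} (suc n) 0≤x x≤1 = begin
  (1ℚ - x) * p * (1ℚ + (1ℚ + ι n) * x)
    ≤⟨ ≤-slack (p * ((1ℚ + ι n) * (x * x))) (0≤* (0≤^ n (slack x≤1)) (0≤* (0≤ι (suc n)) (0≤a² x)))
         (solve 3 (λ x p n → (con 1ℚ :- x) :* p :* (con 1ℚ :+ (con 1ℚ :+ n) :* x) :+ p :*
             ((con 1ℚ :+ n) :* (x :* x)) := p :* (con 1ℚ :+ n :* x)) refl x p (ι n)) ⟩
  p * (1ℚ + ι n * x)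
    ≤⟨ [1-x]ⁿ[1+nx]≤1 n 0≤x x≤1 ⟩
  1ℚ ∎
  where
  open ≤-Reasoning
  p = (1ℚ - x) ^ n

-- Error of a deterministic protocol on the hard distribution

indicator : Bool → ℚ
indicator b = if b then 1ℚ else 0ℚ

0≤indicator : ∀ b → 0ℚ ≤ indicator b
0≤indicator true  = 0≤1
0≤indicator false = ≤-refl

module HardDistribution (C n N : ℕ) (0<n : 0 ℕ.< n) (2⁸≤N : 2 ℕ.^ 8 ℕ.≤ N)
                        (r : ℕ) (large : Growth.grow C (suc r) N ℕ.≤ n) where

  0<4n : 0 ℕ.< 4 ℕ.* n
  0<4n = ℕ.≤-trans 0<n (ℕ.m≤m+n n _)

  6≤N : 6 ℕ.≤ N
  6≤N = ℕ.≤-trans (ℕ.≤ᵇ⇒≤ 6 (2 ℕ.^ 8) _) 2⁸≤N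

  0<N : 0 ℕ.< N
  0<N = ℕ.≤-trans (ℕ.s≤s ℕ.z≤n) 6≤N

  N≤n : N ℕ.≤ n
  N≤n = ℕ.≤-trans (Growth.N≤grow C (suc r) N) large

  open Descent C n (4 ℕ.* n) 0<4n
  open Elimination (4 ℕ.* n) 0<4n n
  open Noise (4 ℕ.* n) 0<4n
  open Collisions (4 ℕ.* n) 0<4n

  mean² : (Input → Input → ℚ) → ℚ
  mean² f = 𝔼 (λ x → 𝔼 (f x))

  mean²-isMean : IsMean (λ (f : Input × Input → ℚ) → mean² (λ x y → f (x , y)))
  mean²-isMean = record
    { cong-≗ = λ f≗g → Eₙ.cong-≗ (λ x → Eₙ.cong-≗ (λ y → f≗g (x , y)))
    ; add    = λ f g → trans (Eₙ.cong-≗ (λ x → Eₙ.add _ _)) (Eₙ.add _ _)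
    ; scale  = λ c f → trans (Eₙ.cong-≗ (λ x → Eₙ.scale c _)) (Eₙ.scale c _)
    ; mono   = λ f≤g → Eₙ.mono (λ x → Eₙ.mono (λ y → f≤g (x , y)))
    ; unit   = trans (Eₙ.cong-≗ (λ x → Eₙ.unit)) Eₙ.unit
    }
  module E² = IsMean mean²-isMean

  θ iN : ℚ
  θ  = ι N * inv (ι n) (0<ι 0<n)
  iN = inv (ι N) (0<ι 0<N)

  0≤θ : 0ℚ ≤ θ
  0≤θ = 0≤* (0≤ι N) (0≤inv _ _)

  θ≤1 : θ ≤ 1ℚ
  θ≤1 = fraction≤1 N n 0<n N≤n

  nθ≡N : ι n * θ ≡ ι N
  nθ≡N = trans (solve 3 (λ n N i → n :* (N :* i) := N :* (n :* i)) refl (ι n) (ι N)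
      (inv (ι n) (0<ι 0<n)))
               (trans (*-congˡ (*-inv (ι n) (0<ι 0<n))) (*-identityʳ (ι N)))

  EE-correct : ∀ x y → 1ℚ ≤ (if EE n x y then collisions x y else apart x y)
  EE-correct x y with Fin.any? (λ i → lookup x i Fin.≟ lookup y i)
  ... | yes (i , eq) = 1≤collisions x y i eq
  ... | no  none     = 1≤apart x y (λ i eq → none (i , eq))

  -- The union bound over coordinates; the alphabet size 4n enters here.
  mean-collisions : mean² collisions ≤ ℤ.+ 1 ℚ./ 4
  mean-collisions = begin
    𝔼 (λ x → 𝔼 (collisions x))                       ≡⟨ trans (Eₙ.cong-≗ E-collisions) (Eₙ.const _)
        ⟩
    ι n * inv (ι (4 ℕ.* n)) (0<ι 0<4n)               ≤⟨ fraction≤ n 4 (4 ℕ.* n) (ℕ.s≤s ℕ.z≤n) 0<4n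
        (ℕ.≤-reflexive (ℕ.*-comm n 4)) ⟩
    inv (ι 4) (0<ι {4} (ℕ.s≤s ℕ.z≤n))                ≡⟨ *-identityˡ _ ⟨
    1ℚ * inv (ι 4) (0<ι {4} (ℕ.s≤s ℕ.z≤n))           ≡⟨ *-congʳ quarter ⟨
    (ℤ.+ 1 ℚ./ 4) * ι 4 * inv (ι 4) (0<ι {4} (ℕ.s≤s ℕ.z≤n))
      ≡⟨ trans (*-assoc _ (ι 4) _) (trans (*-congˡ (*-inv (ι 4) (0<ι {4} (ℕ.s≤s ℕ.z≤n))))
          (*-identityʳ _)) ⟩
    ℤ.+ 1 ℚ./ 4 ∎
    where
    open ≤-Reasoning
    quarter : (ℤ.+ 1 ℚ./ 4) * ι 4 ≡ 1ℚ
    quarter = trans (*-congˡ (sym 4≡ι)) (solve 0 (con (ℤ.+ 1 ℚ./ 4) :* con 4ℚ := con 1ℚ) refl)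

  mean-noise*apart : mean² (λ x y → noise θ x y * apart x y) ≤ iN
  mean-noise*apart = ≤-trans (Eₙ.bounded (E-noise*apart θ≤1)) (*-cancelˡ (ι N) (0<ι 0<N) (begin
    ι N * (1ℚ - θ) ^ n                          ≤⟨ ≤-slack ((1ℚ - θ) ^ n) (0≤^ n (slack θ≤1))
        (solve 2 (λ N p → N :* p :+ p := p :* (con 1ℚ :+ N)) refl (ι N) ((1ℚ - θ) ^ n)) ⟩
    (1ℚ - θ) ^ n * (1ℚ + ι N)                   ≡⟨ cong (λ x → (1ℚ - θ) ^ n * (1ℚ + x)) nθ≡N ⟨
    (1ℚ - θ) ^ n * (1ℚ + ι n * θ)               ≤⟨ [1-x]ⁿ[1+nx]≤1 n 0≤θ θ≤1 ⟩
    1ℚ                                          ≡⟨ *-inv (ι N) (0<ι 0<N) ⟨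
    ι N * iN                                    ∎))
    where open ≤-Reasoning

  256iN≤1 : (ℤ.+ 256 ℚ./ 1) * iN ≤ 1ℚ
  256iN≤1 = begin
    (ℤ.+ 256 ℚ./ 1) * iN      ≡⟨ solve 1 (λ i → con (ℤ.+ 256 ℚ./ 1) :* i := con 2ℚ :*
        (con 2ℚ :* (con 2ℚ :* (con 2ℚ :* (con 2ℚ :* (con 2ℚ :* (con 2ℚ :* (con 2ℚ :* con 1ℚ)))))))
        :* i) refl iN ⟩
    2ℚ ^ 8 * iN               ≡⟨ *-congʳ (trans (cong (_^ 8) 2≡ι) (sym (ι-^ 2 8))) ⟩
    ι (2 ℕ.^ 8) * iN          ≤⟨ fraction≤1 (2 ℕ.^ 8) N 0<N 2⁸≤N ⟩
    1ℚ                        ∎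
    where open ≤-Reasoning

  module _ (first : Player) (π : StartedBy first (EEInput n) (EEInput n) (C ℕ.* n) r) where

    wrong : EEInput n → EEInput n → Bool
    wrong x y = EE n x y xor output first π x y

    err rej : Input → Input → ℚ
    err x y = indicator (wrong x y)
    rej = rejection first π

    rej≤ : ∀ x y → rej x y ≤ err x y + apart x y
    rej≤ x y = cases (EE n x y) (output first π x y) (EE-correct x y)
      where
      cases : ∀ e o → 1ℚ ≤ (if e then collisions x y else apart x y) →
              (if o then 0ℚ else 1ℚ) ≤ indicator (e xor o) + apart x y
      cases e     true  _ = 0≤+ (0≤indicator (e xor true)) (0≤apart x y)
      cases true  false _ = ≤-slack (apart x y) (0≤apart x y) refl
      cases false false p = ≤-trans p (≤-reflexive (sym (+-identityˡ (apart x y))))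

    1≤rej : ∀ x y → 1ℚ ≤ rej x y + err x y + collisions x y
    1≤rej x y = cases (EE n x y) (output first π x y) (EE-correct x y)
      where
      cases : ∀ e o → 1ℚ ≤ (if e then collisions x y else apart x y) →
              1ℚ ≤ (if o then 0ℚ else 1ℚ) + indicator (e xor o) + collisions x y
      cases e     false _ = ≤-slack (indicator (e xor false) + collisions x y)
          (0≤+ (0≤indicator (e xor false)) (0≤collisions x y))
          (sym (+-assoc 1ℚ (indicator (e xor false)) (collisions x y)))
      cases true  true  p = ≤-trans p (≤-reflexive (solve 1 (λ c → c := con 0ℚ :+ con 0ℚ :+ c) refl
          (collisions x y)))
      cases false true  _ = ≤-slack (collisions x y) (0≤collisions x y) (cong (_+ collisions x y)
          (sym (+-identityˡ 1ℚ)))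

    -- Error under noisy copies plus error under independent pairs. The total weight is 2, so an
    -- error probability of 1/3 would allow at most 2/3.
    err-mass : ℚ
    err-mass = mean² (λ x y → (noise θ x y + 1ℚ) * err x y)

    1≤err-mass : 1ℚ ≤ err-mass + (ℤ.+ 19 ℚ./ 1) * iN + (ℤ.+ 1 ℚ./ 4)
    1≤err-mass = begin
      1ℚ
        ≡⟨ E².unit ⟨
      mean² (λ x y → 1ℚ)
        ≤⟨ E².mono (λ (x , y) → 1≤rej x y) ⟩
      mean² (λ x y → rej x y + err x y + collisions x y)
        ≡⟨ trans (E².add (λ (x , y) → rej x y + err x y) (λ (x , y) → collisions x y))
            (cong (_+ mean² collisions) (E².add (λ (x , y) → rej x y) (λ (x , y) → err x y))) ⟩
      mean² rej + mean² err + mean² collisions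
        ≤⟨ +-mono-≤ (+-monoˡ (mean² err) (rejection-stable r 6≤N 0<N 0<n large first π))
            mean-collisions ⟩
      mean² (λ x y → noise θ x y * rej x y) + 18ℚ * iN + mean² err + (ℤ.+ 1 ℚ./ 4)
        ≤⟨ +-monoˡ _ (+-monoˡ (mean² err) (+-monoˡ (18ℚ * iN) noise*rej≤)) ⟩
      mean² (λ x y → noise θ x y * err x y) + iN + 18ℚ * iN + mean² err + (ℤ.+ 1 ℚ./ 4)
        ≡⟨ solve 3 (λ a i b → a :+ i :+ con 18ℚ :* i :+ b :+ con (ℤ.+ 1 ℚ./ 4) := (a :+ b) :+ con
            (ℤ.+ 19 ℚ./ 1) :* i :+ con (ℤ.+ 1 ℚ./ 4)) refl
             (mean² (λ x y → noise θ x y * err x y)) iN (mean² err) ⟩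
      (mean² (λ x y → noise θ x y * err x y) + mean² err) + (ℤ.+ 19 ℚ./ 1) * iN + (ℤ.+ 1 ℚ./ 4)
        ≡⟨ cong (λ z → z + (ℤ.+ 19 ℚ./ 1) * iN + (ℤ.+ 1 ℚ./ 4))
            (trans (sym (E².add (λ (x , y) → noise θ x y * err x y) (λ (x , y) → err x y)))
             (E².cong-≗ (λ (x , y) → solve 2 (λ p e → p :* e :+ e := (p :+ con 1ℚ) :* e) refl
                 (noise θ x y) (err x y)))) ⟩
      err-mass + (ℤ.+ 19 ℚ./ 1) * iN + (ℤ.+ 1 ℚ./ 4) ∎
      where
      open ≤-Reasoning
      noise*rej≤ : mean² (λ x y → noise θ x y * rej x y) ≤ mean² (λ x y → noise θ x y * err x y) +
          iN
      noise*rej≤ = begin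
        mean² (λ x y → noise θ x y * rej x y)
          ≤⟨ E².mono (λ (x , y) → *-monoˡ (noise θ x y) (0≤noise 0≤θ θ≤1 x y) (rej≤ x y)) ⟩
        mean² (λ x y → noise θ x y * (err x y + apart x y))
          ≡⟨ trans (E².cong-≗ (λ (x , y) → distribˡ (noise θ x y) (err x y) (apart x y)))
              (E².add (λ (x , y) → noise θ x y * err x y) (λ (x , y) → noise θ x y * apart x y)) ⟩
        mean² (λ x y → noise θ x y * err x y) + mean² (λ x y → noise θ x y * apart x y)
          ≤⟨ +-monoʳ _ mean-noise*apart ⟩
        mean² (λ x y → noise θ x y * err x y) + iN ∎

    2<3err-mass : 2ℚ < 3ℚ * err-mass
    2<3err-mass = ℚ.<-≤-trans 2<c (begin
      c
        ≤⟨ ≤-slack _ (0≤+ (0≤* (ℚ.nonNegative⁻¹ 3ℚ) (slack 1≤err-mass))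
            (0≤* (ℚ.nonNegative⁻¹ (ℤ.+ 57 ℚ./ 256)) (slack 256iN≤1)))
             (solve 2 (λ S i → con c :+ (con 3ℚ :* (S :+ con (ℤ.+ 19 ℚ./ 1) :* i :+ con
                 (ℤ.+ 1 ℚ./ 4) :- con 1ℚ) :+ con (ℤ.+ 57 ℚ./ 256) :* (con 1ℚ :- con (ℤ.+ 256 ℚ./ 1)
                 :* i))
                := con 3ℚ :* S) refl err-mass iN) ⟩
      3ℚ * err-mass ∎)
      where
      open ≤-Reasoning
      c : ℚ
      -- This is 3(1 - 1/4 - 19/256), where 19 is 18 from `rejection-stable` plus 1 from noisy
      -- copies that are apart. It exceeds 2 as soon as 19/N is below 1/12, and 256 is the first
      -- power of 2 for which that holds.
      c = ℤ.+ 519 ℚ./ 256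
      2<c : 2ℚ < c
      2<c = toWitness {a? = 2ℚ ℚ.<? c} _

-- The hard distribution as integer weights

sumℕ : {A : Set} → (A → ℕ) → List A → ℕ
sumℕ f []       = 0
sumℕ f (a ∷ as) = f a ℕ.+ sumℕ f as

sumℚ : {A : Set} → (A → ℚ) → List A → ℚ
sumℚ f []       = 0ℚ
sumℚ f (a ∷ as) = f a + sumℚ f as

module _ {A : Set} where

  sumℚ-++ : ∀ (f : A → ℚ) as bs → sumℚ f (as ++ bs) ≡ sumℚ f as + sumℚ f bs
  sumℚ-++ f []       bs = sym (+-identityˡ _)
  sumℚ-++ f (a ∷ as) bs = trans (+-congˡ (sumℚ-++ f as bs)) (sym (+-assoc (f a) _ _))

  sumℚ-map : ∀ {B : Set} (f : A → ℚ) (g : B → A) bs → sumℚ f (List.map g bs) ≡ sumℚ (λ b → f (g b))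
      bs
  sumℚ-map f g []       = refl
  sumℚ-map f g (b ∷ bs) = +-congˡ (sumℚ-map f g bs)

  sumℚ-cong : ∀ {f g : A → ℚ} → f ≗ g → ∀ as → sumℚ f as ≡ sumℚ g as
  sumℚ-cong f≗g []       = refl
  sumℚ-cong f≗g (a ∷ as) = cong₂ _+_ (f≗g a) (sumℚ-cong f≗g as)

  ι-sum : ∀ (f : A → ℕ) as → ι (sumℕ f as) ≡ sumℚ (λ a → ι (f a)) as
  ι-sum f []       = refl
  ι-sum f (a ∷ as) = trans (ι-+ (f a) _) (+-congˡ (ι-sum f as))

module _ {A : Set} where

  pairs : List A → List A → List (A × A)
  pairs []       bs = []
  pairs (a ∷ as) bs = List.map (a ,_) bs ++ pairs as bs

  sumℚ-pairs : ∀ (f : A × A → ℚ) as bs → sumℚ f (pairs as bs) ≡ sumℚ (λ a → sumℚ (λ b → f (a , b))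
      bs) as
  sumℚ-pairs f []       bs = refl
  sumℚ-pairs f (a ∷ as) bs = trans (sumℚ-++ f (List.map (a ,_) bs) _)
      (cong₂ _+_ (sumℚ-map f (a ,_) bs) (sumℚ-pairs f as bs))

module Enumeration (t : ℕ) (0<t : 0 ℕ.< t) where
  open Noise t 0<t

  points : ∀ n → List (Vec (Fin t) n)
  points zero    = [] ∷ []
  points (suc n) = List.concat (List.tabulate (λ v → List.map (v ∷_) (points n)))

  private
    sumℚ-tabulate : ∀ {A : Set} m (h : Fin m → List A) f → sumℚ f (List.concat (List.tabulate h)) ≡
        ∑ m (λ v → sumℚ f (h v))
    sumℚ-tabulate zero    h f = refl
    sumℚ-tabulate (suc m) h f = trans (sumℚ-++ f (h zero) _)
        (+-congˡ (sumℚ-tabulate m (λ v → h (suc v)) f))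

    ∑≡t*avg : ∀ f → ∑ t f ≡ ι t * avg f
    ∑≡t*avg f = sym (trans (sym (*-assoc (ι t) _ (∑ t f))) (trans (*-congʳ (*-inv (ι t) (0<ι 0<t)))
        (*-identityˡ (∑ t f))))

  sumℚ-points : ∀ n f → sumℚ f (points n) ≡ ι t ^ n * E n f
  sumℚ-points zero    f = trans (+-identityʳ (f [])) (sym (*-identityˡ (f [])))
  sumℚ-points (suc n) f = begin
    sumℚ f (points (suc n))
      ≡⟨ sumℚ-tabulate t (λ v → List.map (v ∷_) (points n)) f ⟩
    ∑ t (λ v → sumℚ f (List.map (v ∷_) (points n)))
      ≡⟨ ∑-cong t (λ v → trans (sumℚ-map f (v ∷_) (points n)) (sumℚ-points n (λ vs → f (v ∷ vs)))) ⟩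
    ∑ t (λ v → ι t ^ n * E n (λ vs → f (v ∷ vs)))
      ≡⟨ trans (∑-scale t (ι t ^ n) _) (*-congˡ (∑≡t*avg _)) ⟩
    ι t ^ n * (ι t * avg (λ v → E n (λ vs → f (v ∷ vs))))
      ≡⟨ solve 3 (λ p t e → p :* (t :* e) := t :* p :* e) refl (ι t ^ n) (ι t) (E (suc n) f) ⟩
    ι t * ι t ^ n * E (suc n) f ∎
    where open ≡-Reasoning

module Weights (C n N : ℕ) (0<n : 0 ℕ.< n) (2⁸≤N : 2 ℕ.^ 8 ℕ.≤ N)
               (r : ℕ) (large : Growth.grow C (suc r) N ℕ.≤ n) where
  open HardDistribution C n N 0<n 2⁸≤N r large
  open Noise (4 ℕ.* n) 0<4n
  open Elimination (4 ℕ.* n) 0<4n n using (module Eₙ)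
  open Enumeration (4 ℕ.* n) 0<4n

  t : ℕ
  t = 4 ℕ.* n

  weight₁ : Fin t → Fin t → ℕ
  weight₁ v u = (n ℕ.∸ N) ℕ.+ (if does (v Fin.≟ u) then N ℕ.* t else 0)

  -- n ^ n times the noise density, which is integral.
  noise-weight : ∀ {m} → Vec (Fin t) m → Vec (Fin t) m → ℕ
  noise-weight []       []       = 1
  noise-weight (v ∷ vs) (u ∷ us) = weight₁ v u ℕ.* noise-weight vs us

  ι-weight₁ : ∀ v u → ι (weight₁ v u) ≡ ι n * (1ℚ + θ * (δ v u - 1ℚ))
  ι-weight₁ v u = begin
    ι ((n ℕ.∸ N) ℕ.+ (if does (v Fin.≟ u) then N ℕ.* t else 0))
      ≡⟨ trans (ι-+ (n ℕ.∸ N) _) (cong₂ _+_ (ι-∸ N≤n) (cases (does (v Fin.≟ u)))) ⟩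
    ι n - ι N + ι N * δ v u
      ≡⟨ cong (λ x → ι n - x + x * δ v u) nθ≡N ⟨
    ι n - ι n * θ + ι n * θ * δ v u
      ≡⟨ solve 3 (λ n θ d → n :- n :* θ :+ n :* θ :* d := n :* (con 1ℚ :+ θ :* (d :- con 1ℚ))) refl
          (ι n) θ (δ v u) ⟩
    ι n * (1ℚ + θ * (δ v u - 1ℚ)) ∎
    where
    open ≡-Reasoning
    cases : ∀ b → ι (if b then N ℕ.* t else 0) ≡ ι N * (if b then ι t else 0ℚ)
    cases true  = ι-* N t
    cases false = sym (zeroʳ (ι N))

  ι-noise-weight : ∀ {m} (v u : Vec (Fin t) m) → ι (noise-weight v u) ≡ ι n ^ m * noise θ v u
  ι-noise-weight         []       []       = trans (+-identityʳ 1ℚ) (sym (*-identityˡ 1ℚ))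
  ι-noise-weight {suc m} (v ∷ vs) (u ∷ us) = trans (ι-* (weight₁ v u) _)
    (trans (cong₂ _*_ (ι-weight₁ v u) (ι-noise-weight vs us)) (*-exchange (ι n) _ (ι n ^ m)
        (noise θ vs us)))

  -- The ring of probabilities need not contain the rationals, so the mixture of noisy and
  -- independent pairs is multiplied by n^n to become integral.
  weight : EEInput n × EEInput n → ℕ
  weight (x , y) = noise-weight x y ℕ.+ n ℕ.^ n

  inputs : List (EEInput n × EEInput n)
  inputs = pairs (points n) (points n)

  private
    scale : ℚ
    scale = ι (t ℕ.^ n) * ι (t ℕ.^ n) * ι (n ℕ.^ n)

    0<scale : 0ℚ < scale
    0<scale = subst (0ℚ <_) (trans (ι-* (t ℕ.^ n ℕ.* t ℕ.^ n) (n ℕ.^ n))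
        (*-congʳ (ι-* (t ℕ.^ n) (t ℕ.^ n))))
      (0<ι {t ℕ.^ n ℕ.* t ℕ.^ n ℕ.* n ℕ.^ n} (ℕ.*-mono-≤ (ℕ.*-mono-≤ (^>0 0<4n) (^>0 0<4n))
          (^>0 0<n)))
      where
      ^>0 : ∀ {a} → 0 ℕ.< a → 0 ℕ.< a ℕ.^ n
      ^>0 {a} 0<a = ℕ.m^n>0 a ⦃ ℕ.>-nonZero 0<a ⦄ n

    ι-weight : ∀ p → ι (weight p) ≡ ι (n ℕ.^ n) * (noise θ (proj₁ p) (proj₂ p) + 1ℚ)
    ι-weight (x , y) = trans (ι-+ (noise-weight x y) (n ℕ.^ n)) (trans
      (cong (_+ ι (n ℕ.^ n)) (trans (ι-noise-weight x y) (*-congʳ (sym (ι-^ n n)))))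
      (solve 2 (λ a p → a :* p :+ a := a :* (p :+ con 1ℚ)) refl (ι (n ℕ.^ n)) (noise θ x y)))

    weighted : ∀ (f : EEInput n → EEInput n → ℕ) →
      ι (sumℕ (λ p → weight p ℕ.* f (proj₁ p) (proj₂ p)) inputs) ≡
      scale * mean² (λ x y → (noise θ x y + 1ℚ) * ι (f x y))
    weighted f = begin
      ι (sumℕ (λ p → weight p ℕ.* f (proj₁ p) (proj₂ p)) inputs)
        ≡⟨ trans (ι-sum _ inputs) (sumℚ-cong (λ p → trans (ι-* (weight p) _)
            (trans (*-congʳ (ι-weight p)) (*-assoc (ι (n ℕ.^ n)) _ _))) inputs) ⟩
      sumℚ (λ p → ι (n ℕ.^ n) * g (proj₁ p) (proj₂ p)) inputs
        ≡⟨ sumℚ-pairs (λ p → ι (n ℕ.^ n) * g (proj₁ p) (proj₂ p)) (points n) (points n) ⟩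
      sumℚ (λ x → sumℚ (λ y → ι (n ℕ.^ n) * g x y) (points n)) (points n)
        ≡⟨ trans (sumℚ-cong (λ x → sumℚ-points n _) (points n)) (sumℚ-points n _) ⟩
      ι t ^ n * E n (λ x → ι t ^ n * E n (λ y → ι (n ℕ.^ n) * g x y))
        ≡⟨ *-congˡ (trans (Eₙ.scale (ι t ^ n) _)
            (*-congˡ (trans (Eₙ.cong-≗ (λ x → Eₙ.scale (ι (n ℕ.^ n)) (g x))) (Eₙ.scale (ι (n ℕ.^ n))
            _)))) ⟩
      ι t ^ n * (ι t ^ n * (ι (n ℕ.^ n) * mean² g))
        ≡⟨ solve 3 (λ a b m → a :* (a :* (b :* m)) := a :* a :* b :* m) refl (ι t ^ n) (ι (n ℕ.^ n))
            (mean² g) ⟩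
      ι t ^ n * ι t ^ n * ι (n ℕ.^ n) * mean² g
        ≡⟨ cong (λ z → z * z * ι (n ℕ.^ n) * mean² g) (ι-^ t n) ⟨
      scale * mean² g ∎
      where
      open ≡-Reasoning
      g : EEInput n → EEInput n → ℚ
      g x y = (noise θ x y + 1ℚ) * ι (f x y)

  hard : ∀ first (π : StartedBy first (EEInput n) (EEInput n) (C ℕ.* n) r) →
         sumℕ weight inputs ℕ.< 3 ℕ.* sumℕ (λ p → weight p ℕ.* (if wrong first π (proj₁ p) (proj₂ p)
             then 1 else 0)) inputs
  hard first π = ι-cancel-< (begin-strict
    ι (sumℕ weight inputs)
      ≡⟨ cong ι (sum-cong inputs) ⟩
    ι (sumℕ (λ p → weight p ℕ.* 1) inputs)
      ≡⟨ trans (weighted (λ _ _ → 1)) (*-congˡ total) ⟩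
    scale * 2ℚ
      <⟨ *-monoˡ-< scale 0<scale (2<3err-mass first π) ⟩
    scale * (3ℚ * err-mass first π)
      ≡⟨ solve 2 (λ s e → s :* (con 3ℚ :* e) := con 3ℚ :* (s :* e)) refl scale (err-mass first π) ⟩
    3ℚ * (scale * err-mass first π)
      ≡⟨ *-congˡ (*-congˡ (E².cong-≗ (λ (x , y) → *-congˡ (cases (wrong first π x y))))) ⟩
    3ℚ * (scale * mean² (λ x y → (noise θ x y + 1ℚ) * ι (if wrong first π x y then 1 else 0)))
      ≡⟨ cong₂ _*_ 3≡ι (sym (weighted (λ x y → if wrong first π x y then 1 else 0))) ⟩
    ι 3 * ι errors
      ≡⟨ ι-* 3 errors ⟨
    ι (3 ℕ.* errors) ∎)
    where
    open ≤-Reasoning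
    errors = sumℕ (λ p → weight p ℕ.* (if wrong first π (proj₁ p) (proj₂ p) then 1 else 0)) inputs
    cases : ∀ b → indicator b ≡ ι (if b then 1 else 0)
    cases true  = sym (+-identityʳ 1ℚ)
    cases false = refl
    sum-cong : ∀ ps → sumℕ weight ps ≡ sumℕ (λ p → weight p ℕ.* 1) ps
    sum-cong []       = refl
    sum-cong (p ∷ ps) = cong₂ ℕ._+_ (sym (ℕ.*-identityʳ (weight p))) (sum-cong ps)
    total : mean² (λ x y → (noise θ x y + 1ℚ) * ι 1) ≡ 2ℚ
    total = trans (E².cong-≗ (λ (x , y) → trans (*-congˡ (+-identityʳ 1ℚ))
        (*-identityʳ (noise θ x y + 1ℚ))))
      (trans (E².add (λ (x , y) → noise θ x y) (λ _ → 1ℚ))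
          (trans (cong₂ _+_ (trans (Eₙ.cong-≗ (E-noise θ)) Eₙ.unit) E².unit)
          (solve 0 (con 1ℚ :+ con 1ℚ := con 2ℚ) refl)))

-- Averaging over the random source

module Expectation {c ℓ₁ ℓ₂ a e : Level} {K : OrderedCommutativeRing c ℓ₁ ℓ₂} (S : ProbabilitySpace
    K a e) where
  open OrderedCommutativeRing K
  open ProbabilitySpace S
  private
    module R = CommutativeRing commutativeRing
    module O = IsPartialOrder isPartialOrder
  open Mult R.+-commutativeMonoid using (×-congʳ; ×-homo-+; ×-assocˡ; ×-distrib-+) renaming (_×_ to _×ᴷ_)
  open SetoidReasoning R.setoid

  ≤-≈ : ∀ {x y z} → x ≤ᴷ y → y ≈ z → x ≤ᴷ z
  ≤-≈ x≤y y≈z = O.trans x≤y (O.reflexive y≈z)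

  ≈-≤ : ∀ {x y z} → x ≈ y → y ≤ᴷ z → x ≤ᴷ z
  ≈-≤ x≈y y≤z = O.trans (O.reflexive x≈y) y≤z

  +ᴷ-mono : ∀ {w x y z} → w ≤ᴷ x → y ≤ᴷ z → (w +ᴷ y) ≤ᴷ (x +ᴷ z)
  +ᴷ-mono {w} {x} {y} {z} w≤x y≤z =
    O.trans (+-monoˡ-≤ y w≤x) (≈-≤ (R.+-comm x y) (≤-≈ (+-monoˡ-≤ x y≤z) (R.+-comm z x)))

  ×-monoʳ : ∀ m {x y} → x ≤ᴷ y → (m ×ᴷ x) ≤ᴷ (m ×ᴷ y)
  ×-monoʳ zero    x≤y = O.refl
  ×-monoʳ (suc m) x≤y = +ᴷ-mono x≤y (×-monoʳ m x≤y)

  ×-zero : ∀ m → (m ×ᴷ 0#) ≈ 0#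
  ×-zero zero    = R.refl
  ×-zero (suc m) = R.trans (R.+-identityˡ _) (×-zero m)

  ×-nonneg : ∀ m {x} → 0# ≤ᴷ x → 0# ≤ᴷ (m ×ᴷ x)
  ×-nonneg m 0≤x = ≈-≤ (R.sym (×-zero m)) (×-monoʳ m 0≤x)

  ×-monoˡ : ∀ {m n x} → 0# ≤ᴷ x → m ℕ.≤ n → (m ×ᴷ x) ≤ᴷ (n ×ᴷ x)
  ×-monoˡ {n = n} 0≤x ℕ.z≤n       = ×-nonneg n 0≤x
  ×-monoˡ {x = x} 0≤x (ℕ.s≤s m≤n) = +ᴷ-mono (O.refl {x}) (×-monoˡ 0≤x m≤n)

  intersection : ∀ {A B} → IsEvent A → IsEvent B → IsEvent (λ ω → A ω ∧ B ω)
  intersection {A} {B} p q = IsEvent-resp (λ ω → deMorgan (A ω) (B ω))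
      (complement (union (complement p) (complement q)))
    where
    deMorgan : ∀ x y → not (not x ∨ not y) ≡ x ∧ y
    deMorgan true  true  = refl
    deMorgan true  false = refl
    deMorgan false _     = refl

  Pr-split : ∀ {A B} (p : IsEvent A) (q : IsEvent B) →
             Pr p ≈ (Pr (intersection p q) +ᴷ Pr (intersection p (complement q)))
  Pr-split {A} {B} p q = R.trans
    (Pr-cong (λ ω → cover (A ω) (B ω)) p (union (intersection p q) (intersection p (complement q))))
    (Pr-additive (intersection p q) (intersection p (complement q)) (λ ω → disjoint (A ω) (B ω)))
    where
    cover : ∀ x y → x ≡ (x ∧ y) ∨ (x ∧ not y)
    cover true  true  = refl
    cover true  false = refl
    cover false _     = refl
    disjoint : ∀ x y → (x ∧ y) ∧ (x ∧ not y) ≡ false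
    disjoint true  true  = refl
    disjoint true  false = refl
    disjoint false _     = refl

  Pr-empty : ∀ {A} (p : IsEvent A) → (∀ ω → A ω ≡ false) → Pr p ≈ 0#
  Pr-empty p none = R.trans (Pr-cong none p (complement full)) (GroupProperties.identityʳ-unique
      R.+-group (Pr full) _
    (R.trans (R.sym (Pr-additive full (complement full) (λ _ → refl))) (Pr-cong (λ _ → refl) _ _)))

  module _ {I : Set} where

    sumᴷ : (I → Carrier) → List I → Carrier
    sumᴷ f []       = 0#
    sumᴷ f (i ∷ is) = f i +ᴷ sumᴷ f is

    sumᴷ-add : ∀ {f g h} → (∀ i → (f i +ᴷ g i) ≈ h i) → ∀ is → (sumᴷ f is +ᴷ sumᴷ g is) ≈ sumᴷ h is
    sumᴷ-add eq []       = R.+-identityˡ 0#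
    sumᴷ-add {f} {g} {h} eq (i ∷ is) = begin
      (f i +ᴷ sumᴷ f is) +ᴷ (g i +ᴷ sumᴷ g is)   ≈⟨ R.+-assoc _ _ _ ⟩
      f i +ᴷ (sumᴷ f is +ᴷ (g i +ᴷ sumᴷ g is))   ≈⟨ R.+-congˡ (R.trans (R.sym (R.+-assoc _ _ _))
          (R.trans (R.+-congʳ (R.+-comm _ _)) (R.+-assoc _ _ _))) ⟩
      f i +ᴷ (g i +ᴷ (sumᴷ f is +ᴷ sumᴷ g is))   ≈⟨ R.+-assoc _ _ _ ⟨
      (f i +ᴷ g i) +ᴷ (sumᴷ f is +ᴷ sumᴷ g is)   ≈⟨ R.+-cong (eq i) (sumᴷ-add eq is) ⟩
      h i +ᴷ sumᴷ h is                           ∎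

    sumᴷ-mono : ∀ {f g} → (∀ i → f i ≤ᴷ g i) → ∀ is → sumᴷ f is ≤ᴷ sumᴷ g is
    sumᴷ-mono f≤g []       = O.refl
    sumᴷ-mono f≤g (i ∷ is) = +ᴷ-mono (f≤g i) (sumᴷ-mono f≤g is)

    sumᴷ-unit : ∀ (w : I → ℕ) is → sumᴷ (λ i → w i ×ᴷ 1#) is ≈ (sumℕ w is ×ᴷ 1#)
    sumᴷ-unit w []       = R.refl
    sumᴷ-unit w (i ∷ is) = R.trans (R.+-congˡ (sumᴷ-unit w is))
        (R.sym (×-homo-+ 1# (w i) (sumℕ w is)))

  module _ {I : Set} {A : I → Ω → Bool} (A-event : ∀ i → IsEvent (A i)) (w : I → ℕ) where

    occurring : Ω → List I → ℕ
    occurring ω = sumℕ (λ i → w i ℕ.* (if A i ω then 1 else 0))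

    -- By induction on the list, conditioning on whether its first event occurs.
    expectation-on : ∀ is {B} (p : IsEvent B) m → (∀ ω → B ω ≡ true → m ℕ.≤ occurring ω is) →
                     (m ×ᴷ Pr p) ≤ᴷ sumᴷ (λ i → w i ×ᴷ Pr (intersection p (A-event i))) is
    expectation-on []       p zero    _ = O.refl
    expectation-on []       {B} p (suc m) absurd =
      O.reflexive (R.trans (×-congʳ (suc m) (Pr-empty p (λ ω → never (B ω) (absurd ω))))
          (×-zero (suc m)))
      where
      never : ∀ b → (b ≡ true → suc m ℕ.≤ 0) → b ≡ false
      never true  impossible with () ← impossible refl
      never false _ = refl
    expectation-on (i ∷ is) {B} p m m≤ = O.trans below (≤-≈ (+ᴷ-mono (O.refl {w i ×ᴷ Pr yes-p})
        (+ᴷ-mono (expectation-on is yes-p (m ℕ.∸ w i) yes-m) (expectation-on is no-p m no-m)))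
        (R.+-congˡ (sumᴷ-add (λ j → R.trans (R.sym (×-distrib-+ _ _ (w j)))
            (×-congʳ (w j) (R.sym (refine j)))) is)))
      where
      q     = A-event i
      yes-p = intersection p q
      no-p  = intersection p (complement q)
      yes-m : ∀ ω → B ω ∧ A i ω ≡ true → m ℕ.∸ w i ℕ.≤ occurring ω is
      yes-m ω = cases (B ω) (A i ω) (m≤ ω)
        where
        cases : ∀ x y → (x ≡ true → m ℕ.≤ w i ℕ.* (if y then 1 else 0) ℕ.+ occurring ω is) →
                x ∧ y ≡ true → m ℕ.∸ w i ℕ.≤ occurring ω is
        cases true true m≤ _ = ℕ.m≤n+o⇒m∸n≤o m (w i) (ℕ.≤-trans (m≤ refl)
            (ℕ.≤-reflexive (cong (ℕ._+ occurring ω is) (ℕ.*-identityʳ (w i)))))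
      no-m : ∀ ω → B ω ∧ not (A i ω) ≡ true → m ℕ.≤ occurring ω is
      no-m ω = cases (B ω) (A i ω) (m≤ ω)
        where
        cases : ∀ x y → (x ≡ true → m ℕ.≤ w i ℕ.* (if y then 1 else 0) ℕ.+ occurring ω is) →
                x ∧ not y ≡ true → m ℕ.≤ occurring ω is
        cases true false m≤ _ = ℕ.≤-trans (m≤ refl) (ℕ.≤-reflexive (cong (ℕ._+ occurring ω is)
            (ℕ.*-zeroʳ (w i))))
      -- Truncated subtraction is harmless: `m` is at most `w i` plus the difference even if `w i`
      -- is the larger one.
      below : (m ×ᴷ Pr p) ≤ᴷ ((w i ×ᴷ Pr yes-p) +ᴷ (((m ℕ.∸ w i) ×ᴷ Pr yes-p) +ᴷ (m ×ᴷ Pr no-p)))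
      below = ≈-≤ (R.trans (×-congʳ m (Pr-split p q)) (×-distrib-+ _ _ m))
        (≤-≈ (+-monoˡ-≤ (m ×ᴷ Pr no-p) (≤-≈ (×-monoˡ {n = w i ℕ.+ (m ℕ.∸ w i)} (Pr-nonneg yes-p)
            (ℕ.m≤n+m∸n m (w i))) (×-homo-+ (Pr yes-p) (w i) (m ℕ.∸ w i))))
             (R.+-assoc _ _ _))
      refine : ∀ j → Pr (intersection p (A-event j)) ≈ (Pr (intersection yes-p (A-event j)) +ᴷ Pr
          (intersection no-p (A-event j)))
      refine j = R.trans (Pr-split (intersection p (A-event j)) q)
        (R.+-cong (Pr-cong (λ ω → exchange (B ω) (A j ω) (A i ω)) _ _)
            (Pr-cong (λ ω → exchange (B ω) (A j ω) (not (A i ω))) _ _))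
        where
        exchange : ∀ x y z → (x ∧ y) ∧ z ≡ (x ∧ z) ∧ y
        exchange false _ _ = refl
        exchange true  y z = Bool.∧-comm y z

    expectation : ∀ is m → (∀ ω → m ℕ.≤ occurring ω is) →
                  (m ×ᴷ 1#) ≤ᴷ sumᴷ (λ i → w i ×ᴷ Pr (A-event i)) is
    expectation is m m≤ = ≈-≤ (×-congʳ m (R.sym Pr-full))
        (O.trans (expectation-on is full m (λ ω _ → m≤ ω))
      (sumᴷ-mono (λ i → O.reflexive (×-congʳ (w i) (Pr-cong (λ _ → refl) _ _))) is))

  module _ {I : Set} {A : I → Ω → Bool} (A-event : ∀ i → IsEvent (A i)) (w : I → ℕ) where

    -- With integer weights of sum W the strict inequality is a gap of at least 1. Averaging over ω
    -- turns it into W + 1 below the weighted sum of the tripled probabilities, which is at most W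
    -- if all events are unlikely. Adding -W leaves 1 below 0, with no need for a total order.
    likely-event : ∀ is → (∀ ω → sumℕ w is ℕ.< 3 ℕ.* occurring A-event w ω is) →
                   ¬ (∀ i → (3 ×ᴷ Pr (A-event i)) ≤ᴷ 1#)
    likely-event is often unlikely = 1≰0 (≤-≈ (≈-≤ (R.sym lhs) (+-monoˡ-≤ (R.- T) too-small))
        (R.-‿inverseʳ T))
      where
      T : Carrier
      T = sumℕ w is ×ᴷ 1#
      tripled : ∀ ω is → 3 ℕ.* occurring A-event w ω is ≡ occurring A-event (λ i → w i ℕ.* 3) ω is
      tripled ω []       = refl
      tripled ω (i ∷ is) = trans (ℕ.*-distribˡ-+ 3 (w i ℕ.* (if A i ω then 1 else 0))
          (occurring A-event w ω is)) (cong₂ ℕ._+_ (eq (w i) (if A i ω then 1 else 0))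
          (tripled ω is))
        where
        eq : ∀ a b → 3 ℕ.* (a ℕ.* b) ≡ a ℕ.* 3 ℕ.* b
        eq = ℕ-Solver.solve-∀
      too-small : (suc (sumℕ w is) ×ᴷ 1#) ≤ᴷ T
      too-small = O.trans (expectation A-event (λ i → w i ℕ.* 3) is (suc (sumℕ w is))
          (λ ω → ℕ.≤-trans (often ω) (ℕ.≤-reflexive (tripled ω is))))
        (≤-≈ (sumᴷ-mono (λ i → ≈-≤ (R.sym (×-assocˡ _ (w i) 3)) (×-monoʳ (w i) (unlikely i))) is)
            (sumᴷ-unit w is))
      lhs : ((1# +ᴷ T) +ᴷ (R.- T)) ≈ 1#
      lhs = R.trans (R.+-assoc 1# T (R.- T)) (R.trans (R.+-congˡ (R.-‿inverseʳ T))
          (R.+-identityʳ 1#))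

-- Iterated logarithms and towers

2^⌊log₂n⌋≤n : ∀ n → 0 ℕ.< n → 2 ℕ.^ ⌊log₂ n ⌋ ℕ.≤ n
2^⌊log₂n⌋≤n = <-rec (λ n → 0 ℕ.< n → 2 ℕ.^ ⌊log₂ n ⌋ ℕ.≤ n) step
  where
  step : ∀ n → (∀ {m} → m ℕ.< n → 0 ℕ.< m → 2 ℕ.^ ⌊log₂ m ⌋ ℕ.≤ m) → 0 ℕ.< n → 2 ℕ.^ ⌊log₂ n ⌋ ℕ.≤ n
  step (suc zero)      _   _ = ℕ.≤-refl
  step n@(suc (suc k)) rec _ = begin
    2 ℕ.^ ⌊log₂ n ⌋                          ≡⟨ cong (2 ℕ.^_) (ℕ.m+[n∸m]≡n 1≤log) ⟨
    2 ℕ.* 2 ℕ.^ (⌊log₂ n ⌋ ℕ.∸ 1)            ≡⟨ cong (λ l → 2 ℕ.* 2 ℕ.^ l) (⌊log₂⌊n/2⌋⌋≡⌊log₂n⌋∸1 n)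
        ⟨
    2 ℕ.* 2 ℕ.^ ⌊log₂ ℕ.⌊ n /2⌋ ⌋            ≤⟨ ℕ.*-monoʳ-≤ 2 (rec (ℕ.⌊n/2⌋<n (suc k))
        (ℕ.s≤s ℕ.z≤n)) ⟩
    2 ℕ.* ℕ.⌊ n /2⌋                          ≡⟨ cong (ℕ.⌊ n /2⌋ ℕ.+_) (ℕ.+-identityʳ ℕ.⌊ n /2⌋) ⟩
    ℕ.⌊ n /2⌋ ℕ.+ ℕ.⌊ n /2⌋                  ≤⟨ ℕ.+-monoʳ-≤ ℕ.⌊ n /2⌋ (ℕ.⌊n/2⌋≤⌈n/2⌉ n) ⟩
    ℕ.⌊ n /2⌋ ℕ.+ ℕ.⌈ n /2⌉                  ≡⟨ ℕ.⌊n/2⌋+⌈n/2⌉≡n n ⟩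
    n                                        ∎
    where
    open ℕ.≤-Reasoning
    1≤log : 1 ℕ.≤ ⌊log₂ n ⌋
    1≤log = ℕ.≤-trans (ℕ.≤-reflexive (sym (⌊log₂[2^n]⌋≡n 1))) (⌊log₂⌋-mono-≤ {2} {n}
        (ℕ.s≤s (ℕ.s≤s ℕ.z≤n)))

tower : ℕ → ℕ → ℕ
tower zero    m = m
tower (suc s) m = tower s (2 ℕ.^ m)

tower-mono : ∀ s {l m} → l ℕ.≤ m → tower s l ℕ.≤ tower s m
tower-mono zero    l≤m = l≤m
tower-mono (suc s) l≤m = tower-mono s (ℕ.^-monoʳ-≤ 2 l≤m)

s+m≤tower : ∀ s m → s ℕ.+ m ℕ.≤ tower s m
s+m≤tower zero    m = ℕ.≤-refl
s+m≤tower (suc s) m = ℕ.≤-trans (ℕ.≤-trans (ℕ.≤-reflexive (sym (ℕ.+-suc s m)))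
    (ℕ.+-monoʳ-≤ s (m<2^m m))) (s+m≤tower s (2 ℕ.^ m))

-- The logarithms are undone one at a time. Positivity excludes the conventional value 0 of the
-- logarithm of 0, where exponentiating would overshoot.
tower≤ : ∀ s {m n} → 0 ℕ.< m → m ℕ.≤ log^ s n → tower s m ℕ.≤ n
tower≤ zero            0<m m≤ = m≤
tower≤ (suc s) {m} {n} 0<m m≤ = tower≤ s (ℕ.m^n>0 2 m) (ℕ.≤-trans (ℕ.^-monoʳ-≤ 2 m≤)
    (2^⌊log₂n⌋≤n (log^ s n) (positive (log^ s n) (ℕ.≤-trans 0<m m≤))))
  where
  positive : ∀ l → 0 ℕ.< ⌊log₂ l ⌋ → 0 ℕ.< l
  positive (suc l) _ = ℕ.s≤s ℕ.z≤n

log^-+ : ∀ s r n → log^ (s ℕ.+ r) n ≡ log^ s (log^ r n)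
log^-+ zero    r n = refl
log^-+ (suc s) r n = cong ⌊log₂_⌋ (log^-+ s r n)

-- The additive constant `q` pays for the top of the tower: if `q` further logarithms still leave at
-- least 2, then the r-th iterate is at least `tower q 2`, which exceeds `q`.
log*>⇒tower≤ : ∀ {q} r n → 0 ℕ.< q → q ℕ.+ r ℕ.< log* n → tower r q ℕ.≤ n
log*>⇒tower≤ {q} r n 0<q q+r<log* = tower≤ r 0<q (begin
  q                 ≤⟨ ℕ.m≤m+n q 2 ⟩
  q ℕ.+ 2           ≤⟨ s+m≤tower q 2 ⟩
  tower q 2         ≤⟨ tower≤ q (ℕ.s≤s ℕ.z≤n) (subst (2 ℕ.≤_) (log^-+ q r n) 2≤log^) ⟩
  log^ r n          ∎)
  where
  open ℕ.≤-Reasoning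
  2≤log^ : 2 ℕ.≤ log^ (q ℕ.+ r) n
  2≤log^ = ℕ.≮⇒≥ (λ small → ℕ.<⇒≱ q+r<log* (proj₂ (proj₂ (log*-exists n)) (q ℕ.+ r) small))

module TowerGrowth (C : ℕ) where
  open Growth C

  -- By `next≤` the exponent of 2 in `next N` is at most N² + N² + 2N²(C + 5), which is `c` times
  -- N².
  c : ℕ
  c = 2 ℕ.* C ℕ.+ 12

  -- The factor 3c absorbs the polynomial overhead of next, which thus costs exactly
  -- one exponential and not a bounded number of them.
  potential : ℕ → ℕ
  potential N = 3 ℕ.* c ℕ.* (N ℕ.* N)

  N≤potential : ∀ N → N ℕ.≤ potential N
  N≤potential N = ℕ.≤-trans (m≤m*m N) (ℕ.m≤n*m (N ℕ.* N) (3 ℕ.* c) ⦃ ℕ.m*n≢0 3 c ⦃ _ ⦄ ⦃ c≢0 ⦄ ⦄)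
    where
    c≢0 : ℕ.NonZero c
    c≢0 = ℕ.>-nonZero (ℕ.m≤n⇒m≤o+n (2 ℕ.* C) (ℕ.s≤s ℕ.z≤n))

  3c≤2^c : 3 ℕ.* c ℕ.≤ 2 ℕ.^ c
  3c≤2^c = subst (λ c → 3 ℕ.* c ℕ.≤ 2 ℕ.^ c) (eq C) (3[4+j]≤ (2 ℕ.* C ℕ.+ 8))
    where
    eq : ∀ C → 4 ℕ.+ (2 ℕ.* C ℕ.+ 8) ≡ 2 ℕ.* C ℕ.+ 12
    eq = ℕ-Solver.solve-∀
    3[4+j]≤ : ∀ j → 3 ℕ.* (4 ℕ.+ j) ℕ.≤ 2 ℕ.^ (4 ℕ.+ j)
    3[4+j]≤ zero    = ℕ.≤ᵇ⇒≤ 12 16 _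
    3[4+j]≤ (suc j) = begin
      3 ℕ.* (4 ℕ.+ suc j)                           ≡⟨ eq′ j ⟩
      3 ℕ.+ 3 ℕ.* (4 ℕ.+ j)
          ≤⟨ ℕ.+-mono-≤ (ℕ.≤-trans (ℕ.≤-trans (ℕ.m≤m+n 3 9) (ℕ.*-monoʳ-≤ 3 (ℕ.m≤m+n 4 j)))
          (3[4+j]≤ j)) (3[4+j]≤ j) ⟩
      2 ℕ.^ (4 ℕ.+ j) ℕ.+ 2 ℕ.^ (4 ℕ.+ j)           ≡⟨ cong (2 ℕ.^ (4 ℕ.+ j) ℕ.+_) (ℕ.+-identityʳ _)
          ⟨
      2 ℕ.^ suc (4 ℕ.+ j)                           ∎
      where
      open ℕ.≤-Reasoning
      eq′ : ∀ j → 3 ℕ.* (4 ℕ.+ suc j) ≡ 3 ℕ.+ 3 ℕ.* (4 ℕ.+ j)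
      eq′ = ℕ-Solver.solve-∀

  next≤ : ∀ N → 0 ℕ.< N → next N ℕ.≤ 2 ℕ.^ (c ℕ.* (N ℕ.* N))
  next≤ N 0<N = begin
    N ℕ.* 2 ℕ.^ suc (exponent N)              ≤⟨ ℕ.*-monoˡ-≤ _ (m≤2^m N) ⟩
    2 ℕ.^ N ℕ.* 2 ℕ.^ suc (exponent N)        ≡⟨ ℕ.^-distribˡ-+-* 2 N _ ⟨
    2 ℕ.^ (N ℕ.+ suc (exponent N))            ≤⟨ ℕ.^-monoʳ-≤ 2 (ℕ.+-mono-≤ (m≤m*m N)
        (ℕ.+-monoˡ-≤ (exponent N) (ℕ.*-mono-≤ 0<N 0<N))) ⟩
    2 ℕ.^ (N ℕ.* N ℕ.+ (N ℕ.* N ℕ.+ exponent N))    ≡⟨ cong (2 ℕ.^_) (eq (N ℕ.* N) C) ⟩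
    2 ℕ.^ (c ℕ.* (N ℕ.* N))                   ∎
    where
    open ℕ.≤-Reasoning
    eq : ∀ q C → q ℕ.+ (q ℕ.+ 2 ℕ.* q ℕ.* (C ℕ.+ 5)) ≡ (2 ℕ.* C ℕ.+ 12) ℕ.* q
    eq = ℕ-Solver.solve-∀

  -- `potential N` is three times the exponent that bounds `next N`: two of the three parts pay for
  -- the square of `next N`, and the third for the factor 3c.
  potential-next : ∀ N → 0 ℕ.< N → potential (next N) ℕ.≤ 2 ℕ.^ potential N
  potential-next N 0<N = begin
    3 ℕ.* c ℕ.* (next N ℕ.* next N)
      ≤⟨ ℕ.*-mono-≤ (ℕ.≤-trans 3c≤2^c (ℕ.^-monoʳ-≤ 2 (ℕ.m≤m*n c (N ℕ.* N)
          ⦃ ℕ.>-nonZero (ℕ.*-mono-≤ 0<N 0<N) ⦄))) (ℕ.*-mono-≤ (next≤ N 0<N) (next≤ N 0<N)) ⟩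
    2 ℕ.^ e ℕ.* (2 ℕ.^ e ℕ.* 2 ℕ.^ e)
      ≡⟨ trans (cong (2 ℕ.^ e ℕ.*_) (sym (ℕ.^-distribˡ-+-* 2 e e)))
          (sym (ℕ.^-distribˡ-+-* 2 e (e ℕ.+ e))) ⟩
    2 ℕ.^ (e ℕ.+ (e ℕ.+ e))
      ≡⟨ cong (2 ℕ.^_) (eq c (N ℕ.* N)) ⟩
    2 ℕ.^ potential N ∎
    where
    open ℕ.≤-Reasoning
    e = c ℕ.* (N ℕ.* N)
    eq : ∀ c q → c ℕ.* q ℕ.+ (c ℕ.* q ℕ.+ c ℕ.* q) ≡ 3 ℕ.* c ℕ.* q
    eq = ℕ-Solver.solve-∀

  grow≤tower : ∀ s N → 0 ℕ.< N → grow s N ℕ.≤ tower s (potential N)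
  grow≤tower s N 0<N = ℕ.≤-trans (N≤potential (grow s N)) (potential-grow s N 0<N)
    where
    potential-grow : ∀ s N → 0 ℕ.< N → potential (grow s N) ℕ.≤ tower s (potential N)
    potential-grow zero    N 0<N = ℕ.≤-refl
    potential-grow (suc s) N 0<N = ℕ.≤-trans (potential-grow s (next N) (ℕ.≤-trans 0<N (N≤next N)))
        (tower-mono s (potential-next N 0<N))

-- The lower bound on the number of rounds

module _ {c ℓ₁ ℓ₂ a e : Level} (C N : ℕ) (2⁸≤N : 2 ℕ.^ 8 ℕ.≤ N) where
  open TowerGrowth C using (potential; N≤potential; grow≤tower)

  rounds-bound : ∀ (n : ℕ) → 1 ℕ.≤ n → (K : OrderedCommutativeRing c ℓ₁ ℓ₂)
    (S : ProbabilitySpace K a e) →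
    ∀ (r : ℕ) (Π : ProbabilisticProtocol S (EEInput n) (EEInput n) (C ℕ.* n) r) →
    Error≤⅓ S (EE n) Π → log* n ℕ.≤ suc (potential N) ℕ.+ r
  rounds-bound n 1≤n K S r Π error with log* n ℕ.≤? suc (potential N) ℕ.+ r
  ... | yes bound = bound
  ... | no  many  = contradiction
        (λ (x , y) → error x y)
        (Expectation.likely-event S (λ (x , y) → errorEvent S (EE n) Π x y) weight inputs
            (λ ω → hard first (protocol ω)))
    where
    open ProbabilisticProtocol Π
    0<N : 0 ℕ.< N
    0<N = ℕ.≤-trans (ℕ.s≤s ℕ.z≤n) 2⁸≤N
    large : Growth.grow C (suc r) N ℕ.≤ n
    -- The successor in the bound on `log* n` covers the one application of `next` in excess of the
    -- number of rounds.
    large = ℕ.≤-trans (grow≤tower (suc r) N 0<N) (log*>⇒tower≤ (suc r) n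
        (ℕ.≤-trans 0<N (N≤potential N))
      (ℕ.≤-trans (ℕ.≤-reflexive (cong suc (ℕ.+-suc (potential N) r))) (ℕ.≰⇒> many)))
    open Weights C n N 1≤n 2⁸≤N r large

corollary1 : ∀ {c ℓ₁ ℓ₂ a e : Level} (C : ℕ) → 0 ℕ.< C →
    ∃[ C′ ] (∀ (n : ℕ) → 1 ℕ.≤ n →
    (K : OrderedCommutativeRing c ℓ₁ ℓ₂) (S : ProbabilitySpace K a e) →
    ∀ (r : ℕ) (Π : ProbabilisticProtocol S (EEInput n) (EEInput n) (C ℕ.* n) r) →
    Error≤⅓ S (EE n) Π →
    log* n ℕ.≤ C′ ℕ.+ r)
corollary1 C _ = suc (TowerGrowth.potential C (2 ℕ.^ 8)) , rounds-bound C (2 ℕ.^ 8) ℕ.≤-refl
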